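{- Let $N(m,n)$ denote the number of maximum independent sets (distance-$2$ MDS codes) in the Doob graph $D(m,n)$. Then $$N(m,n)=2^{2^{2m+n-1}(1+o(1))}\qquad\text{as } 2m+n\to\infty,$$ i.e. $\log_2 N(m,n) = 2^{2m+n-1}(1+o(1))$ as $2m+n\to\infty$.
   Context: The Shrikhande graph $\mathrm{Sh}$ is the graph with vertex set $\mathbb{Z}_4^2$ in which $u$ and $v$ are adjacent iff $u-v\in\{\pm(1,0),\pm(0,1),\pm(1,1)\}$. $K_4$ is the complete graph on $4$ vertices. For integers $m,n\ge 0$, $D(m,n)$ is the Cartesian product of $m$ copies of $\mathrm{Sh}$ and $n$ copies of $K_4$ (for $m=0$ this is the Hamming graph $H(n,4)$). The independence number of $D(m,n)$ is $4^{2m+n-1}$, and a maximum independent set in $D(m,n)$ (an independent set of size $4^{2m+n-1}$) is called an MDS code. -}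

module Defs where

open import Data.Nat using (ℕ; zero; suc; _+_; _*_; _∸_; _^_; _≡ᵇ_)
open import Data.Nat.DivMod using (_%_)
open import Data.Fin using (Fin; toℕ)
open import Data.Fin.Properties using (_≟_)
open import Data.Bool using (Bool; true; false; _∧_; _∨_; not)
open import Data.Product using (_×_; _,_)
open import Data.List using (List; []; _∷_; map; concatMap; length; filterᵇ; allFin)
open import Data.Vec using (Vec; []; _∷_)
open import Relation.Nullary.Decidable using (⌊_⌋)

diff4 : Fin 4 → Fin 4 → ℕ
diff4 a b = (toℕ a + 4 ∸ toℕ b) % 4

eqF : Fin 4 → Fin 4 → Bool
eqF a b = ⌊ a ≟ b ⌋

-- Shrikhande graph on Z_4^2: u ~ v iff u - v ∈ {±(1,0), ±(0,1), ±(1,1)}.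
ShV : Set
ShV = Fin 4 × Fin 4

isD : ℕ → ℕ → ℕ → ℕ → Bool
isD d1 d2 e1 e2 = (d1 ≡ᵇ e1) ∧ (d2 ≡ᵇ e2)

adjSh : ShV → ShV → Bool
adjSh (u1 , u2) (v1 , v2) =
  let d1 = diff4 u1 v1 ; d2 = diff4 u2 v2 in
  isD d1 d2 1 0 ∨ isD d1 d2 3 0 ∨ isD d1 d2 0 1 ∨ isD d1 d2 0 3
    ∨ isD d1 d2 1 1 ∨ isD d1 d2 3 3

eqSh : ShV → ShV → Bool
eqSh (u1 , u2) (v1 , v2) = eqF u1 v1 ∧ eqF u2 v2

adjK : Fin 4 → Fin 4 → Bool
adjK a b = not (eqF a b)

eqVec : {A : Set} → (A → A → Bool) → {k : ℕ} → Vec A k → Vec A k → Bool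
eqVec e [] [] = true
eqVec e (x ∷ xs) (y ∷ ys) = e x y ∧ eqVec e xs ys

adjProd : {A : Set} → (A → A → Bool) → (A → A → Bool) →
          {k : ℕ} → Vec A k → Vec A k → Bool
adjProd e a [] [] = false
adjProd e a (x ∷ xs) (y ∷ ys) =
  (a x y ∧ eqVec e xs ys) ∨ (e x y ∧ adjProd e a xs ys)

Vert : ℕ → ℕ → Set
Vert m n = Vec ShV m × Vec (Fin 4) n

adjD : {m n : ℕ} → Vert m n → Vert m n → Bool
adjD (s , k) (s' , k') =
  (adjProd eqSh adjSh s s' ∧ eqVec eqF k k')
    ∨ (eqVec eqSh s s' ∧ adjProd eqF adjK k k')

vecs : {A : Set} → List A → (k : ℕ) → List (Vec A k)
vecs xs zero = [] ∷ []
vecs xs (suc k) = concatMap (λ x → map (x ∷_) (vecs xs k)) xs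

cart : {A B : Set} → List A → List B → List (A × B)
cart xs ys = concatMap (λ x → map (x ,_) ys) xs

verts : (m n : ℕ) → List (Vert m n)
verts m n = cart (vecs (cart (allFin 4) (allFin 4)) m) (vecs (allFin 4) n)

-- All sublists of a list; for a duplicate-free list these correspond
-- bijectively to the subsets of its set of elements.
sublists : {A : Set} → List A → List (List A)
sublists [] = [] ∷ []
sublists (x ∷ xs) = let r = sublists xs in map (x ∷_) r Data.List.++ r

allᵇ : {A : Set} → (A → Bool) → List A → Bool
allᵇ p [] = true
allᵇ p (x ∷ xs) = p x ∧ allᵇ p xs

independent : {m n : ℕ} → List (Vert m n) → Bool
independent S = allᵇ (λ u → allᵇ (λ v → not (adjD u v)) S) S

isMDS : (m n : ℕ) → List (Vert m n) → Bool
isMDS m n S = independent S ∧ (length S ≡ᵇ 4 ^ (2 * m + n ∸ 1))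

N : ℕ → ℕ → ℕ
N m n = length (filterᵇ (isMDS m n) (sublists (verts m n)))

{-# OPTIONS --safe #-}

-- Write d = 2m + n. For the lower bound, each Sh splits into its four rows (4-cycles) and each K₄ into two
-- edges; the vertices then fall into 2^d products of even cycles and edges, 2^(d-1) of them of even parity,
-- and an MDS code arises by choosing one side of the bipartition of each even product.
--
-- For the upper bound, the sixteen maximum independent sets of Sh map injectively to maximum independent
-- sets of K₄ × K₄ so that disjoint sets stay disjoint; hence N(m+1,n) ≤ N(m,n+2), and it remains to count
-- Latin functions f on {0,1,2,3}^(d-1). Such an f is built up face by face, where the face of a set I of
-- coordinates consists of the points that vanish outside I. Given f on the boundary of a face (the points
-- with a further zero), there are at most two ways to go on, so one bit per face suffices, unless the
-- boundary values are linear over the Klein group: three completions would take three values at one point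
-- C, and comparing them on the lines through C determines two of them everywhere and makes the boundary
-- linear. A linear boundary has one linear completion and boundedly many others. The faces on which f is
-- linear form a down-set, so extra bits are needed only once on every chain of faces, and most of the
-- 2^(d-1) faces can be covered by long chains.
module Submission where

open import Defs
open import Data.Bool using (Bool; true; false; T?; _∧_; _∨_; _xor_; if_then_else_; not)
open import Data.Bool.Properties using (T-≡; not-involutive) renaming (_≟_ to _≟ᵇ_)
open import Data.Empty using (⊥; ⊥-elim)
open import Data.Fin using (Fin; combine; remQuot; suc; zero)
open import Data.Fin.Properties using (_≟_; all?; any?; combine-injective; combine-remQuot; injective⇒≤)
open import Data.List using (List; []; _∷_; _++_; allFin; cartesianProductWith; concatMap; filterᵇ; length; map)
import Data.List as List
import Data.List.Membership.DecPropositional as DecMembership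
open import Data.List.Membership.Propositional using (_∈_; _∉_)
open import Data.List.Membership.Propositional.Properties using (∈-++⁺ʳ; ∈-++⁺ˡ; ∈-++⁻; ∈-allFin; ∈-concatMap⁺; ∈-lookup; ∈-map⁺; ∈-map⁻)
open import Data.List.Properties using (length-++; length-map; ≡-dec)
open import Data.List.Relation.Unary.All using (All; []; _∷_)
import Data.List.Relation.Unary.All as All
open import Data.List.Relation.Unary.All.Properties using (++⁺; concat⁺; map⁺)
open import Data.List.Relation.Unary.AllPairs using (AllPairs; []; _∷_)
import Data.List.Relation.Unary.AllPairs as AllPairs
import Data.List.Relation.Unary.AllPairs.Properties as AllPairs
open import Data.List.Relation.Unary.Any using (here; index; there)
import Data.List.Relation.Unary.Any as Any
open import Data.List.Relation.Unary.Any.Properties using (lookup-index)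
open import Data.List.Relation.Unary.Unique.Propositional using (Unique)
import Data.List.Relation.Unary.Unique.Propositional.Properties as Unique
open import Data.Nat using (ℕ; _*_; _+_; _<_; _^_; _∸_; _≤_; _≤?_; _≤ᵇ_; _≥_; s≤s; suc; zero; z≤n)
open import Data.Nat.Induction using (<-rec)
open import Data.Nat.Properties using (*-assoc; *-cancelˡ-≤; *-comm; *-distribˡ-+; *-identityʳ; *-mono-≤; *-monoʳ-≤; *-monoˡ-≤; *-zeroʳ; +-assoc; +-cancelʳ-≡; +-cancelʳ-≤; +-cancelˡ-≡; +-comm; +-identityʳ; +-mono-≤; +-monoʳ-≤; +-monoˡ-≤; +-suc; 1+n≰n; ^-*-assoc; ^-distribˡ-+-*; ^-monoʳ-≤; ^-monoˡ-≤; m+[n∸m]≡n; m^n>0; m∸n≤m; m≤m+n; m≤n*m; m≤n+m; m≤n⇒m≤1+n; n≤1+n; suc-injective; ≡ᵇ⇒≡; ≡⇒≡ᵇ; ≤-antisym; ≤-refl; ≤-reflexive; ≤-trans; ≤ᵇ⇒≤; module ≤-Reasoning)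
import Data.Nat.Properties as ℕ
open import Data.Nat.Solver using (module +-*-Solver)
open import Data.Product using (Σ; _,_; _×_; proj₁; proj₂; ∃)
import Data.Product.Properties as Product
open import Data.Sum using (_⊎_; [_,_]′; inj₁; inj₂)
import Data.Sum as Sum
open import Data.Vec using (Vec; []; _[_]≔_; _∷_; fromList; lookup; replicate; splitAt; tabulate; tail)
import Data.Vec as Vec
open import Data.Vec.Properties using (++-injective; []≔-commutes; []≔-idempotent; []≔-lookup; lookup-replicate; lookup∘tabulate; lookup∘updateAt; lookup∘updateAt′; ∷-injective)
import Data.Vec.Properties as Vec
open import Function using (_∘_)
open import Function.Bundles using (Equivalence)
open import Relation.Binary.PropositionalEquality
open import Relation.Nullary using (Dec; does; no; yes; ¬_)
open import Relation.Nullary.Decidable using (_×-dec_; _→-dec_; _⊎-dec_; decidable-stable; from-yes; map′; ¬?; ⌊_⌋)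

-- One bit per face would already give the right exponent; the obstacle is the linear boundaries,
-- whose completions need three further bits. These bits come from the deviation from the linear
-- completion: a nonzero deviation a, once it is present anywhere in the interior, fills the whole
-- subgrid of points with no coordinate part equal to a, so it is enough to know which of the three
-- values occur. A chain of l faces thus costs l + 4 bits. Chains of length L + 1 have an overhead
-- of about 4/(L + 1), and the fraction of faces left alone after B blocks is (p/q)^B with q = 2^L
-- and p = q - L - 1, which tends to 0 for fixed L.
--
-- At a triple point C, coordinates are relabelled so that C becomes the origin and the boundary
-- becomes the set of points with a coordinate 3; the colours are relabelled too. Linearity survives
-- this because every permutation of four elements is affine over the Klein group. In the new names
-- two of the completions are the sum function altered only on the boxes {0,2}^n and {0,1}^n, and
-- both boxes miss the boundary.

infixl 6 _⊕_

pattern 𝟎 = zero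
pattern 𝟏 = suc zero
pattern 𝟐 = suc (suc zero)
pattern 𝟑 = suc (suc (suc zero))

-- Addition of the Klein four-group on {0,1,2,3}.
_⊕_ : Fin 4 → Fin 4 → Fin 4
𝟎 ⊕ b = b
𝟏 ⊕ 𝟎 = 𝟏
𝟏 ⊕ 𝟏 = 𝟎
𝟏 ⊕ 𝟐 = 𝟑
𝟏 ⊕ 𝟑 = 𝟐
𝟐 ⊕ 𝟎 = 𝟐
𝟐 ⊕ 𝟏 = 𝟑
𝟐 ⊕ 𝟐 = 𝟎
𝟐 ⊕ 𝟑 = 𝟏
𝟑 ⊕ 𝟎 = 𝟑
𝟑 ⊕ 𝟏 = 𝟐
𝟑 ⊕ 𝟐 = 𝟏
𝟑 ⊕ 𝟑 = 𝟎

abstract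
  ⊕-assoc : ∀ a b c → (a ⊕ b) ⊕ c ≡ a ⊕ (b ⊕ c)
  ⊕-assoc = from-yes (all? λ a → all? λ b → all? λ c → ((a ⊕ b) ⊕ c) ≟ (a ⊕ (b ⊕ c)))

abstract
  ⊕-self : ∀ a → a ⊕ a ≡ 𝟎
  ⊕-self = from-yes (all? λ a → (a ⊕ a) ≟ 𝟎)

abstract
  ⊕-identityʳ : ∀ a → a ⊕ 𝟎 ≡ a
  ⊕-identityʳ = from-yes (all? λ a → (a ⊕ 𝟎) ≟ a)

abstract
  ⊕-cancelʳ : ∀ a b → (a ⊕ b) ⊕ b ≡ a
  ⊕-cancelʳ = from-yes (all? λ a → all? λ b → ((a ⊕ b) ⊕ b) ≟ a)

⊕-injectiveˡ : ∀ a b c → a ⊕ c ≡ b ⊕ c → a ≡ b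
⊕-injectiveˡ a b c e = trans (sym (⊕-cancelʳ a c)) (trans (cong (_⊕ c) e) (⊕-cancelʳ b c))

abstract
  -- The four elements of the Klein group sum to 0.
  fourth : ∀ a b c → a ≢ b → b ≢ c → a ≢ c → ∀ d → d ≢ a → d ≢ b → d ≢ c → d ≡ a ⊕ b ⊕ c
  fourth = from-yes (all? λ a → all? λ b → all? λ c → ¬? (a ≟ b) →-dec ¬? (b ≟ c) →-dec ¬? (a ≟ c) →-dec
    all? λ d → ¬? (d ≟ a) →-dec ¬? (d ≟ b) →-dec ¬? (d ≟ c) →-dec (d ≟ (a ⊕ b ⊕ c)))

-- Latin functions and the boundary of the grid

Point : ℕ → Set
Point = Vec (Fin 4)

data Adj : ∀ {n} → Point n → Point n → Set where
  here  : ∀ {n a b} {x : Point n} → a ≢ b → Adj (a ∷ x) (b ∷ x)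
  there : ∀ {n a} {x y : Point n} → Adj x y → Adj (a ∷ x) (a ∷ y)

-- These are the Latin hypercubes of order 4, that is, the proper 4-colourings of H(n,4).
Latin : ∀ {n} → (Point n → Fin 4) → Set
Latin f = ∀ {x y} → Adj x y → f x ≢ f y

HasZero Interior : ∀ {n} → Point n → Set
HasZero x = ∃ λ i → lookup x i ≡ 𝟎
Interior x = ∀ i → lookup x i ≢ 𝟎

adj-update : ∀ {n} (x : Point n) i {t} → t ≢ lookup x i → Adj (x [ i ]≔ t) x
adj-update (a ∷ x) zero t≢ = here t≢
adj-update (a ∷ x) (suc i) t≢ = there (adj-update x i t≢)

latin-update : ∀ {n} {f : Point n → Fin 4} → Latin f → ∀ x i {t} → t ≢ lookup x i → f (x [ i ]≔ t) ≢ f x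
latin-update Lf x i t≢ = Lf (adj-update x i t≢)

latin-slice : ∀ {n} {f : Point (suc n) → Fin 4} → Latin f → ∀ a → Latin (λ x → f (a ∷ x))
latin-slice Lf a p = Lf (there p)

lookup-updated : ∀ {n} (x : Point n) i t → lookup (x [ i ]≔ t) i ≡ t
lookup-updated x i t = lookup∘updateAt i x

lookup-other : ∀ {n} (x : Point n) i j t → j ≢ i → lookup (x [ i ]≔ t) j ≡ lookup x j
lookup-other x i j t j≢i = lookup∘updateAt′ j i j≢i x

-- Three completions of one boundary: a triple point or two that coincide

Inj : (Fin 4 → Fin 4) → Set
Inj u = ∀ {s t} → s ≢ t → u s ≢ u t

private
  exhaust : ∀ a b c d → a ≢ b → a ≢ c → a ≢ d → b ≢ c → b ≢ d → c ≢ d → ∀ e → e ≢ a → e ≢ b → e ≢ c → e ≡ d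
  exhaust a b c d ab ac ad bc bd cd e ea eb ec =
    trans (fourth a b c ab bc ac e ea eb ec) (sym (fourth a b c ab bc ac d (≢-sym ad) (≢-sym bd) (≢-sym cd)))

-- Lists the nonzero colours in an arbitrary order, so that one argument serves all six orders.
record Frame (a b c : Fin 4) : Set where
  field
    0a : 𝟎 ≢ a
    0b : 𝟎 ≢ b
    0c : 𝟎 ≢ c
    ab : a ≢ b
    ac : a ≢ c
    bc : b ≢ c

covered : ∀ {a b c} → Frame a b c → ∀ t → t ≡ 𝟎 ⊎ t ≡ a ⊎ t ≡ b ⊎ t ≡ c
covered {a} {b} {c} F t with t ≟ 𝟎 | t ≟ a | t ≟ b
... | yes p | _ | _ = inj₁ p
... | no _ | yes p | _ = inj₂ (inj₁ p)
... | no _ | no _ | yes p = inj₂ (inj₂ (inj₁ p))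
... | no p | no q | no r = inj₂ (inj₂ (inj₂ (exhaust 𝟎 a b c 0a 0b 0c ab ac bc t p q r)))
  where open Frame F

agree-fourth : ∀ {u v a b c} → Inj u → Inj v → Frame a b c →
  u 𝟎 ≡ v 𝟎 → u a ≡ v a → u b ≡ v b → ∀ t → u t ≡ v t
agree-fourth {u} {v} {a} {b} {c} Iu Iv F e0 ea eb t with covered F t
... | inj₁ refl = e0
... | inj₂ (inj₁ refl) = ea
... | inj₂ (inj₂ (inj₁ refl)) = eb
... | inj₂ (inj₂ (inj₂ refl)) =
  exhaust (v 𝟎) (v a) (v b) (v c) (Iv 0a) (Iv 0b) (Iv 0c) (Iv ab) (Iv ac) (Iv bc) (u c)
    (λ p → Iu 0c (trans e0 (sym p))) (λ p → Iu ac (trans ea (sym p))) (λ p → Iu bc (trans eb (sym p)))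
  where open Frame F

-- If u b ≢ v b, then v b can only be u c, because u 𝟎 and u a are already taken by v 𝟎 and v a. But
-- then w has this colour both at b and at c.
agree-cross : ∀ {u v w a b c} → Inj u → Inj v → Inj w → Frame a b c → u 𝟎 ≡ v 𝟎 →
  u a ≡ v a → v b ≡ w b → u c ≡ w c → ∀ t → u t ≡ v t
agree-cross {u} {v} {w} {a} {b} {c} Iu Iv Iw F e0 uv vw uw with u b ≟ v b
... | yes p = agree-fourth Iu Iv F e0 uv p
... | no p = ⊥-elim (Iw bc (trans (sym vw) (trans vb≡uc uw)))
  where
  open Frame F
  vb≡uc : v b ≡ u c
  vb≡uc = exhaust (u 𝟎) (u a) (u b) (u c) (Iu 0a) (Iu 0b) (Iu 0c) (Iu ab) (Iu ac) (Iu bc) (v b)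
    (λ q → Iv 0b (sym (trans q e0))) (λ q → Iv ab (sym (trans q uv))) (λ q → p (sym q))

data Pair : Set where
  p₁₂ p₂₃ p₁₃ : Pair

AgreeOn : ∀ {A : Set} → Pair → (f g h : A → Fin 4) → Set
AgreeOn p₁₂ f g h = ∀ x → f x ≡ g x
AgreeOn p₂₃ f g h = ∀ x → g x ≡ h x
AgreeOn p₁₃ f g h = ∀ x → f x ≡ h x

record Triple {n} (f g h : Point n → Fin 4) : Set where
  constructor mkTriple
  field
    centre : Point n
    interior : Interior centre
    f≢g : f centre ≢ g centre
    g≢h : g centre ≢ h centre
    f≢h : f centre ≢ h centre

-- Induction on the dimension, slicing the first coordinate at 𝟏, 𝟐, 𝟑; the slice at 𝟎 lies in the
-- boundary. If no slice has a triple point, some pair coincides on each slice: a repeated pair then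
-- coincides on all lines by `agree-fourth`, and three different pairs are handled by `agree-cross`.
triple-point : ∀ {n} (f g h : Point n → Fin 4) → Latin f → Latin g → Latin h →
  (∀ x → HasZero x → f x ≡ g x) → (∀ x → HasZero x → g x ≡ h x) →
  Triple f g h ⊎ Σ Pair λ p → AgreeOn p f g h
triple-point {zero} f g h _ _ _ _ _ with f [] ≟ g [] | g [] ≟ h [] | f [] ≟ h []
... | yes p | _ | _ = inj₂ (p₁₂ , λ { [] → p })
... | no _ | yes p | _ = inj₂ (p₂₃ , λ { [] → p })
... | no _ | no _ | yes p = inj₂ (p₁₃ , λ { [] → p })
... | no p | no q | no r = inj₁ (mkTriple [] (λ ()) p q r)
triple-point {suc n} f g h Lf Lg Lh fg∂ gh∂ =
  merge (slice 𝟏 (λ ())) (slice 𝟐 (λ ())) (slice 𝟑 (λ ()))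
  where
  At : Fin 4 → Pair → Set
  At a p = AgreeOn p (λ x → f (a ∷ x)) (λ x → g (a ∷ x)) (λ x → h (a ∷ x))
  shift : ∀ {a} {x : Point n} → HasZero x → HasZero (a ∷ x)
  shift (i , p) = suc i , p
  slice : ∀ a → a ≢ 𝟎 → Triple f g h ⊎ Σ Pair (At a)
  slice a a≢0 with triple-point (λ x → f (a ∷ x)) (λ x → g (a ∷ x)) (λ x → h (a ∷ x))
    (latin-slice Lf a) (latin-slice Lg a) (latin-slice Lh a)
    (λ x z → fg∂ (a ∷ x) (shift z)) (λ x z → gh∂ (a ∷ x) (shift z))
  ... | inj₁ (mkTriple c ic p q r) = inj₁ (mkTriple (a ∷ c) (λ { zero → a≢0 ; (suc i) → ic i }) p q r)
  ... | inj₂ r = inj₂ r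
  line : ∀ {k : Point (suc n) → Fin 4} → Latin k → ∀ x → Inj (λ t → k (t ∷ x))
  line Lk x s≢t = Lk (here s≢t)
  F0 : ∀ x → f (𝟎 ∷ x) ≡ g (𝟎 ∷ x)
  F0 x = fg∂ _ (zero , refl)
  G0 : ∀ x → g (𝟎 ∷ x) ≡ h (𝟎 ∷ x)
  G0 x = gh∂ _ (zero , refl)
  same : ∀ {a b c} → Frame a b c → ∀ p → At a p → At b p → AgreeOn p f g h
  same F p₁₂ A B (t ∷ x) = agree-fourth (line Lf x) (line Lg x) F (F0 x) (A x) (B x) t
  same F p₂₃ A B (t ∷ x) = agree-fourth (line Lg x) (line Lh x) F (G0 x) (A x) (B x) t
  same F p₁₃ A B (t ∷ x) = agree-fourth (line Lf x) (line Lh x) F (trans (F0 x) (G0 x)) (A x) (B x) t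
  cross : ∀ {a b c} → Frame a b c → At a p₁₂ → At b p₂₃ → At c p₁₃ → Σ Pair λ p → AgreeOn p f g h
  cross F A B C = p₁₂ , λ { (t ∷ x) → agree-cross (line Lf x) (line Lg x) (line Lh x) F (F0 x) (A x) (B x) (C x) t }
  frame : ∀ {a b c} → 𝟎 ≢ a → 𝟎 ≢ b → 𝟎 ≢ c → a ≢ b → a ≢ c → b ≢ c → Frame a b c
  frame p q r s t u = record { 0a = p ; 0b = q ; 0c = r ; ab = s ; ac = t ; bc = u }
  F123 : Frame 𝟏 𝟐 𝟑
  F123 = frame (λ ()) (λ ()) (λ ()) (λ ()) (λ ()) (λ ())
  F132 : Frame 𝟏 𝟑 𝟐
  F132 = frame (λ ()) (λ ()) (λ ()) (λ ()) (λ ()) (λ ())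
  F231 : Frame 𝟐 𝟑 𝟏
  F231 = frame (λ ()) (λ ()) (λ ()) (λ ()) (λ ()) (λ ())
  F213 : Frame 𝟐 𝟏 𝟑
  F213 = frame (λ ()) (λ ()) (λ ()) (λ ()) (λ ()) (λ ())
  F312 : Frame 𝟑 𝟏 𝟐
  F312 = frame (λ ()) (λ ()) (λ ()) (λ ()) (λ ()) (λ ())
  F321 : Frame 𝟑 𝟐 𝟏
  F321 = frame (λ ()) (λ ()) (λ ()) (λ ()) (λ ()) (λ ())
  pairs : ∀ p q r → At 𝟏 p → At 𝟐 q → At 𝟑 r → Σ Pair λ p → AgreeOn p f g h
  pairs p₁₂ p₁₂ r A B C = p₁₂ , same F123 p₁₂ A B
  pairs p₂₃ p₂₃ r A B C = p₂₃ , same F123 p₂₃ A B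
  pairs p₁₃ p₁₃ r A B C = p₁₃ , same F123 p₁₃ A B
  pairs p₁₂ p₂₃ p₁₂ A B C = p₁₂ , same F132 p₁₂ A C
  pairs p₁₂ p₂₃ p₂₃ A B C = p₂₃ , same F231 p₂₃ B C
  pairs p₁₂ p₂₃ p₁₃ A B C = cross F123 A B C
  pairs p₁₂ p₁₃ p₁₂ A B C = p₁₂ , same F132 p₁₂ A C
  pairs p₁₂ p₁₃ p₂₃ A B C = cross F132 A C B
  pairs p₁₂ p₁₃ p₁₃ A B C = p₁₃ , same F231 p₁₃ B C
  pairs p₂₃ p₁₂ p₁₂ A B C = p₁₂ , same F231 p₁₂ B C
  pairs p₂₃ p₁₂ p₂₃ A B C = p₂₃ , same F132 p₂₃ A C
  pairs p₂₃ p₁₂ p₁₃ A B C = cross F213 B A C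
  pairs p₂₃ p₁₃ p₁₂ A B C = cross F312 C A B
  pairs p₂₃ p₁₃ p₂₃ A B C = p₂₃ , same F132 p₂₃ A C
  pairs p₂₃ p₁₃ p₁₃ A B C = p₁₃ , same F231 p₁₃ B C
  pairs p₁₃ p₁₂ p₁₂ A B C = p₁₂ , same F231 p₁₂ B C
  pairs p₁₃ p₁₂ p₂₃ A B C = cross F231 B C A
  pairs p₁₃ p₁₂ p₁₃ A B C = p₁₃ , same F132 p₁₃ A C
  pairs p₁₃ p₂₃ p₁₂ A B C = cross F321 C B A
  pairs p₁₃ p₂₃ p₂₃ A B C = p₂₃ , same F231 p₂₃ B C
  pairs p₁₃ p₂₃ p₁₃ A B C = p₁₃ , same F132 p₁₃ A C
  merge : Triple f g h ⊎ Σ Pair (At 𝟏) → Triple f g h ⊎ Σ Pair (At 𝟐) → Triple f g h ⊎ Σ Pair (At 𝟑) →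
    Triple f g h ⊎ Σ Pair λ p → AgreeOn p f g h
  merge (inj₁ t) _ _ = inj₁ t
  merge _ (inj₁ t) _ = inj₁ t
  merge _ _ (inj₁ t) = inj₁ t
  merge (inj₂ (p , A)) (inj₂ (q , B)) (inj₂ (r , C)) = inj₂ (pairs p q r A B C)

-- The sum function, weights of points, and boxes

⨁ : ∀ {n} → Point n → Fin 4
⨁ [] = 𝟎
⨁ (a ∷ x) = a ⊕ ⨁ x

⨁-update : ∀ {n} (x : Point n) i t → ⨁ (x [ i ]≔ t) ≡ ⨁ x ⊕ (lookup x i ⊕ t)
⨁-update (a ∷ x) zero t = lemma a (⨁ x) t
  where
  lemma : ∀ a s t → t ⊕ s ≡ (a ⊕ s) ⊕ (a ⊕ t)
  lemma = from-yes (all? λ a → all? λ s → all? λ t → (t ⊕ s) ≟ ((a ⊕ s) ⊕ (a ⊕ t)))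
⨁-update (a ∷ x) (suc i) t = trans (cong (a ⊕_) (⨁-update x i t)) (sym (⊕-assoc a (⨁ x) _))

weight : ∀ {n} → (Fin 4 → ℕ) → Point n → ℕ
weight w [] = 0
weight w (a ∷ x) = w a + weight w x

weight-update : ∀ {n} w (x : Point n) i t → weight w (x [ i ]≔ t) + w (lookup x i) ≡ weight w x + w t
weight-update w (a ∷ x) zero t =
  trans (+-comm (w t + weight w x) (w a)) (trans (cong (w a +_) (+-comm (w t) _)) (sym (+-assoc (w a) _ _)))
weight-update w (a ∷ x) (suc i) t =
  trans (+-assoc (w a) _ _) (trans (cong (w a +_) (weight-update w x i t)) (sym (+-assoc (w a) _ _)))

weight-drop : ∀ {n} w (x : Point n) i t → w (lookup x i) ≡ 1 → w t ≡ 0 → suc (weight w (x [ i ]≔ t)) ≡ weight w x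
weight-drop w x i t p q = begin
  suc (weight w (x [ i ]≔ t)) ≡⟨ +-comm 1 _ ⟩
  weight w (x [ i ]≔ t) + 1 ≡⟨ cong (weight w (x [ i ]≔ t) +_) p ⟨
  weight w (x [ i ]≔ t) + w (lookup x i) ≡⟨ weight-update w x i t ⟩
  weight w x + w t ≡⟨ cong (weight w x +_) q ⟩
  weight w x + 0 ≡⟨ +-identityʳ _ ⟩
  weight w x ∎
  where open ≡-Reasoning

nonzero : Fin 4 → ℕ
nonzero 𝟎 = 0
nonzero (suc _) = 1

nonzero-1 : ∀ {a} → a ≢ 𝟎 → nonzero a ≡ 1
nonzero-1 {𝟎} p = ⊥-elim (p refl)
nonzero-1 {suc _} _ = refl

is : Fin 4 → Fin 4 → ℕ
is v a with a ≟ v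
... | yes _ = 1
... | no _ = 0

is-1 : ∀ {v a} → a ≡ v → is v a ≡ 1
is-1 {v} {a} p with a ≟ v
... | yes _ = refl
... | no q = ⊥-elim (q p)

is-0 : ∀ {v a} → a ≢ v → is v a ≡ 0
is-0 {v} {a} p with a ≟ v
... | yes q = ⊥-elim (p q)
... | no _ = refl

∥_∥ : ∀ {n} → Point n → ℕ
∥ x ∥ = weight nonzero x

clear-< : ∀ {n} (x : Point n) i → lookup x i ≢ 𝟎 → ∥ x [ i ]≔ 𝟎 ∥ < ∥ x ∥
clear-< x i p = ≤-reflexive (weight-drop nonzero x i 𝟎 (nonzero-1 p) refl)

keep-≡ : ∀ {n} (x : Point n) i t → lookup x i ≢ 𝟎 → t ≢ 𝟎 → ∥ x [ i ]≔ t ∥ ≡ ∥ x ∥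
keep-≡ x i t p q = +-cancelʳ-≡ 1 _ _ (trans (cong (∥ x [ i ]≔ t ∥ +_) (sym (nonzero-1 p)))
  (trans (weight-update nonzero x i t) (cong (∥ x ∥ +_) (nonzero-1 q))))

Has : ∀ {n} → Fin 4 → Point n → Set
Has v x = ∃ λ i → lookup x i ≡ v

has? : ∀ {n} v (x : Point n) → Dec (Has v x)
has? v x = any? λ i → lookup x i ≟ v

Other : ∀ {n} → Fin 4 → Point n → Fin n → Set
Other v x i = ∃ λ j → j ≢ i × lookup x j ≡ v

other? : ∀ {n} v (x : Point n) i → Dec (Other v x i)
other? v x i = any? λ j → ¬? (j ≟ i) ×-dec (lookup x j ≟ v)

InBox : ∀ {n} → Fin 4 → Point n → Set
InBox u x = ∀ i → lookup x i ≡ 𝟎 ⊎ lookup x i ≡ u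

inBox? : ∀ {n} u (x : Point n) → Dec (InBox u x)
inBox? u x = all? λ i → (lookup x i ≟ 𝟎) ⊎-dec (lookup x i ≟ u)

abstract
  box : ∀ {n} → Fin 4 → Point n → Fin 4
  box u x with inBox? u x
  ... | yes _ = u
  ... | no _ = 𝟎

  box-in : ∀ {n} u (x : Point n) → InBox u x → box u x ≡ u
  box-in u x p with inBox? u x
  ... | yes _ = refl
  ... | no q = ⊥-elim (q p)

  box-out : ∀ {n} u (x : Point n) i → lookup x i ≢ 𝟎 → lookup x i ≢ u → box u x ≡ 𝟎
  box-out u x i p q with inBox? u x
  ... | yes r = ⊥-elim ([ p , q ]′ (r i))
  ... | no _ = refl

-- The linear function ⨁ with its values shifted by u on the box {0,u}ⁿ.
switched : ∀ {n} → Fin 4 → Point n → Fin 4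
switched u x = ⨁ x ⊕ box u x

-- Rigidity: colours on the axes determine two functions that agree where 𝟑 occurs

data Colours : Fin 4 → Fin 4 → Set where
  c12 : Colours 𝟏 𝟐
  c21 : Colours 𝟐 𝟏

-- The equations feed `exclude`: a neighbour reached by changing a to t, with box value b, forbids
-- the offset (a ⊕ t) ⊕ b. Abstracting over the two orders of 𝟏 and 𝟐 lets `Level` serve both
-- functions.
record Facts (u v : Fin 4) : Set where
  field
    u≢0 : u ≢ 𝟎
    v≢0 : v ≢ 𝟎
    u≢v : u ≢ v
    u≢3 : u ≢ 𝟑
    v≢3 : v ≢ 𝟑
    u+0 : (u ⊕ 𝟎) ⊕ 𝟎 ≡ u
    v+0 : (v ⊕ 𝟎) ⊕ 𝟎 ≡ v
    v+0+u : (v ⊕ 𝟎) ⊕ u ≡ 𝟑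
    u+0+u : (u ⊕ 𝟎) ⊕ u ≡ 𝟎
    3+0+u : (𝟑 ⊕ 𝟎) ⊕ u ≡ v
    u+3 : (u ⊕ 𝟑) ⊕ 𝟎 ≡ v
    v+3 : (v ⊕ 𝟑) ⊕ 𝟎 ≡ u
    3+u : (𝟑 ⊕ u) ⊕ 𝟎 ≡ v
    3+v : (𝟑 ⊕ v) ⊕ 𝟎 ≡ u
    u+v : (u ⊕ v) ⊕ 𝟎 ≡ 𝟑
    v+u : (v ⊕ u) ⊕ 𝟎 ≡ 𝟑
    only-0 : ∀ s y → y ≢ s ⊕ u → y ≢ s ⊕ v → y ≢ s ⊕ 𝟑 → y ≡ s ⊕ 𝟎
    only-u : ∀ s y → y ≢ s ⊕ 𝟎 → y ≢ s ⊕ v → y ≢ s ⊕ 𝟑 → y ≡ s ⊕ u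
    one-of : ∀ a → a ≡ 𝟎 ⊎ a ≡ u ⊎ a ≡ v ⊎ a ≡ 𝟑

facts : ∀ {u v} → Colours u v → Facts u v
facts c12 = record
  { u≢0 = λ () ; v≢0 = λ () ; u≢v = λ () ; u≢3 = λ () ; v≢3 = λ ()
  ; u+0 = refl ; v+0 = refl ; v+0+u = refl ; u+0+u = refl ; 3+0+u = refl ; u+3 = refl ; v+3 = refl
  ; 3+u = refl ; 3+v = refl ; u+v = refl ; v+u = refl
  ; only-0 = from-yes (all? λ s → all? λ y → ¬? (y ≟ (s ⊕ 𝟏)) →-dec ¬? (y ≟ (s ⊕ 𝟐)) →-dec ¬? (y ≟ (s ⊕ 𝟑)) →-dec (y ≟ (s ⊕ 𝟎)))
  ; only-u = from-yes (all? λ s → all? λ y → ¬? (y ≟ (s ⊕ 𝟎)) →-dec ¬? (y ≟ (s ⊕ 𝟐)) →-dec ¬? (y ≟ (s ⊕ 𝟑)) →-dec (y ≟ (s ⊕ 𝟏)))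
  ; one-of = λ { 𝟎 → inj₁ refl ; 𝟏 → inj₂ (inj₁ refl) ; 𝟐 → inj₂ (inj₂ (inj₁ refl)) ; 𝟑 → inj₂ (inj₂ (inj₂ refl)) } }
facts c21 = record
  { u≢0 = λ () ; v≢0 = λ () ; u≢v = λ () ; u≢3 = λ () ; v≢3 = λ ()
  ; u+0 = refl ; v+0 = refl ; v+0+u = refl ; u+0+u = refl ; 3+0+u = refl ; u+3 = refl ; v+3 = refl
  ; 3+u = refl ; 3+v = refl ; u+v = refl ; v+u = refl
  ; only-0 = from-yes (all? λ s → all? λ y → ¬? (y ≟ (s ⊕ 𝟐)) →-dec ¬? (y ≟ (s ⊕ 𝟏)) →-dec ¬? (y ≟ (s ⊕ 𝟑)) →-dec (y ≟ (s ⊕ 𝟎)))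
  ; only-u = from-yes (all? λ s → all? λ y → ¬? (y ≟ (s ⊕ 𝟎)) →-dec ¬? (y ≟ (s ⊕ 𝟏)) →-dec ¬? (y ≟ (s ⊕ 𝟑)) →-dec (y ≟ (s ⊕ 𝟐)))
  ; one-of = λ { 𝟎 → inj₁ refl ; 𝟐 → inj₂ (inj₁ refl) ; 𝟏 → inj₂ (inj₂ (inj₁ refl)) ; 𝟑 → inj₂ (inj₂ (inj₂ refl)) } }

Matches : ∀ {n} → Fin 4 → (Point n → Fin 4) → Point n → Set
Matches u g x = g x ≡ switched u x

-- The known colour of a neighbour, written as an offset from ⨁ x, is a colour that x may not
-- repeat. Three exclusions leave one offset; every value in `Level` is found in this way.
exclude : ∀ {n} {g : Point n → Fin 4} {u x} i {a t b d} → Latin g → lookup x i ≡ a → t ≢ a →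
  Matches u g (x [ i ]≔ t) → box u (x [ i ]≔ t) ≡ b → (a ⊕ t) ⊕ b ≡ d → g x ≢ ⨁ x ⊕ d
exclude {g = g} {u} {x} i {a} {t} {b} {d} Lg refl t≢a m e q gx =
  latin-update Lg x i t≢a (trans value (sym gx))
  where
  open ≡-Reasoning
  value : g (x [ i ]≔ t) ≡ ⨁ x ⊕ d
  value = begin
    g (x [ i ]≔ t) ≡⟨ m ⟩
    ⨁ (x [ i ]≔ t) ⊕ box u (x [ i ]≔ t) ≡⟨ cong₂ _⊕_ (⨁-update x i t) e ⟩
    (⨁ x ⊕ (a ⊕ t)) ⊕ b ≡⟨ ⊕-assoc (⨁ x) _ b ⟩
    ⨁ x ⊕ ((a ⊕ t) ⊕ b) ≡⟨ cong (⨁ x ⊕_) q ⟩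
    ⨁ x ⊕ d ∎

-- One step of an induction on the number N of nonzero coordinates. Points with a coordinate 𝟑 come
-- first: there g and h agree, so facts about one function restrict the other. The remaining points
-- then have settled neighbours with a 𝟑.
module Level {n} {u v : Fin 4} (col : Colours u v) (g h : Point n → Fin 4) (Lg : Latin g) (Lh : Latin h)
  (agree : ∀ x → Has 𝟑 x → g x ≡ h x) (N : ℕ)
  (IHg : ∀ y → ∥ y ∥ < N → Matches u g y) (IHh : ∀ y → ∥ y ∥ < N → Matches v h y) where

  open Facts (facts col)

  private
    3≢0 : _≢_ {A = Fin 4} 𝟑 𝟎
    3≢0 ()

    outside : ∀ (x : Point n) i {a} → lookup x i ≡ a → a ≢ 𝟎 → a ≢ u → box u x ≡ 𝟎
    outside x i refl p q = box-out u x i p q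

    outside′ : ∀ (x : Point n) i j t {a} → j ≢ i → lookup x j ≡ a → a ≢ 𝟎 → a ≢ u → box u (x [ i ]≔ t) ≡ 𝟎
    outside′ x i j t j≢i e p q = outside (x [ i ]≔ t) j (trans (lookup-other x i j t j≢i) e) p q

    differ : ∀ (x : Point n) {i j a b} → lookup x i ≡ a → lookup x j ≡ b → a ≢ b → i ≢ j
    differ x p q a≢b refl = a≢b (trans (sym p) q)

    here-other : ∀ (x : Point n) {i j t a} → j ≢ i → lookup x j ≡ a → Has a (x [ i ]≔ t)
    here-other x {i} {j} {t} j≢i e = j , trans (lookup-other x i j t j≢i) e

    here-new : ∀ (x : Point n) i t → Has t (x [ i ]≔ t)
    here-new x i t = i , lookup-updated x i t

    cleared : ∀ (x : Point n) i {a} → ∥ x ∥ ≡ N → lookup x i ≡ a → a ≢ 𝟎 → ∥ x [ i ]≔ 𝟎 ∥ < N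
    cleared x i refl refl p = clear-< x i p

    kept : ∀ (x : Point n) i t {a} → ∥ x ∥ ≡ N → lookup x i ≡ a → a ≢ 𝟎 → t ≢ 𝟎 → ∥ x [ i ]≔ t ∥ ≡ N
    kept x i t refl refl p q = keep-≡ x i t p q

    box-update : ∀ (x : Point n) i t → (∀ j → j ≢ i → lookup x j ≡ 𝟎 ⊎ lookup x j ≡ u) → t ≡ 𝟎 ⊎ t ≡ u → InBox u (x [ i ]≔ t)
    box-update x i t off p j with j ≟ i
    ... | yes refl = subst (λ a → a ≡ 𝟎 ⊎ a ≡ u) (sym (lookup-updated x i t)) p
    ... | no j≢i = subst (λ a → a ≡ 𝟎 ⊎ a ≡ u) (sym (lookup-other x i j t j≢i)) (off j j≢i)

    plain : ∀ (x : Point n) {i a} → lookup x i ≡ a → a ≢ 𝟎 → a ≢ u → g x ≡ ⨁ x ⊕ 𝟎 → Matches u g x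
    plain x {i} e p q r = trans r (cong (⨁ x ⊕_) (sym (outside x i e p q)))

  -- Clearing a u, a v or a 𝟑 excludes the offset of the same name, since another colour keeps the
  -- neighbour outside the u-box.
  all-colours : ∀ x → ∥ x ∥ ≡ N → Has u x → Has v x → Has 𝟑 x → Matches u g x
  all-colours x nx (i , xi) (j , xj) (k , xk) = plain x xk 3≢0 (≢-sym u≢3) (only-0 (⨁ x) (g x)
    (exclude i Lg xi (≢-sym u≢0) (IHg _ (cleared x i nx xi u≢0))
      (outside′ x i k 𝟎 (differ x xk xi (≢-sym u≢3)) xk 3≢0 (≢-sym u≢3)) u+0)
    (exclude j Lg xj (≢-sym v≢0) (IHg _ (cleared x j nx xj v≢0))
      (outside′ x j k 𝟎 (differ x xk xj (≢-sym v≢3)) xk 3≢0 (≢-sym u≢3)) v+0)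
    (exclude k Lg xk (≢-sym 3≢0) (IHg _ (cleared x k nx xk 3≢0))
      (outside′ x k j 𝟎 (differ x xj xk v≢3) xj v≢0 (≢-sym u≢v)) refl))

  private
    box-v : ∀ (x : Point n) i j → j ≢ i → lookup x j ≡ u → box v (x [ i ]≔ 𝟎) ≡ 𝟎
    box-v x i j j≢i e = box-out v _ j
      (λ p → u≢0 (trans (sym e) (trans (sym (lookup-other x i j 𝟎 j≢i)) p)))
      (λ p → u≢v (trans (sym e) (trans (sym (lookup-other x i j 𝟎 j≢i)) p)))

  -- Induction on the number k of coordinates 𝟑: of several 𝟑, one changed to v leads to
  -- `all-colours`, and one changed to u lowers k.
  two-colours : ∀ k x → weight (is 𝟑) x ≡ k → ∥ x ∥ ≡ N → ¬ Has v x → Has u x → Has 𝟑 x → Matches u g x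
  two-colours k x kx nx ¬v (j , xj) (i , xi) with other? 𝟑 x i
  two-colours k x kx nx ¬v (j , xj) (i , xi) | no ¬3 = plain x xi 3≢0 (≢-sym u≢3) (only-0 (⨁ x) (g x)
    (exclude j Lg xj (≢-sym u≢0) (IHg _ (cleared x j nx xj u≢0))
      (outside′ x j i 𝟎 (differ x xi xj (≢-sym u≢3)) xi 3≢0 (≢-sym u≢3)) u+0)
    -- Clearing the only 𝟑 enters the u-box, so g excludes v here instead of 𝟑. The offset 𝟑 is
    -- excluded through h: the u at j keeps the cleared point out of the v-box, where h is the plain
    -- sum, and g and h agree at x.
    (exclude i Lg xi (≢-sym 3≢0) (IHg _ (cleared x i nx xi 3≢0)) (box-in u _ (box-update x i 𝟎 off (inj₁ refl))) 3+0+u)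
    (λ p → exclude i Lh xi (≢-sym 3≢0) (IHh _ (cleared x i nx xi 3≢0))
      (box-v x i j (differ x xj xi u≢3) xj) refl (trans (sym (agree x (i , xi))) p)))
    where
    off : ∀ l → l ≢ i → lookup x l ≡ 𝟎 ⊎ lookup x l ≡ u
    off l l≢i with one-of (lookup x l)
    ... | inj₁ p = inj₁ p
    ... | inj₂ (inj₁ p) = inj₂ p
    ... | inj₂ (inj₂ (inj₁ p)) = ⊥-elim (¬v (l , p))
    ... | inj₂ (inj₂ (inj₂ p)) = ⊥-elim (¬3 (l , l≢i , p))
  two-colours zero x kx nx ¬v (j , xj) (i , xi) | yes _
    with () ← trans (weight-drop (is 𝟑) x i 𝟎 (is-1 xi) refl) kx
  two-colours (suc k) x kx nx ¬v (j , xj) (i , xi) | yes (l , l≢i , xl) =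
    plain x xi 3≢0 (≢-sym u≢3) (only-0 (⨁ x) (g x)
      (exclude i Lg xi v≢3 (all-colours _ (kept x i v nx xi 3≢0 v≢0) (here-other x j≢i xj) (here-new x i v) (here-other x l≢i xl))
        (outside′ x i l v l≢i xl 3≢0 (≢-sym u≢3)) 3+v)
      (exclude i Lg xi u≢3 (two-colours k (x [ i ]≔ u) kx′ (kept x i u nx xi 3≢0 u≢0) ¬v′ (here-new x i u) (here-other x l≢i xl))
        (outside′ x i l u l≢i xl 3≢0 (≢-sym u≢3)) 3+u)
      (exclude i Lg xi (≢-sym 3≢0) (IHg _ (cleared x i nx xi 3≢0)) (outside′ x i l 𝟎 l≢i xl 3≢0 (≢-sym u≢3)) refl))
    where
    j≢i = differ x xj xi u≢3
    kx′ : weight (is 𝟑) (x [ i ]≔ u) ≡ k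
    kx′ = suc-injective (trans (weight-drop (is 𝟑) x i u (is-1 xi) (is-0 u≢3)) kx)
    ¬v′ : ¬ Has v (x [ i ]≔ u)
    ¬v′ (m , p) with m ≟ i
    ... | yes refl = u≢v (trans (sym (lookup-updated x i u)) p)
    ... | no m≢i = ¬v (m , trans (sym (lookup-other x i m u m≢i)) p)

  -- The first parameter is `two-colours` with the functions and colours exchanged. The second
  -- supplies another nonzero coordinate when a single nonzero colour occurs; points of weight 1 lie
  -- on the axes, where the values are given.
  module Boundary (two-colours-h : ∀ x → ∥ x ∥ ≡ N → ¬ Has u x → Has v x → Has 𝟑 x → Matches v h x)
    (N≥2 : ∀ (x : Point n) → ∥ x ∥ ≡ N → ∀ i → ∃ λ j → j ≢ i × lookup x j ≢ 𝟎) where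

    private
      from-h : ∀ x → Has 𝟑 x → Matches v h x → Matches u g x
      from-h x (i , xi) m = trans (agree x (i , xi)) (trans m (cong (⨁ x ⊕_)
        (trans (box-out v x i (λ p → 3≢0 (trans (sym xi) p)) (λ p → v≢3 (trans (sym p) xi)))
          (sym (outside x i xi 3≢0 (≢-sym u≢3))))))

    boundary : ∀ x → ∥ x ∥ ≡ N → Has 𝟑 x → Matches u g x
    boundary x nx h3@(i , xi) with has? u x | has? v x
    ... | yes hu | yes hv = all-colours x nx hu hv h3
    ... | yes hu | no ¬v = two-colours _ x refl nx ¬v hu h3
    ... | no ¬u | yes hv = from-h x h3 (two-colours-h x nx ¬u hv h3)
    ... | no ¬u | no ¬v with N≥2 x nx i
    ... | j , j≢i , xj≢0 with one-of (lookup x j)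
    ... | inj₁ p = ⊥-elim (xj≢0 p)
    ... | inj₂ (inj₁ p) = ⊥-elim (¬u (j , p))
    ... | inj₂ (inj₂ (inj₁ p)) = ⊥-elim (¬v (j , p))
    -- Only 𝟎 and 𝟑 occur. The neighbour with one 𝟑 changed to v is known through h, the one with u
    -- through g.
    ... | inj₂ (inj₂ (inj₂ xj)) = plain x xi 3≢0 (≢-sym u≢3) (only-0 (⨁ x) (g x)
      (exclude i Lg xi v≢3 (from-h _ (here-other x j≢i xj) (two-colours-h _ (kept x i v nx xi 3≢0 v≢0)
          (avoid u ¬u v (≢-sym u≢v)) (here-new x i v) (here-other x j≢i xj)))
        (outside′ x i j v j≢i xj 3≢0 (≢-sym u≢3)) 3+v)
      (exclude i Lg xi u≢3 (two-colours _ _ refl (kept x i u nx xi 3≢0 u≢0)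
          (avoid v ¬v u u≢v) (here-new x i u) (here-other x j≢i xj))
        (outside′ x i j u j≢i xj 3≢0 (≢-sym u≢3)) 3+u)
      (exclude i Lg xi (≢-sym 3≢0) (IHg _ (cleared x i nx xi 3≢0)) (outside′ x i j 𝟎 j≢i xj 3≢0 (≢-sym u≢3)) refl))
      where
      avoid : ∀ a → ¬ Has a x → ∀ t → t ≢ a → ¬ Has a (x [ i ]≔ t)
      avoid a ¬a t t≢a (m , p) with m ≟ i
      ... | yes refl = t≢a (trans (sym (lookup-updated x i t)) p)
      ... | no m≢i = ¬a (m , trans (sym (lookup-other x i m t m≢i)) p)

    private
      to-3 : ∀ (x : Point n) i {a} → ∥ x ∥ ≡ N → lookup x i ≡ a → a ≢ 𝟎 → Matches u g (x [ i ]≔ 𝟑)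
      to-3 x i nx xi a≢0 = boundary _ (kept x i 𝟑 nx xi a≢0 3≢0) (here-new x i 𝟑)

      box-3 : ∀ (x : Point n) i → box u (x [ i ]≔ 𝟑) ≡ 𝟎
      box-3 x i = outside _ i (lookup-updated x i 𝟑) 3≢0 (≢-sym u≢3)

    -- Induction on the number k of coordinates v. Clearing the last v enters the u-box, whose shift
    -- makes it exclude 𝟑; if there are several, changing one of them to u excludes 𝟑.
    mixed : ∀ k x → weight (is v) x ≡ k → ∥ x ∥ ≡ N → ¬ Has 𝟑 x → Has v x → Has u x → Matches u g x
    mixed k x kx nx ¬3 (i , xi) (j , xj) with other? v x i
    mixed k x kx nx ¬3 (i , xi) (j , xj) | no ¬v = plain x xi v≢0 (≢-sym u≢v) (only-0 (⨁ x) (g x)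
      (exclude i Lg xi (≢-sym v≢3) (to-3 x i nx xi v≢0) (box-3 x i) v+3)
      (exclude j Lg xj (≢-sym u≢3) (to-3 x j nx xj u≢0) (box-3 x j) u+3)
      (exclude i Lg xi (≢-sym v≢0) (IHg _ (cleared x i nx xi v≢0)) (box-in u _ (box-update x i 𝟎 off (inj₁ refl))) v+0+u))
      where
      off : ∀ l → l ≢ i → lookup x l ≡ 𝟎 ⊎ lookup x l ≡ u
      off l l≢i with one-of (lookup x l)
      ... | inj₁ p = inj₁ p
      ... | inj₂ (inj₁ p) = inj₂ p
      ... | inj₂ (inj₂ (inj₁ p)) = ⊥-elim (¬v (l , l≢i , p))
      ... | inj₂ (inj₂ (inj₂ p)) = ⊥-elim (¬3 (l , p))
    mixed zero x kx nx ¬3 (i , xi) (j , xj) | yes _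
      with () ← trans (weight-drop (is v) x i 𝟎 (is-1 xi) (is-0 (≢-sym v≢0))) kx
    mixed (suc k) x kx nx ¬3 (i , xi) (j , xj) | yes (l , l≢i , xl) = plain x xi v≢0 (≢-sym u≢v) (only-0 (⨁ x) (g x)
      (exclude i Lg xi (≢-sym v≢3) (to-3 x i nx xi v≢0) (box-3 x i) v+3)
      (exclude i Lg xi (≢-sym v≢0) (IHg _ (cleared x i nx xi v≢0)) (outside′ x i l 𝟎 l≢i xl v≢0 (≢-sym u≢v)) v+0)
      (exclude i Lg xi u≢v (mixed k (x [ i ]≔ u) kx′ (kept x i u nx xi v≢0 u≢0) ¬3′ (here-other x l≢i xl) (here-new x i u))
        (outside′ x i l u l≢i xl v≢0 (≢-sym u≢v)) v+u))
      where
      kx′ : weight (is v) (x [ i ]≔ u) ≡ k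
      kx′ = suc-injective (trans (weight-drop (is v) x i u (is-1 xi) (is-0 u≢v)) kx)
      ¬3′ : ¬ Has 𝟑 (x [ i ]≔ u)
      ¬3′ (m , p) with m ≟ i
      ... | yes refl = u≢3 (trans (sym (lookup-updated x i u)) p)
      ... | no m≢i = ¬3 (m , trans (sym (lookup-other x i m u m≢i)) p)

    everywhere : ∀ x → ∥ x ∥ ≡ N → (∃ λ i → lookup x i ≢ 𝟎) → Matches u g x
    everywhere x nx (i , xi≢0) with has? 𝟑 x | has? u x | has? v x
    ... | yes h3 | _ | _ = boundary x nx h3
    ... | no ¬3 | yes hu | yes hv = mixed _ x refl nx ¬3 hv hu
    ... | no ¬3 | no ¬u | no ¬v with one-of (lookup x i)
    ... | inj₁ p = ⊥-elim (xi≢0 p)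
    ... | inj₂ (inj₁ p) = ⊥-elim (¬u (i , p))
    ... | inj₂ (inj₂ (inj₁ p)) = ⊥-elim (¬v (i , p))
    ... | inj₂ (inj₂ (inj₂ p)) = ⊥-elim (¬3 (i , p))
    everywhere x nx _ | no ¬3 | no ¬u | yes (i , xi) with N≥2 x nx i
    ... | j , j≢i , xj≢0 with one-of (lookup x j)
    ... | inj₁ p = ⊥-elim (xj≢0 p)
    ... | inj₂ (inj₁ p) = ⊥-elim (¬u (j , p))
    ... | inj₂ (inj₂ (inj₂ p)) = ⊥-elim (¬3 (j , p))
    ... | inj₂ (inj₂ (inj₁ xj)) = plain x xi v≢0 (≢-sym u≢v) (only-0 (⨁ x) (g x)
      (exclude i Lg xi (≢-sym v≢3) (to-3 x i nx xi v≢0) (box-3 x i) v+3)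
      (exclude i Lg xi (≢-sym v≢0) (IHg _ (cleared x i nx xi v≢0)) (outside′ x i j 𝟎 j≢i xj v≢0 (≢-sym u≢v)) v+0)
      (exclude i Lg xi u≢v (mixed _ (x [ i ]≔ u) refl (kept x i u nx xi v≢0 u≢0) ¬3′ (here-other x j≢i xj) (here-new x i u))
        (outside′ x i j u j≢i xj v≢0 (≢-sym u≢v)) v+u))
      where
      ¬3′ : ¬ Has 𝟑 (x [ i ]≔ u)
      ¬3′ (m , p) with m ≟ i
      ... | yes refl = u≢3 (trans (sym (lookup-updated x i u)) p)
      ... | no m≢i = ¬3 (m , trans (sym (lookup-other x i m u m≢i)) p)
    everywhere x nx _ | no ¬3 | yes (i , xi) | no ¬v with N≥2 x nx i
    ... | j , j≢i , xj≢0 with one-of (lookup x j)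
    ... | inj₁ p = ⊥-elim (xj≢0 p)
    ... | inj₂ (inj₂ (inj₁ p)) = ⊥-elim (¬v (j , p))
    ... | inj₂ (inj₂ (inj₂ p)) = ⊥-elim (¬3 (j , p))
    -- All nonzero coordinates are u, so x itself is in the u-box. The neighbours exclude 𝟎, v and 𝟑
    -- and leave the offset u.
    ... | inj₂ (inj₁ xj) = trans (only-u (⨁ x) (g x)
      (exclude i Lg xi (≢-sym u≢0) (IHg _ (cleared x i nx xi u≢0)) (box-in u _ (box-update x i 𝟎 off (inj₁ refl))) u+0+u)
      (exclude i Lg xi (≢-sym u≢3) (to-3 x i nx xi u≢0) (box-3 x i) u+3)
      (exclude i Lg xi (≢-sym u≢v) (mixed _ (x [ i ]≔ v) refl (kept x i v nx xi u≢0 v≢0) ¬3′ (here-new x i v) (here-other x j≢i xj))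
        (outside _ i (lookup-updated x i v) v≢0 (≢-sym u≢v)) u+v))
      (cong (⨁ x ⊕_) (sym (box-in u x in-box)))
      where
      in-box : InBox u x
      in-box l with one-of (lookup x l)
      ... | inj₁ p = inj₁ p
      ... | inj₂ (inj₁ p) = inj₂ p
      ... | inj₂ (inj₂ (inj₁ p)) = ⊥-elim (¬v (l , p))
      ... | inj₂ (inj₂ (inj₂ p)) = ⊥-elim (¬3 (l , p))
      off : ∀ l → l ≢ i → lookup x l ≡ 𝟎 ⊎ lookup x l ≡ u
      off l _ = in-box l
      ¬3′ : ¬ Has 𝟑 (x [ i ]≔ v)
      ¬3′ (m , p) with m ≟ i
      ... | yes refl = v≢3 (trans (sym (lookup-updated x i v)) p)
      ... | no m≢i = ¬3 (m , trans (sym (lookup-other x i m v m≢i)) p)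

-- Points on the axes and induction on the weight

lookup-ext : ∀ {A : Set} {n} (x y : Vec A n) → (∀ i → lookup x i ≡ lookup y i) → x ≡ y
lookup-ext [] [] e = refl
lookup-ext (a ∷ x) (b ∷ y) e = cong₂ _∷_ (e zero) (lookup-ext x y (e ∘ suc))

origin : ∀ {n} → Point n
origin = replicate _ 𝟎

axis : ∀ {n} → Fin n → Fin 4 → Point n
axis i t = origin [ i ]≔ t

axis-elsewhere : ∀ {n} {i j : Fin n} {t} → j ≢ i → lookup (axis i t) j ≡ 𝟎
axis-elsewhere {i = i} {j} {t} j≢i = trans (lookup-other origin i j t j≢i) (lookup-replicate j 𝟎)

∥zero∥ : ∀ {n} (x : Point n) → (∀ i → lookup x i ≡ 𝟎) → ∥ x ∥ ≡ 0
∥zero∥ [] e = refl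
∥zero∥ (a ∷ x) e rewrite e zero = ∥zero∥ x (e ∘ suc)

another-nonzero : ∀ {n} (x : Point n) → 2 ≤ ∥ x ∥ → ∀ i → ∃ λ j → j ≢ i × lookup x j ≢ 𝟎
another-nonzero x 2≤ i with any? (λ j → ¬? (j ≟ i) ×-dec ¬? (lookup x j ≟ 𝟎))
... | yes p = p
... | no ¬p = ⊥-elim (1+n≰n (≤-trans 2≤ small))
  where
  off : ∀ j → lookup (x [ i ]≔ 𝟎) j ≡ 𝟎
  off j with j ≟ i
  ... | yes refl = lookup-updated x i 𝟎
  ... | no j≢i = trans (lookup-other x i j 𝟎 j≢i) (decidable-stable (lookup x j ≟ 𝟎) (λ q → ¬p (j , j≢i , q)))
  nonzero≤1 : ∀ a → nonzero a ≤ 1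
  nonzero≤1 𝟎 = z≤n
  nonzero≤1 (suc _) = ≤-refl
  small : ∥ x ∥ ≤ 1
  small = ≤-trans (≤-reflexive (trans (sym (+-identityʳ _)) (trans (sym (weight-update nonzero x i 𝟎))
    (cong (_+ nonzero (lookup x i)) (∥zero∥ (x [ i ]≔ 𝟎) off))))) (nonzero≤1 (lookup x i))

two-nonzero : ∀ {n} (x : Point n) i j → j ≢ i → lookup x i ≢ 𝟎 → lookup x j ≢ 𝟎 → 2 ≤ ∥ x ∥
two-nonzero x i j j≢i p q = ≤-trans (s≤s (≤-trans (s≤s z≤n) (clear-< (x [ i ]≔ 𝟎) j (λ e → q (trans (sym (lookup-other x i j 𝟎 j≢i)) e)))))
  (clear-< x i p)

≤1-axis : ∀ {n} (x : Point (suc n)) → ¬ (2 ≤ ∥ x ∥) → ∃ λ i → x ≡ axis i (lookup x i)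
≤1-axis x ¬2 with any? (λ i → ¬? (lookup x i ≟ 𝟎))
... | yes (i , p) = i , lookup-ext _ _ same
  where
  same : ∀ j → lookup x j ≡ lookup (axis i (lookup x i)) j
  same j with j ≟ i
  ... | yes refl = sym (lookup-updated origin i _)
  ... | no j≢i = trans (decidable-stable (lookup x j ≟ 𝟎) (λ q → ¬2 (two-nonzero x i j j≢i p q))) (sym (axis-elsewhere j≢i))
... | no ¬p = zero , lookup-ext _ _ same
  where
  vanish : ∀ j → lookup x j ≡ 𝟎
  vanish j = decidable-stable (lookup x j ≟ 𝟎) (λ q → ¬p (j , q))
  same : ∀ j → lookup x j ≡ lookup (axis zero (lookup x zero)) j
  same zero = refl
  same (suc j) = trans (vanish (suc j)) (sym (lookup-replicate j 𝟎))

-- Strong induction on ∥ x ∥ for both functions together, because in `Level` each of them uses the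
-- other at smaller weight. The axes are the base.
rigid : ∀ {n} (g h : Point (suc n) → Fin 4) → Latin g → Latin h → (∀ x → Has 𝟑 x → g x ≡ h x) →
  (∀ i t → Matches 𝟐 g (axis i t)) → (∀ i t → Matches 𝟏 h (axis i t)) →
  ∀ x → Matches 𝟐 g x × Matches 𝟏 h x
rigid {n} g h Lg Lh agree ag ah x = <-rec P step ∥ x ∥ x refl
  where
  P : ℕ → Set
  P N = ∀ x → ∥ x ∥ ≡ N → Matches 𝟐 g x × Matches 𝟏 h x
  step : ∀ N → (∀ {M} → M < N → P M) → P N
  step N IH x nx with 2 ≤? N
  ... | no ¬2 with ≤1-axis x (λ p → ¬2 (subst (2 ≤_) nx p))
  ... | i , e = subst (Matches 𝟐 g) (sym e) (ag i _) , subst (Matches 𝟏 h) (sym e) (ah i _)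
  step N IH x nx | yes 2≤ = G.everywhere x nx nz , H.everywhere x nx nz
    where
    IHg : ∀ y → ∥ y ∥ < N → Matches 𝟐 g y
    IHg y p = proj₁ (IH p y refl)
    IHh : ∀ y → ∥ y ∥ < N → Matches 𝟏 h y
    IHh y p = proj₂ (IH p y refl)
    module LG = Level c21 g h Lg Lh agree N IHg IHh
    module LH = Level c12 h g Lh Lg (λ x p → sym (agree x p)) N IHh IHg
    N≥2 : ∀ x → ∥ x ∥ ≡ N → ∀ i → ∃ λ j → j ≢ i × lookup x j ≢ 𝟎
    N≥2 y ny = another-nonzero y (subst (2 ≤_) (sym ny) 2≤)
    nz : ∃ λ i → lookup x i ≢ 𝟎
    nz with N≥2 x nx zero
    ... | j , _ , p = j , p
    module G = LG.Boundary (λ x → LH.two-colours _ x refl) N≥2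
    module H = LH.Boundary (λ x → LG.two-colours _ x refl) N≥2

-- Permutations of the colours

surjective : ∀ {u} → Inj u → ∀ y → ∃ λ t → u t ≡ y
surjective {u} Iu y with u 𝟎 ≟ y | u 𝟏 ≟ y | u 𝟐 ≟ y
... | yes p | _ | _ = 𝟎 , p
... | no _ | yes p | _ = 𝟏 , p
... | no _ | no _ | yes p = 𝟐 , p
... | no p | no q | no r = 𝟑 , trans
  (fourth (u 𝟎) (u 𝟏) (u 𝟐) (Iu λ ()) (Iu λ ()) (Iu λ ()) (u 𝟑) (Iu λ ()) (Iu λ ()) (Iu λ ()))
  (sym (fourth (u 𝟎) (u 𝟏) (u 𝟐) (Iu λ ()) (Iu λ ()) (Iu λ ()) y (≢-sym p) (≢-sym q) (≢-sym r)))

inverse : ∀ {u} → Inj u → Fin 4 → Fin 4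
inverse Iu y = proj₁ (surjective Iu y)

inverseʳ : ∀ {u} (Iu : Inj u) y → u (inverse Iu y) ≡ y
inverseʳ Iu y = proj₂ (surjective Iu y)

inverseˡ : ∀ {u} (Iu : Inj u) t → inverse Iu (u t) ≡ t
inverseˡ {u} Iu t with inverse Iu (u t) ≟ t
... | yes p = p
... | no p = ⊥-elim (Iu p (inverseʳ Iu (u t)))

inverse-inj : ∀ {u} (Iu : Inj u) → Inj (inverse Iu)
inverse-inj {u} Iu s≢t p = s≢t (trans (sym (inverseʳ Iu _)) (trans (cong u p) (inverseʳ Iu _)))

abstract
  fourth-new : ∀ a b c → a ≢ b → b ≢ c → a ≢ c → a ⊕ b ⊕ c ≢ a × a ⊕ b ⊕ c ≢ b × a ⊕ b ⊕ c ≢ c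
  fourth-new = from-yes (all? λ a → all? λ b → all? λ c → ¬? (a ≟ b) →-dec ¬? (b ≟ c) →-dec ¬? (a ≟ c) →-dec
    (¬? ((a ⊕ b ⊕ c) ≟ a) ×-dec ¬? ((a ⊕ b ⊕ c) ≟ b) ×-dec ¬? ((a ⊕ b ⊕ c) ≟ c)))

-- The symmetric group on four letters is the affine group of the Klein group: for distinct a, b, c
-- both sides are the fourth element, and otherwise two equal terms cancel on both sides.
affine : ∀ {u} → Inj u → ∀ a b c → u (a ⊕ b ⊕ c) ≡ u a ⊕ u b ⊕ u c
affine {u} Iu a b c with a ≟ b | b ≟ c | a ≟ c
... | yes refl | _ | _ = trans (cong (λ s → u (s ⊕ c)) (⊕-self a)) (cong (_⊕ u c) (sym (⊕-self (u a))))
... | no _ | yes refl | _ = trans (cong u (⊕-cancelʳ a b)) (sym (⊕-cancelʳ (u a) (u b)))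
... | no _ | no _ | yes refl = trans (cong u (sandwich a b)) (sym (sandwich (u a) (u b)))
  where
  sandwich : ∀ a b → a ⊕ b ⊕ a ≡ b
  sandwich = from-yes (all? λ a → all? λ b → (a ⊕ b ⊕ a) ≟ b)
... | no ab | no bc | no ac with fourth-new a b c ab bc ac
... | da , db , dc = fourth (u a) (u b) (u c) (Iu ab) (Iu bc) (Iu ac) _ (Iu da) (Iu db) (Iu dc)

four : ∀ {A : Set} → A → A → A → A → Fin 4 → A
four p q r s 𝟎 = p
four p q r s 𝟏 = q
four p q r s 𝟐 = r
four p q r s 𝟑 = s

four-inj : ∀ {p q r s} → p ≢ q → p ≢ r → p ≢ s → q ≢ r → q ≢ s → r ≢ s → Inj (four p q r s)
four-inj a b c d e f {𝟎} {𝟎} n = ⊥-elim (n refl)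
four-inj a b c d e f {𝟎} {𝟏} n = a
four-inj a b c d e f {𝟎} {𝟐} n = b
four-inj a b c d e f {𝟎} {𝟑} n = c
four-inj a b c d e f {𝟏} {𝟎} n = ≢-sym a
four-inj a b c d e f {𝟏} {𝟏} n = ⊥-elim (n refl)
four-inj a b c d e f {𝟏} {𝟐} n = d
four-inj a b c d e f {𝟏} {𝟑} n = e
four-inj a b c d e f {𝟐} {𝟎} n = ≢-sym b
four-inj a b c d e f {𝟐} {𝟏} n = ≢-sym d
four-inj a b c d e f {𝟐} {𝟐} n = ⊥-elim (n refl)
four-inj a b c d e f {𝟐} {𝟑} n = f
four-inj a b c d e f {𝟑} {𝟎} n = ≢-sym c
four-inj a b c d e f {𝟑} {𝟏} n = ≢-sym e
four-inj a b c d e f {𝟑} {𝟐} n = ≢-sym f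
four-inj a b c d e f {𝟑} {𝟑} n = ⊥-elim (n refl)

-- Cycles the nonzero colours; it serves to name the other two when one of them is given.
rot : Fin 4 → Fin 4
rot 𝟎 = 𝟎
rot 𝟏 = 𝟐
rot 𝟐 = 𝟑
rot 𝟑 = 𝟏

rot-frame : ∀ {c} → c ≢ 𝟎 → Frame c (rot c) (rot (rot c))
rot-frame {𝟎} p = ⊥-elim (p refl)
rot-frame {𝟏} p = record { 0a = λ () ; 0b = λ () ; 0c = λ () ; ab = λ () ; ac = λ () ; bc = λ () }
rot-frame {𝟐} p = record { 0a = λ () ; 0b = λ () ; 0c = λ () ; ab = λ () ; ac = λ () ; bc = λ () }
rot-frame {𝟑} p = record { 0a = λ () ; 0b = λ () ; 0c = λ () ; ab = λ () ; ac = λ () ; bc = λ () }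

-- The lines through a point where three completions take three values

record Star {n} (g h k : Point n → Fin 4) (C : Point n) : Set where
  field
    Lg : Latin g
    Lh : Latin h
    Lk : Latin k
    gh∂ : ∀ x → HasZero x → g x ≡ h x
    hk∂ : ∀ x → HasZero x → h x ≡ k x
    interior : Interior C
    g≢h : g C ≢ h C
    h≢k : h C ≢ k C
    g≢k : g C ≢ k C

  -- The colour that no completion has at C. By `at-zero` it is the colour of each boundary point
  -- obtained by clearing one coordinate of C.
  W : Fin 4
  W = g C ⊕ h C ⊕ k C

rotate : ∀ {n} {g h k : Point n → Fin 4} {C} → Star g h k C → Star h k g C
rotate S = record { Lg = Lh ; Lh = Lk ; Lk = Lg ; gh∂ = hk∂ ; hk∂ = λ x z → sym (trans (gh∂ x z) (hk∂ x z))
  ; interior = interior ; g≢h = h≢k ; h≢k = ≢-sym g≢k ; g≢k = ≢-sym g≢h }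
  where open Star S

Full : ∀ {n} (g h : Point n → Fin 4) → Point n → Fin n → Set
Full g h C i = ∀ t → t ≢ 𝟎 → g (C [ i ]≔ t) ≢ h (C [ i ]≔ t)

abstract
  -- On a line through C the colour at C and the colour W at the boundary are fixed, so each
  -- completion has two ways to colour the other two points. Of the eight cases, two make the first
  -- of these points another triple point; in the others some pair differs at both points.
  line-types : ∀ α β γ → α ≢ β → β ≢ γ → α ≢ γ → let W = α ⊕ β ⊕ γ in
    ∀ a → a ≢ α → a ≢ W → ∀ a′ → a′ ≢ α → a′ ≢ W → a ≢ a′ →
    ∀ b → b ≢ β → b ≢ W → ∀ b′ → b′ ≢ β → b′ ≢ W → b ≢ b′ →
    ∀ c → c ≢ γ → c ≢ W → ∀ c′ → c′ ≢ γ → c′ ≢ W → c ≢ c′ →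
    (a ≢ b × b ≢ c × a ≢ c) ⊎ (a ≢ b × a′ ≢ b′) ⊎ (b ≢ c × b′ ≢ c′) ⊎ (c ≢ a × c′ ≢ a′)
  line-types = from-yes (all? λ α → all? λ β → all? λ γ → ¬? (α ≟ β) →-dec ¬? (β ≟ γ) →-dec ¬? (α ≟ γ) →-dec
    let W = α ⊕ β ⊕ γ in
    all? λ a → ¬? (a ≟ α) →-dec ¬? (a ≟ W) →-dec all? λ a′ → ¬? (a′ ≟ α) →-dec ¬? (a′ ≟ W) →-dec ¬? (a ≟ a′) →-dec
    all? λ b → ¬? (b ≟ β) →-dec ¬? (b ≟ W) →-dec all? λ b′ → ¬? (b′ ≟ β) →-dec ¬? (b′ ≟ W) →-dec ¬? (b ≟ b′) →-dec
    all? λ c → ¬? (c ≟ γ) →-dec ¬? (c ≟ W) →-dec all? λ c′ → ¬? (c′ ≟ γ) →-dec ¬? (c′ ≟ W) →-dec ¬? (c ≟ c′) →-dec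
    ((¬? (a ≟ b) ×-dec ¬? (b ≟ c) ×-dec ¬? (a ≟ c)) ⊎-dec (¬? (a ≟ b) ×-dec ¬? (a′ ≟ b′)) ⊎-dec
     (¬? (b ≟ c) ×-dec ¬? (b′ ≟ c′)) ⊎-dec (¬? (c ≟ a) ×-dec ¬? (c′ ≟ a′))))

module Lines {n} {g h k : Point n → Fin 4} {C} (S : Star g h k C) where
  open Star S

  gk∂ : ∀ x → HasZero x → g x ≡ k x
  gk∂ x z = trans (gh∂ x z) (hk∂ x z)

  zero-at : ∀ (x : Point n) i → HasZero (x [ i ]≔ 𝟎)
  zero-at x i = i , lookup-updated x i 𝟎

  c : Fin n → Fin 4
  c i = lookup C i

  at-centre : ∀ {f : Point n → Fin 4} i → f (C [ i ]≔ c i) ≡ f C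
  at-centre {f} i = cong f ([]≔-lookup C i)

  line-inj : ∀ {f} → Latin f → ∀ (x : Point n) i → Inj (λ t → f (x [ i ]≔ t))
  line-inj {f} Lf x i {s} {t} s≢t p = latin-update Lf (x [ i ]≔ t) i (λ e → s≢t (trans e (lookup-updated x i t)))
    (trans (cong f ([]≔-idempotent x i)) p)

  column : ∀ {f} → Latin f → ∀ {i j} → i ≢ j → ∀ t → f (C [ i ]≔ t [ j ]≔ 𝟎) ≢ f (C [ i ]≔ t)
  column Lf {i} {j} i≢j t = latin-update Lf _ j
    (λ e → interior j (trans (sym (lookup-other C i j t (≢-sym i≢j))) (sym e)))

  at-zero : ∀ i → g (C [ i ]≔ 𝟎) ≡ W
  at-zero i = fourth (g C) (h C) (k C) g≢h h≢k g≢k _ (latin-update Lg C i 0≢)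
    (λ e → latin-update Lh C i 0≢ (trans (sym (gh∂ _ (zero-at C i))) e))
    (λ e → latin-update Lk C i 0≢ (trans (sym (gk∂ _ (zero-at C i))) e))
    where
    0≢ : 𝟎 ≢ c i
    0≢ = ≢-sym (interior i)

  not-W : ∀ {f} → Latin f → (∀ x → HasZero x → g x ≡ f x) → ∀ i {t} → t ≢ 𝟎 → f (C [ i ]≔ t) ≢ W
  not-W Lf e i t≢0 p = line-inj Lf C i t≢0 (trans p (trans (sym (at-zero i)) (e _ (zero-at C i))))

  not-centre : ∀ {f} → Latin f → ∀ i {t} → t ≢ c i → f (C [ i ]≔ t) ≢ f C
  not-centre Lf i t≢c = latin-update Lf C i t≢c

  swap-zeros : ∀ {i j} → i ≢ j → g (C [ i ]≔ 𝟎 [ j ]≔ 𝟎) ≡ g (C [ j ]≔ 𝟎 [ i ]≔ 𝟎)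
  swap-zeros {i} {j} i≢j = cong g ([]≔-commutes C i j i≢j)

  row-centre : ∀ {i j} → i ≢ j → g (C [ i ]≔ c i [ j ]≔ 𝟎) ≡ W
  row-centre {i} {j} i≢j = trans (cong (λ x → g (x [ j ]≔ 𝟎)) ([]≔-lookup C i)) (at-zero j)

  row-inj : ∀ {i j} → i ≢ j → Inj (λ t → g (C [ i ]≔ t [ j ]≔ 𝟎))
  row-inj {i} {j} i≢j {s} {t} s≢t p = line-inj Lg (C [ j ]≔ 𝟎) i s≢t
    (trans (cong g (sym ([]≔-commutes C i j i≢j))) (trans p (cong g ([]≔-commutes C i j i≢j))))

  -- Two points with three values on one line through C would both have the colour W below them.
  no-second-triple : ∀ {i j t} → i ≢ j → t ≢ c i →
    g (C [ i ]≔ t) ≢ h (C [ i ]≔ t) → h (C [ i ]≔ t) ≢ k (C [ i ]≔ t) → g (C [ i ]≔ t) ≢ k (C [ i ]≔ t) → t ≢ 𝟎 → ⊥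
  no-second-triple {i} {j} {t} i≢j t≢c gh hk gk t≢0 = row-inj i≢j t≢c (trans below (sym (row-centre i≢j)))
    where
    p : Point n
    p = C [ i ]≔ t
    z : HasZero (p [ j ]≔ 𝟎)
    z = zero-at p j
    below : g (p [ j ]≔ 𝟎) ≡ W
    below = trans (fourth (g p) (h p) (k p) gh hk gk _ (column Lg i≢j t)
        (λ e → column Lh i≢j t (trans (sym (gh∂ _ z)) e)) (λ e → column Lk i≢j t (trans (sym (gk∂ _ z)) e)))
      (sym (fourth (g p) (h p) (k p) gh hk gk W (≢-sym (not-W Lg (λ _ _ → refl) i t≢0))
        (≢-sym (not-W Lh gh∂ i t≢0)) (≢-sym (not-W Lk gk∂ i t≢0))))

  -- The second direction j rules out another triple point on the line i.
  some-full : ∀ i j → i ≢ j → Full g h C i ⊎ Full h k C i ⊎ Full k g C i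
  some-full i j i≢j = result (line-types (g C) (h C) (k C) g≢h h≢k g≢k
      _ (not-centre Lg i pc) (not-W Lg (λ _ _ → refl) i p0) _ (not-centre Lg i qc) (not-W Lg (λ _ _ → refl) i q0) (line-inj Lg C i pq)
      _ (not-centre Lh i pc) (not-W Lh gh∂ i p0) _ (not-centre Lh i qc) (not-W Lh gh∂ i q0) (line-inj Lh C i pq)
      _ (not-centre Lk i pc) (not-W Lk gk∂ i p0) _ (not-centre Lk i qc) (not-W Lk gk∂ i q0) (line-inj Lk C i pq))
    where
    F : Frame (c i) (rot (c i)) (rot (rot (c i)))
    F = rot-frame (interior i)
    open Frame F renaming (bc to pq)
    pc = ≢-sym ab
    qc = ≢-sym ac
    p0 = ≢-sym 0b
    q0 = ≢-sym 0c
    full : ∀ (f f′ : Point n → Fin 4) → f C ≢ f′ C → f (C [ i ]≔ rot (c i)) ≢ f′ (C [ i ]≔ rot (c i)) →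
      f (C [ i ]≔ rot (rot (c i))) ≢ f′ (C [ i ]≔ rot (rot (c i))) → Full f f′ C i
    full f f′ a b d t t≢0 with covered F t
    ... | inj₁ p = ⊥-elim (t≢0 p)
    ... | inj₂ (inj₁ refl) = λ e → a (trans (sym (at-centre {f} i)) (trans e (at-centre {f′} i)))
    ... | inj₂ (inj₂ (inj₁ refl)) = b
    ... | inj₂ (inj₂ (inj₂ refl)) = d
    result : _ → Full g h C i ⊎ Full h k C i ⊎ Full k g C i
    result (inj₁ (a , b , d)) = ⊥-elim (no-second-triple i≢j (≢-sym (Frame.ab F)) a b d (≢-sym (Frame.0b F)))
    result (inj₂ (inj₁ (a , b))) = inj₁ (full g h g≢h a b)
    result (inj₂ (inj₂ (inj₁ (a , b)))) = inj₂ (inj₁ (full h k h≢k a b))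
    result (inj₂ (inj₂ (inj₂ (a , b)))) = inj₂ (inj₂ (full k g (≢-sym g≢k) a b))

  -- Consider the row parallel to the line i with coordinate j cleared. Below C it has W; below each
  -- of the other two interior points it has the colour different from W and from the two distinct
  -- colours of g and h there. The colours of a row sum to 0, which leaves k C for the corner.
  corner : ∀ {i j} → i ≢ j → Full g h C i → g (C [ i ]≔ 𝟎 [ j ]≔ 𝟎) ≡ k C
  corner {i} {j} i≢j full = begin
      y 𝟎 ≡⟨ fourth W (y p) (y q) (λ e → y-inj ab (trans (sym yc) e)) (y-inj bc) (λ e → y-inj ac (trans (sym yc) e)) (y 𝟎)
               (λ e → y-inj 0a (trans e yc)) (y-inj 0b) (y-inj 0c) ⟩
      W ⊕ y p ⊕ y q ≡⟨ cong₂ (λ s t → W ⊕ s ⊕ t) (y-val p (≢-sym 0b) (≢-sym ab)) (y-val q (≢-sym 0c) (≢-sym ac)) ⟩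
      W ⊕ (W ⊕ g (P p) ⊕ h (P p)) ⊕ (W ⊕ g (P q) ⊕ h (P q)) ≡⟨ shuffle W (g (P p)) (h (P p)) (g (P q)) (h (P q)) ⟩
      W ⊕ (g (P p) ⊕ g (P q)) ⊕ (h (P p) ⊕ h (P q)) ≡⟨ cong₂ (λ s t → W ⊕ s ⊕ t) (opposite Lg (λ _ _ → refl)) (opposite Lh gh∂) ⟩
      W ⊕ (W ⊕ g C) ⊕ (W ⊕ h C) ≡⟨ final (g C) (h C) (k C) ⟩
      k C ∎
    where
    open ≡-Reasoning
    open Frame (rot-frame (interior i))
    p = rot (c i)
    q = rot (rot (c i))
    P : Fin 4 → Point n
    P t = C [ i ]≔ t
    y : Fin 4 → Fin 4
    y t = g (P t [ j ]≔ 𝟎)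
    y-inj : Inj y
    y-inj = row-inj i≢j
    yc : W ≡ y (c i)
    yc = sym (row-centre i≢j)
    y-val : ∀ t → t ≢ 𝟎 → t ≢ c i → y t ≡ W ⊕ g (P t) ⊕ h (P t)
    y-val t t≢0 t≢c = fourth W (g (P t)) (h (P t)) (≢-sym (not-W Lg (λ _ _ → refl) i t≢0)) (full t t≢0)
      (≢-sym (not-W Lh gh∂ i t≢0)) (y t) (λ e → y-inj t≢c (trans e yc)) (column Lg i≢j t)
      (λ e → column Lh i≢j t (trans (sym (gh∂ _ (zero-at (P t) j))) e))
    -- the four values on a line sum to 0
    opposite : ∀ {f} → Latin f → (∀ x → HasZero x → g x ≡ f x) → f (P p) ⊕ f (P q) ≡ W ⊕ f C
    opposite {f} Lf e = trans (cong (f (P p) ⊕_) (fourth W (f C) (f (P p))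
        (λ r → not-W Lf e i (interior i) (trans (at-centre {f} i) (sym r)))
        (≢-sym (not-centre Lf i (≢-sym ab)))
        (≢-sym (not-W Lf e i (≢-sym 0b)))
        (f (P q)) (not-W Lf e i (≢-sym 0c)) (not-centre Lf i (≢-sym ac)) (≢-sym (line-inj Lf C i bc))))
      (cancel (f (P p)) (W ⊕ f C))
      where
      cancel : ∀ a s → a ⊕ (s ⊕ a) ≡ s
      cancel = from-yes (all? λ a → all? λ s → (a ⊕ (s ⊕ a)) ≟ s)
    shuffle : ∀ w a b a′ b′ → w ⊕ (w ⊕ a ⊕ b) ⊕ (w ⊕ a′ ⊕ b′) ≡ w ⊕ (a ⊕ a′) ⊕ (b ⊕ b′)
    shuffle = from-yes (all? λ w → all? λ a → all? λ b → all? λ a′ → all? λ b′ →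
      (w ⊕ (w ⊕ a ⊕ b) ⊕ (w ⊕ a′ ⊕ b′)) ≟ (w ⊕ (a ⊕ a′) ⊕ (b ⊕ b′)))
    final : ∀ a b d → let w = a ⊕ b ⊕ d in w ⊕ (w ⊕ a) ⊕ (w ⊕ b) ≡ d
    final = from-yes (all? λ a → all? λ b → all? λ d → let w = a ⊕ b ⊕ d in (w ⊕ (w ⊕ a) ⊕ (w ⊕ b)) ≟ d)

-- If different pairs were full on the lines i and j, then `corner` would give two colours to the
-- point with both coordinates cleared.
all-full : ∀ {n} {g h k : Point n → Fin 4} {C} → Star g h k C → ∀ i → Full g h C i → ∀ j → Full g h C j
all-full {g = g} {h} {k} {C} S i full j with i ≟ j
... | yes refl = full
... | no i≢j with Lines.some-full S j i (≢-sym i≢j)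
... | inj₁ F = F
... | inj₂ (inj₁ F) = ⊥-elim (Star.g≢k S (trans (sym (Lines.corner (rotate S) (≢-sym i≢j) F))
  (trans (sym (Star.gh∂ S _ (i , lookup-updated (C [ j ]≔ 𝟎) i 𝟎)))
    (trans (sym (Lines.swap-zeros S i≢j)) (Lines.corner S i≢j full)))))
... | inj₂ (inj₂ F) = ⊥-elim (Star.h≢k S (trans (sym (Lines.corner (rotate (rotate S)) (≢-sym i≢j) F))
  (trans (sym (Lines.gk∂ S _ (i , lookup-updated (C [ j ]≔ 𝟎) i 𝟎)))
    (trans (sym (Lines.swap-zeros S i≢j)) (Lines.corner S i≢j full)))))

-- Linear functions, relabelling, and the linearity forced by a triple point

xsum : ∀ {n} → (Fin n → Fin 4) → Fin 4
xsum {zero} φ = 𝟎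
xsum {suc n} φ = φ zero ⊕ xsum (φ ∘ suc)

xsum-cong : ∀ {n} {φ ψ : Fin n → Fin 4} → (∀ i → φ i ≡ ψ i) → xsum φ ≡ xsum ψ
xsum-cong {zero} e = refl
xsum-cong {suc n} e = cong₂ _⊕_ (e zero) (xsum-cong (e ∘ suc))

part : ∀ {n} → (Point n → Fin 4) → Fin n → Fin 4 → Fin 4
part f i t = f (axis i t) ⊕ f origin

-- The only linear function that has the values of f on the coordinate axes.
lin : ∀ {n} → (Point n → Fin 4) → Point n → Fin 4
lin f x = f origin ⊕ xsum (λ i → part f i (lookup x i))

relabel : ∀ {n} → (Fin n → Fin 4 → Fin 4) → Point n → Point n
relabel π [] = []
relabel π (a ∷ x) = π zero a ∷ relabel (π ∘ suc) x

lookup-relabel : ∀ {n} (π : Fin n → Fin 4 → Fin 4) x i → lookup (relabel π x) i ≡ π i (lookup x i)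
lookup-relabel π (a ∷ x) zero = refl
lookup-relabel π (a ∷ x) (suc i) = lookup-relabel (π ∘ suc) x i

relabel-adj : ∀ {n} {π : Fin n → Fin 4 → Fin 4} → (∀ i → Inj (π i)) → ∀ {x y} → Adj x y → Adj (relabel π x) (relabel π y)
relabel-adj Iπ (here p) = here (Iπ zero p)
relabel-adj Iπ (there p) = there (relabel-adj (Iπ ∘ suc) p)

relabel-update : ∀ {n} (π : Fin n → Fin 4 → Fin 4) x y i t → (∀ j → j ≢ i → π j (lookup x j) ≡ lookup y j) →
  relabel π (x [ i ]≔ t) ≡ y [ i ]≔ π i t
relabel-update π x y i t e = lookup-ext _ _ same
  where
  same : ∀ j → lookup (relabel π (x [ i ]≔ t)) j ≡ lookup (y [ i ]≔ π i t) j
  same j with j ≟ i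
  ... | yes refl = trans (lookup-relabel π (x [ j ]≔ t) j) (trans (cong (π j) (lookup-updated x j t)) (sym (lookup-updated y j _)))
  ... | no j≢i = trans (lookup-relabel π (x [ i ]≔ t) j) (trans (cong (π j) (lookup-other x i j t j≢i))
    (trans (e j j≢i) (sym (lookup-other y i j _ j≢i))))

relabel-latin : ∀ {n} {π : Fin n → Fin 4 → Fin 4} {σ f} → (∀ i → Inj (π i)) → Inj σ → Latin f → Latin (σ ∘ f ∘ relabel π)
relabel-latin Iπ Iσ Lf p = Iσ (Lf (relabel-adj Iπ p))

⨁-origin : ∀ n → ⨁ (origin {n}) ≡ 𝟎
⨁-origin zero = refl
⨁-origin (suc n) = ⨁-origin n

⨁-axis : ∀ {n} (i : Fin n) t → ⨁ (axis i t) ≡ t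
⨁-axis {n} i t = trans (⨁-update origin i t) (cong₂ _⊕_ (⨁-origin n) (cong (_⊕ t) (lookup-replicate i 𝟎)))

switched-axis-in : ∀ {n} u (i : Fin n) t → t ≡ 𝟎 ⊎ t ≡ u → switched u (axis i t) ≡ t ⊕ u
switched-axis-in u i t p = cong₂ _⊕_ (⨁-axis i t) (box-in u _ inside)
  where
  inside : InBox u (axis i t)
  inside j with j ≟ i
  ... | yes refl = subst (λ a → a ≡ 𝟎 ⊎ a ≡ u) (sym (lookup-updated origin j t)) p
  ... | no j≢i = inj₁ (axis-elsewhere j≢i)

switched-axis-out : ∀ {n} u (i : Fin n) t → t ≢ 𝟎 → t ≢ u → switched u (axis i t) ≡ t
switched-axis-out u i t p q = trans (cong₂ _⊕_ (⨁-axis i t) (box-out u _ i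
  (p ∘ trans (sym (lookup-updated origin i t))) (q ∘ trans (sym (lookup-updated origin i t))))) (⊕-identityʳ t)

-- Since τ is affine, A is additive, so the boundary values split into one term per coordinate.
-- Changing one coordinate of the all-𝟑 point leaves another 𝟑 in dimension at least two, so these
-- terms can be read off the axes of f.
lin-unique : ∀ {n} (f : Point (suc (suc n)) → Fin 4) (π : Fin (suc (suc n)) → Fin 4 → Fin 4) {τ} → Inj τ →
  (∀ i → π i 𝟑 ≡ 𝟎) → (∀ x → Has 𝟑 x → f (relabel π x) ≡ τ (⨁ x)) →
  ∀ x → Has 𝟑 x → f (relabel π x) ≡ lin f (relabel π x)
lin-unique {n} f π {τ} Iτ π3 eq x h3 = sym (begin
  lin f (relabel π x) ≡⟨ cong₂ _⊕_ f-origin (xsum-cong λ i → part-value i) ⟩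
  τ o ⊕ xsum (λ i → A (𝟑 ⊕ lookup x i)) ≡⟨ cong (τ o ⊕_) (A-sum x) ⟩
  τ o ⊕ A (o ⊕ ⨁ x) ≡⟨ cong (τ o ⊕_) (cong (λ s → τ s ⊕ τ o) (cancelˡ o (⨁ x))) ⟩
  τ o ⊕ (τ (⨁ x) ⊕ τ o) ≡⟨ sandwich (τ o) (τ (⨁ x)) ⟩
  τ (⨁ x) ≡⟨ eq x h3 ⟨
  f (relabel π x) ∎)
  where
  open ≡-Reasoning
  threes : ∀ {m} → Point m
  threes = replicate _ 𝟑
  o : Fin 4
  o = ⨁ (threes {suc (suc n)})
  A : Fin 4 → Fin 4
  A s = τ (o ⊕ s) ⊕ τ o
  cancelˡ : ∀ a b → a ⊕ (a ⊕ b) ≡ b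
  cancelˡ = from-yes (all? λ a → all? λ b → (a ⊕ (a ⊕ b)) ≟ b)
  sandwich : ∀ a b → a ⊕ (b ⊕ a) ≡ b
  sandwich = from-yes (all? λ a → all? λ b → (a ⊕ (b ⊕ a)) ≟ b)
  A-additive : ∀ s t → A (s ⊕ t) ≡ A s ⊕ A t
  A-additive s t = begin
    τ (o ⊕ (s ⊕ t)) ⊕ τ o ≡⟨ cong (λ r → τ r ⊕ τ o) (spread o s t) ⟩
    τ ((o ⊕ s) ⊕ o ⊕ (o ⊕ t)) ⊕ τ o ≡⟨ cong (_⊕ τ o) (affine Iτ (o ⊕ s) o (o ⊕ t)) ⟩
    (τ (o ⊕ s) ⊕ τ o ⊕ τ (o ⊕ t)) ⊕ τ o ≡⟨ ⊕-assoc (τ (o ⊕ s) ⊕ τ o) _ _ ⟩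
    A s ⊕ A t ∎
    where
    spread : ∀ o s t → o ⊕ (s ⊕ t) ≡ (o ⊕ s) ⊕ o ⊕ (o ⊕ t)
    spread = from-yes (all? λ o → all? λ s → all? λ t → (o ⊕ (s ⊕ t)) ≟ ((o ⊕ s) ⊕ o ⊕ (o ⊕ t)))
  A-sum : ∀ {m} (x : Point m) → xsum (λ i → A (𝟑 ⊕ lookup x i)) ≡ A (⨁ (threes {m}) ⊕ ⨁ x)
  A-sum [] = sym (trans (cong (λ s → τ s ⊕ τ o) (⊕-identityʳ o)) (⊕-self (τ o)))
  A-sum {suc m} (a ∷ x) = trans (cong (A (𝟑 ⊕ a) ⊕_) (A-sum x)) (trans (sym (A-additive (𝟑 ⊕ a) _))
    (cong A (regroup a (⨁ (threes {m})) (⨁ x))))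
    where
    regroup : ∀ a s t → (𝟑 ⊕ a) ⊕ (s ⊕ t) ≡ (𝟑 ⊕ s) ⊕ (a ⊕ t)
    regroup = from-yes (all? λ a → all? λ s → all? λ t → ((𝟑 ⊕ a) ⊕ (s ⊕ t)) ≟ ((𝟑 ⊕ s) ⊕ (a ⊕ t)))
  relabel-threes : relabel π threes ≡ origin
  relabel-threes = lookup-ext _ _ λ i → trans (lookup-relabel π threes i)
    (trans (cong (π i) (lookup-replicate i 𝟑)) (trans (π3 i) (sym (lookup-replicate i 𝟎))))
  f-origin : f origin ≡ τ o
  f-origin = trans (cong f (sym relabel-threes)) (eq threes (zero , refl))
  a-three : ∀ i t → Has 𝟑 (threes {suc (suc n)} [ i ]≔ t)
  a-three zero t = suc zero , refl
  a-three (suc i) t = zero , refl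
  part-value : ∀ i → part f i (lookup (relabel π x) i) ≡ A (𝟑 ⊕ lookup x i)
  part-value i = cong₂ _⊕_ (begin
    f (axis i (lookup (relabel π x) i)) ≡⟨ cong (f ∘ axis i) (lookup-relabel π x i) ⟩
    f (axis i (π i (lookup x i))) ≡⟨ cong f (relabel-update π threes origin i (lookup x i) off) ⟨
    f (relabel π (threes [ i ]≔ lookup x i)) ≡⟨ eq _ (a-three i _) ⟩
    τ (⨁ (threes [ i ]≔ lookup x i)) ≡⟨ cong τ (⨁-update threes i _) ⟩
    τ (o ⊕ (lookup threes i ⊕ lookup x i)) ≡⟨ cong (λ s → τ (o ⊕ (s ⊕ lookup x i))) (lookup-replicate i 𝟑) ⟩
    τ (o ⊕ (𝟑 ⊕ lookup x i)) ∎) f-origin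
    where
    off : ∀ j → j ≢ i → π j (lookup threes j) ≡ lookup origin j
    off j _ = trans (cong (π j) (lookup-replicate j 𝟑)) (trans (π3 j) (sym (lookup-replicate j 𝟎)))

-- Names for the points of the line i with C at 𝟎 and the boundary at 𝟑. Along 𝟎, 𝟏, 𝟐 the colours
-- of g are those of g, h, k at C, and the colours of h are those of h, k, g: the same cyclic order
-- on every line.
record Turn {n} (g h k : Point n → Fin 4) (C : Point n) (i : Fin n) : Set where
  field
    π : Fin 4 → Fin 4
    inj : Inj π
    π0 : π 𝟎 ≡ lookup C i
    π3 : π 𝟑 ≡ 𝟎
    g1 : g (C [ i ]≔ π 𝟏) ≡ h C
    g2 : g (C [ i ]≔ π 𝟐) ≡ k C
    h1 : h (C [ i ]≔ π 𝟏) ≡ k C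
    h2 : h (C [ i ]≔ π 𝟐) ≡ g C

abstract
  -- Both g and h have two colourings of the remaining points. Differing at both points leaves two
  -- of the four combinations, which are exchanged by swapping the points.
  full-types : ∀ α β γ → α ≢ β → β ≢ γ → α ≢ γ → let W = α ⊕ β ⊕ γ in
    ∀ a → a ≢ α → a ≢ W → ∀ a′ → a′ ≢ α → a′ ≢ W → a ≢ a′ →
    ∀ b → b ≢ β → b ≢ W → ∀ b′ → b′ ≢ β → b′ ≢ W → b ≢ b′ → a ≢ b → a′ ≢ b′ →
    (a ≡ β × a′ ≡ γ × b ≡ γ × b′ ≡ α) ⊎ (a′ ≡ β × a ≡ γ × b′ ≡ γ × b ≡ α)
  full-types = from-yes (all? λ α → all? λ β → all? λ γ → ¬? (α ≟ β) →-dec ¬? (β ≟ γ) →-dec ¬? (α ≟ γ) →-dec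
    let W = α ⊕ β ⊕ γ in
    all? λ a → ¬? (a ≟ α) →-dec ¬? (a ≟ W) →-dec all? λ a′ → ¬? (a′ ≟ α) →-dec ¬? (a′ ≟ W) →-dec ¬? (a ≟ a′) →-dec
    all? λ b → ¬? (b ≟ β) →-dec ¬? (b ≟ W) →-dec all? λ b′ → ¬? (b′ ≟ β) →-dec ¬? (b′ ≟ W) →-dec ¬? (b ≟ b′) →-dec
    ¬? (a ≟ b) →-dec ¬? (a′ ≟ b′) →-dec
    (((a ≟ β) ×-dec (a′ ≟ γ) ×-dec (b ≟ γ) ×-dec (b′ ≟ α)) ⊎-dec ((a′ ≟ β) ×-dec (a ≟ γ) ×-dec (b′ ≟ γ) ×-dec (b ≟ α))))

turn : ∀ {n} {g h k : Point n → Fin 4} {C} → Star g h k C → ∀ i → Full g h C i → Turn g h k C i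
turn {g = g} {h} {k} {C} S i full with full-types (g C) (h C) (k C) g≢h h≢k g≢k
    _ (not-centre Lg i (≢-sym ab)) (not-W Lg (λ _ _ → refl) i (≢-sym 0b))
    _ (not-centre Lg i (≢-sym ac)) (not-W Lg (λ _ _ → refl) i (≢-sym 0c)) (line-inj Lg C i bc)
    _ (not-centre Lh i (≢-sym ab)) (not-W Lh gh∂ i (≢-sym 0b))
    _ (not-centre Lh i (≢-sym ac)) (not-W Lh gh∂ i (≢-sym 0c)) (line-inj Lh C i bc)
    (full _ (≢-sym 0b)) (full _ (≢-sym 0c))
  where
  open Star S
  open Lines S
  open Frame (rot-frame (interior i))
... | inj₁ (a , b , d , e) = record { π = four (lookup C i) (rot (lookup C i)) (rot (rot (lookup C i))) 𝟎
  ; inj = four-inj ab ac (≢-sym 0a) bc (≢-sym 0b) (≢-sym 0c) ; π0 = refl ; π3 = refl ; g1 = a ; g2 = b ; h1 = d ; h2 = e }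
  where open Frame (rot-frame (Star.interior S i))
... | inj₂ (a , b , d , e) = record { π = four (lookup C i) (rot (rot (lookup C i))) (rot (lookup C i)) 𝟎
  ; inj = four-inj ac ab (≢-sym 0a) (≢-sym bc) (≢-sym 0c) (≢-sym 0b) ; π0 = refl ; π3 = refl ; g1 = a ; g2 = b ; h1 = d ; h2 = e }
  where open Frame (rot-frame (Star.interior S i))

-- After relabelling, `rigid` makes g and h sums switched on the 𝟐-box and the 𝟏-box. A point with a
-- coordinate 𝟑 is in neither box, so on the boundary g is the plain sum.
full⇒linear : ∀ {n} {g h k : Point (suc (suc n)) → Fin 4} {C} → Star g h k C → Full g h C zero →
  ∀ x → HasZero x → g x ≡ lin g x
full⇒linear {n} {g} {h} {k} {C} S full y (i , yi) =
  subst (λ z → g z ≡ lin g z) y≡ (lin-unique g π Iτ (λ i → Turn.π3 (T i)) on-boundary x (i , xi))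
  where
  open Star S
  open Lines S
  T : ∀ i → Turn g h k C i
  T i = turn S i (all-full S zero full i)
  π : Fin (suc (suc n)) → Fin 4 → Fin 4
  π i = Turn.π (T i)
  Iπ : ∀ i → Inj (π i)
  Iπ i = Turn.inj (T i)
  W≢ : ∀ {f : Point (suc (suc n)) → Fin 4} → Latin f → (∀ x → HasZero x → g x ≡ f x) → f C ≢ W
  W≢ {f} Lf e r = not-W Lf e zero (interior zero) (trans (at-centre {f} zero) r)
  -- With these colour names the lines through C read 𝟐, 𝟏, 𝟎, 𝟑 for g and 𝟏, 𝟎, 𝟐, 𝟑 for h, the
  -- axis values of `switched 𝟐` and `switched 𝟏`.
  τ : Fin 4 → Fin 4
  τ = four (k C) (h C) (g C) W
  Iτ : Inj τ
  Iτ = four-inj (≢-sym h≢k) (≢-sym g≢k) (W≢ Lk gk∂) (≢-sym g≢h) (W≢ Lh gh∂) (W≢ Lg (λ _ _ → refl))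
  σ : Fin 4 → Fin 4
  σ = inverse Iτ
  from-C : ∀ (f : Point (suc (suc n)) → Fin 4) i t {s} → f (C [ i ]≔ π i t) ≡ τ s → σ (f (relabel π (axis i t))) ≡ s
  from-C f i t {s} e = trans (cong (σ ∘ f) (relabel-update π origin C i t off)) (trans (cong σ e) (inverseˡ Iτ s))
    where
    off : ∀ j → j ≢ i → π j (lookup origin j) ≡ lookup C j
    off j _ = trans (cong (π j) (lookup-replicate j 𝟎)) (Turn.π0 (T j))
  g′ h′ : Point (suc (suc n)) → Fin 4
  g′ = σ ∘ g ∘ relabel π
  h′ = σ ∘ h ∘ relabel π
  at-0 : ∀ (f : Point (suc (suc n)) → Fin 4) i → f (C [ i ]≔ π i 𝟎) ≡ f C
  at-0 f i = trans (cong (λ t → f (C [ i ]≔ t)) (Turn.π0 (T i))) (at-centre {f} i)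
  at-3 : ∀ i → g (C [ i ]≔ π i 𝟑) ≡ W
  at-3 i = trans (cong (λ t → g (C [ i ]≔ t)) (Turn.π3 (T i))) (at-zero i)
  g-axis : ∀ i t → Matches 𝟐 g′ (axis i t)
  g-axis i 𝟎 = trans (from-C g i 𝟎 {𝟐} (at-0 g i)) (sym (switched-axis-in 𝟐 i 𝟎 (inj₁ refl)))
  g-axis i 𝟏 = trans (from-C g i 𝟏 {𝟏} (Turn.g1 (T i))) (sym (switched-axis-out 𝟐 i 𝟏 (λ ()) (λ ())))
  g-axis i 𝟐 = trans (from-C g i 𝟐 {𝟎} (Turn.g2 (T i))) (sym (switched-axis-in 𝟐 i 𝟐 (inj₂ refl)))
  g-axis i 𝟑 = trans (from-C g i 𝟑 {𝟑} (at-3 i)) (sym (switched-axis-out 𝟐 i 𝟑 (λ ()) (λ ())))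
  h-axis : ∀ i t → Matches 𝟏 h′ (axis i t)
  h-axis i 𝟎 = trans (from-C h i 𝟎 {𝟏} (at-0 h i)) (sym (switched-axis-in 𝟏 i 𝟎 (inj₁ refl)))
  h-axis i 𝟏 = trans (from-C h i 𝟏 {𝟎} (Turn.h1 (T i))) (sym (switched-axis-in 𝟏 i 𝟏 (inj₂ refl)))
  h-axis i 𝟐 = trans (from-C h i 𝟐 {𝟐} (Turn.h2 (T i))) (sym (switched-axis-out 𝟏 i 𝟐 (λ ()) (λ ())))
  h-axis i 𝟑 = trans (from-C h i 𝟑 {𝟑} (trans (sym (gh∂ _ (i , trans (lookup-updated C i _) (Turn.π3 (T i))))) (at-3 i)))
    (sym (switched-axis-out 𝟏 i 𝟑 (λ ()) (λ ())))
  zero-from-3 : ∀ x → Has 𝟑 x → HasZero (relabel π x)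
  zero-from-3 x (i , p) = i , trans (lookup-relabel π x i) (trans (cong (π i) p) (Turn.π3 (T i)))
  on-boundary : ∀ x → Has 𝟑 x → g (relabel π x) ≡ τ (⨁ x)
  on-boundary x (i , p) = trans (sym (inverseʳ Iτ _)) (cong τ (trans
    (proj₁ (rigid g′ h′ (relabel-latin Iπ (inverse-inj Iτ) Lg) (relabel-latin Iπ (inverse-inj Iτ) Lh)
      (λ x p → cong σ (gh∂ _ (zero-from-3 x p))) g-axis h-axis x))
    (trans (cong (⨁ x ⊕_) (box-out 𝟐 x i (λ e → 3≢0 (trans (sym p) e)) (λ e → 3≢2 (trans (sym p) e)))) (⊕-identityʳ _))))
    where
    3≢0 : _≢_ {A = Fin 4} 𝟑 𝟎
    3≢0 ()
    3≢2 : _≢_ {A = Fin 4} 𝟑 𝟐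
    3≢2 ()
  x : Point (suc (suc n))
  x = relabel (λ i → inverse (Iπ i)) y
  y≡ : relabel π x ≡ y
  y≡ = lookup-ext _ _ λ j → trans (lookup-relabel π x j)
    (trans (cong (π j) (lookup-relabel _ y j)) (inverseʳ (Iπ j) _))
  xi : lookup x i ≡ 𝟑
  xi = trans (lookup-relabel _ y i) (trans (cong (inverse (Iπ i)) (trans yi (sym (Turn.π3 (T i))))) (inverseˡ (Iπ i) 𝟑))

axis-boundary : ∀ {n} (i : Fin (suc (suc n))) t → HasZero (axis i t)
axis-boundary zero t = suc zero , refl
axis-boundary (suc i) t = zero , refl

-- In dimension at least two the axes belong to the boundary.
lin-cong : ∀ {n} (f g : Point (suc (suc n)) → Fin 4) → (∀ x → HasZero x → f x ≡ g x) → ∀ x → lin f x ≡ lin g x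
lin-cong f g e x = cong₂ _⊕_ e0 (xsum-cong λ i → cong₂ _⊕_ (e (axis i (lookup x i)) (axis-boundary i (lookup x i))) e0)
  where
  e0 : f origin ≡ g origin
  e0 = e origin (zero , refl)

-- Cyclic symmetry moves the full pair to the front, and `lin` is the same for all three
-- completions.
linear-boundary : ∀ {n} (f g h : Point (suc (suc n)) → Fin 4) → Latin f → Latin g → Latin h →
  (∀ x → HasZero x → f x ≡ g x) → (∀ x → HasZero x → g x ≡ h x) → Triple f g h →
  ∀ x → HasZero x → f x ≡ lin f x
linear-boundary f g h Lf Lg Lh fg∂ gh∂ (mkTriple C int p q r) x z = by-type (Lines.some-full S zero (suc zero) (λ ()))
  where
  S : Star f g h C
  S = record { Lg = Lf ; Lh = Lg ; Lk = Lh ; gh∂ = fg∂ ; hk∂ = gh∂ ; interior = int ; g≢h = p ; h≢k = q ; g≢k = r }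
  fh∂ : ∀ x → HasZero x → f x ≡ h x
  fh∂ x z = trans (fg∂ x z) (gh∂ x z)
  by-type : Full f g C zero ⊎ Full g h C zero ⊎ Full h f C zero → f x ≡ lin f x
  by-type (inj₁ F) = full⇒linear S F x z
  by-type (inj₂ (inj₁ F)) = trans (fg∂ x z) (trans (full⇒linear (rotate S) F x z) (sym (lin-cong f g fg∂ x)))
  by-type (inj₂ (inj₂ F)) = trans (fh∂ x z) (trans (full⇒linear (rotate (rotate S)) F x z) (sym (lin-cong f h fh∂ x)))

-- Completions of a linear boundary

xsum-update : ∀ {n} {φ ψ : Fin n → Fin 4} i → (∀ j → j ≢ i → ψ j ≡ φ j) → xsum ψ ≡ xsum φ ⊕ (φ i ⊕ ψ i)
xsum-update {φ = φ} {ψ} zero e = trans (cong (ψ zero ⊕_) (xsum-cong λ j → e (suc j) (λ ()))) (exchange (φ zero) (ψ zero) _)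
  where
  exchange : ∀ a b s → b ⊕ s ≡ (a ⊕ s) ⊕ (a ⊕ b)
  exchange = from-yes (all? λ a → all? λ b → all? λ s → (b ⊕ s) ≟ ((a ⊕ s) ⊕ (a ⊕ b)))
xsum-update {φ = φ} {ψ} (suc i) e = trans (cong₂ _⊕_ (e zero (λ ())) (xsum-update i λ j j≢i → e (suc j) λ { refl → j≢i refl }))
  (sym (⊕-assoc (φ zero) _ _))

lin-update : ∀ {n} (f : Point n → Fin 4) x i t → lin f (x [ i ]≔ t) ≡ lin f x ⊕ (part f i (lookup x i) ⊕ part f i t)
lin-update f x i t = trans (cong (f origin ⊕_) (trans
    (xsum-update i λ j j≢i → cong (part f j) (lookup-other x i j t j≢i))
    (cong (λ s → xsum (λ j → part f j (lookup x j)) ⊕ (part f i (lookup x i) ⊕ part f i s)) (lookup-updated x i t))))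
  (sym (⊕-assoc (f origin) _ _))

part-0 : ∀ {n} (f : Point n → Fin 4) i → part f i 𝟎 ≡ 𝟎
part-0 f i = trans (cong (λ x → f x ⊕ f origin)
  (trans (cong (origin [ i ]≔_) (sym (lookup-replicate i 𝟎))) ([]≔-lookup origin i))) (⊕-self (f origin))

part-inj : ∀ {n} {f : Point n → Fin 4} → Latin f → ∀ i → Inj (part f i)
part-inj {f = f} Lf i {s} {t} s≢t p = latin-update Lf (axis i t) i (λ e → s≢t (trans e (lookup-updated origin i t)))
  (trans (cong f ([]≔-idempotent origin i)) (⊕-injectiveˡ _ _ (f origin) p))

part-≢0 : ∀ {n} {f : Point n → Fin 4} → Latin f → ∀ i {t} → t ≢ 𝟎 → part f i t ≢ 𝟎
part-≢0 {f = f} Lf i t≢0 p = part-inj Lf i t≢0 (trans p (sym (part-0 f i)))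

defect : ∀ {n} → (Point n → Fin 4) → Point n → Fin 4
defect f x = f x ⊕ lin f x

interior-update : ∀ {n} (x : Point n) → Interior x → ∀ i {t} → t ≢ 𝟎 → Interior (x [ i ]≔ t)
interior-update x int i {t} t≢0 j with j ≟ i
... | yes refl = t≢0 ∘ trans (sym (lookup-updated x i t))
... | no j≢i = int j ∘ trans (sym (lookup-other x i j t j≢i))

module Defect {n} (f : Point (suc (suc n)) → Fin 4) (Lf : Latin f) (bd : ∀ x → HasZero x → f x ≡ lin f x) where

  below : ∀ x i → f (x [ i ]≔ 𝟎) ≡ lin f x ⊕ part f i (lookup x i)
  below x i = trans (bd _ (i , lookup-updated x i 𝟎)) (trans (lin-update f x i 𝟎)
    (cong (lin f x ⊕_) (trans (cong (part f i (lookup x i) ⊕_) (part-0 f i)) (⊕-identityʳ _))))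

  value : ∀ x → f x ≡ lin f x ⊕ defect f x
  value x = restore (f x) (lin f x)
    where
    restore : ∀ a b → a ≡ b ⊕ (a ⊕ b)
    restore = from-yes (all? λ a → all? λ b → a ≟ (b ⊕ (a ⊕ b)))

  -- Otherwise x would repeat the colour of its boundary neighbour in direction i.
  defect≢part : ∀ x i → lookup x i ≢ 𝟎 → defect f x ≢ part f i (lookup x i)
  defect≢part x i p e = latin-update Lf x i (≢-sym p)
    (trans (below x i) (trans (cong (lin f x ⊕_) (sym e)) (sym (value x))))

  private
    another : ∀ i → ∃ λ (j : Fin (suc (suc n))) → j ≢ i
    another zero = suc zero , λ ()
    another (suc i) = zero , λ ()

  -- Below, b and a ⊕ b are the parts of x and of its neighbour y on the line i.
  spread : ∀ x i t {a} → Interior x → defect f x ≡ a → a ≢ 𝟎 → t ≢ 𝟎 → part f i t ≢ a → defect f (x [ i ]≔ t) ≡ a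
  spread x i t {a} int e a≢0 t≢0 pt≢a with t ≟ lookup x i
  ... | yes refl = trans (cong (defect f) ([]≔-lookup x i)) e
  ... | no t≢xi = decide (remaining a b (part f i t) (defect f y) a≢0 b≢0 c≢0 b≢a pt≢a c≢b dy≢0 dy≢c)
    where
    y : Point (suc (suc n))
    y = x [ i ]≔ t
    b : Fin 4
    b = part f i (lookup x i)
    b≢0 : b ≢ 𝟎
    b≢0 = part-≢0 Lf i (int i)
    c≢0 : part f i t ≢ 𝟎
    c≢0 = part-≢0 Lf i t≢0
    b≢a : b ≢ a
    b≢a p = defect≢part x i (int i) (trans e (sym p))
    c≢b : part f i t ≢ b
    c≢b = part-inj Lf i t≢xi
    c≡ : part f i t ≡ a ⊕ b
    c≡ = third a b (part f i t) a≢0 b≢0 c≢0 b≢a pt≢a c≢b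
      where
      third : ∀ a b c → a ≢ 𝟎 → b ≢ 𝟎 → c ≢ 𝟎 → b ≢ a → c ≢ a → c ≢ b → c ≡ a ⊕ b
      third = from-yes (all? λ a → all? λ b → all? λ c → ¬? (a ≟ 𝟎) →-dec ¬? (b ≟ 𝟎) →-dec ¬? (c ≟ 𝟎) →-dec
        ¬? (b ≟ a) →-dec ¬? (c ≟ a) →-dec ¬? (c ≟ b) →-dec (c ≟ (a ⊕ b)))
    intʸ : Interior y
    intʸ = interior-update x int i t≢0
    dy≢c : defect f y ≢ part f i t
    dy≢c p = defect≢part y i (intʸ i) (trans p (cong (part f i) (sym (lookup-updated x i t))))
    on-line : ∀ s → lin f (x [ i ]≔ s) ≡ lin f x ⊕ (b ⊕ part f i s)
    on-line s = lin-update f x i s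
    -- The parts of x and y on this line sum to a, so y without a defect would repeat the colour of
    -- x.
    dy≢0 : defect f y ≢ 𝟎
    dy≢0 p = latin-update Lf x i t≢xi (trans (value y) (trans (cong₂ _⊕_ (trans (on-line t) (cong (λ r → lin f x ⊕ (b ⊕ r)) c≡)) p)
      (trans (simplify (lin f x) a b) (trans (cong (lin f x ⊕_) (sym e)) (sym (value x))))))
      where
      simplify : ∀ s a b → (s ⊕ (b ⊕ (a ⊕ b))) ⊕ 𝟎 ≡ s ⊕ a
      simplify = from-yes (all? λ s → all? λ a → all? λ b → ((s ⊕ (b ⊕ (a ⊕ b))) ⊕ 𝟎) ≟ (s ⊕ a))
    remaining : ∀ a b c d → a ≢ 𝟎 → b ≢ 𝟎 → c ≢ 𝟎 → b ≢ a → c ≢ a → c ≢ b → d ≢ 𝟎 → d ≢ c → d ≡ a ⊎ d ≡ b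
    remaining a b c d p q r s t u v w with d ≟ a
    ... | yes z = inj₁ z
    ... | no z = inj₂ (last a b c d p q r s t u v w z)
      where
      last : ∀ a b c d → a ≢ 𝟎 → b ≢ 𝟎 → c ≢ 𝟎 → b ≢ a → c ≢ a → c ≢ b → d ≢ 𝟎 → d ≢ c → d ≢ a → d ≡ b
      last = from-yes (all? {4} λ a → all? {4} λ b → all? {4} λ c → all? {4} λ d → ¬? (a ≟ 𝟎) →-dec ¬? (b ≟ 𝟎) →-dec ¬? (c ≟ 𝟎) →-dec
        ¬? (b ≟ a) →-dec ¬? (c ≟ a) →-dec ¬? (c ≟ b) →-dec ¬? (d ≟ 𝟎) →-dec ¬? (d ≟ c) →-dec ¬? (d ≟ a) →-dec (d ≟ b))
    -- A 3-cycle on the line i would use up all the defects allowed by another direction j.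
    decide : defect f y ≡ a ⊎ defect f y ≡ b → defect f y ≡ a
    decide (inj₁ p) = p
    decide (inj₂ dy) = ⊥-elim (exhausted a b (part f j (lookup x j)) a≢0 b≢0 b≢a
        (part-≢0 Lf j (int j))
        (λ p → defect≢part x j (int j) (trans e (sym p)))
        (λ p → defect≢part y j (intʸ j) (trans dy (trans (sym p) (cong (part f j) (sym (lookup-other x i j t j≢i))))))
        (λ p → defect≢part z j (intᶻ j) (trans dz (trans (sym p) (cong (part f j) (sym (lookup-other x i j r j≢i)))))))
      where
      j = proj₁ (another i)
      j≢i = proj₂ (another i)
      exhausted : ∀ a b w → a ≢ 𝟎 → b ≢ 𝟎 → b ≢ a → w ≢ 𝟎 → w ≢ a → w ≢ b → ¬ (w ≢ a ⊕ b)
      exhausted = from-yes (all? λ a → all? λ b → all? λ w → ¬? (a ≟ 𝟎) →-dec ¬? (b ≟ 𝟎) →-dec ¬? (b ≟ a) →-dec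
        ¬? (w ≟ 𝟎) →-dec ¬? (w ≟ a) →-dec ¬? (w ≟ b) →-dec ¬? (¬? (w ≟ (a ⊕ b))))
      -- The third interior point of the line is the one with part a.
      r : Fin 4
      r = inverse (part-inj Lf i) a
      part-r : part f i r ≡ a
      part-r = inverseʳ (part-inj Lf i) a
      r≢0 : r ≢ 𝟎
      r≢0 p = a≢0 (trans (sym part-r) (trans (cong (part f i) p) (part-0 f i)))
      r≢xi : r ≢ lookup x i
      r≢xi p = b≢a (trans (cong (part f i) (sym p)) part-r)
      r≢t : r ≢ t
      r≢t p = pt≢a (trans (cong (part f i) (sym p)) part-r)
      z : Point (suc (suc n))
      z = x [ i ]≔ r
      intᶻ : Interior z
      intᶻ = interior-update x int i r≢0
      fy : f y ≡ lin f x ⊕ (b ⊕ a)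
      fy = trans (value y) (trans (cong₂ _⊕_ (trans (on-line t) (cong (λ r → lin f x ⊕ (b ⊕ r)) c≡)) dy) (simplify (lin f x) a b))
        where
        simplify : ∀ s a b → (s ⊕ (b ⊕ (a ⊕ b))) ⊕ b ≡ s ⊕ (b ⊕ a)
        simplify = from-yes (all? λ s → all? λ a → all? λ b → ((s ⊕ (b ⊕ (a ⊕ b))) ⊕ b) ≟ (s ⊕ (b ⊕ a)))
      fx : f x ≡ lin f x ⊕ a
      fx = trans (value x) (cong (lin f x ⊕_) e)
      line-inj : Inj (λ s → f (x [ i ]≔ s))
      line-inj {s} {s′} s≢ p = latin-update Lf (x [ i ]≔ s′) i (λ q → s≢ (trans q (lookup-updated x i s′)))
        (trans (cong f ([]≔-idempotent x i)) p)
      fz : f z ≡ lin f x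
      fz = last (lin f x) a b (f z) a≢0 b≢0 b≢a
        (λ p → latin-update Lf x i r≢xi (trans p (sym fx)))
        (λ p → line-inj r≢0 (trans p (sym (below x i))))
        (λ p → line-inj r≢t (trans p (sym fy)))
        where
        last : ∀ s a b d → a ≢ 𝟎 → b ≢ 𝟎 → b ≢ a → d ≢ s ⊕ a → d ≢ s ⊕ b → d ≢ s ⊕ (b ⊕ a) → d ≡ s
        last = from-yes (all? λ s → all? λ a → all? λ b → all? λ d → ¬? (a ≟ 𝟎) →-dec ¬? (b ≟ 𝟎) →-dec ¬? (b ≟ a) →-dec
          ¬? (d ≟ (s ⊕ a)) →-dec ¬? (d ≟ (s ⊕ b)) →-dec ¬? (d ≟ (s ⊕ (b ⊕ a))) →-dec (d ≟ s))
      dz : defect f z ≡ a ⊕ b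
      dz = trans (cong₂ _⊕_ fz (trans (on-line r) (cong (λ q → lin f x ⊕ (b ⊕ q)) part-r))) (simplify (lin f x) a b)
        where
        simplify : ∀ s a b → s ⊕ (s ⊕ (b ⊕ a)) ≡ a ⊕ b
        simplify = from-yes (all? λ s → all? λ a → all? λ b → (s ⊕ (s ⊕ (b ⊕ a))) ≟ (a ⊕ b))

  -- Any interior x is turned into y by overwriting one coordinate at a time; `spread` keeps the
  -- defect at each step because no part of y is a.
  module Walk (y : Point (suc (suc n))) {a} (a≢0 : a ≢ 𝟎) (inty : Interior y) (y≢a : ∀ i → part f i (lookup y i) ≢ a) where

    walk : List (Fin (suc (suc n))) → Point (suc (suc n)) → Point (suc (suc n))
    walk [] x = x
    walk (i ∷ is) x = walk is (x [ i ]≔ lookup y i)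

    walk-defect : ∀ is x → Interior x → defect f x ≡ a → defect f (walk is x) ≡ a
    walk-defect [] x int e = e
    walk-defect (i ∷ is) x int e = walk-defect is _ (interior-update x int i (inty i)) (spread x i _ int e a≢0 (inty i) (y≢a i))

    walk-keeps : ∀ is x j → lookup x j ≡ lookup y j → lookup (walk is x) j ≡ lookup y j
    walk-keeps [] x j e = e
    walk-keeps (i ∷ is) x j e = walk-keeps is (x [ i ]≔ lookup y i) j kept
      where
      kept : lookup (x [ i ]≔ lookup y i) j ≡ lookup y j
      kept with j ≟ i
      ... | yes refl = lookup-updated x j _
      ... | no j≢i = trans (lookup-other x i j _ j≢i) e

    walk-reaches : ∀ {is j} x → j ∈ is → lookup (walk is x) j ≡ lookup y j
    walk-reaches {i ∷ is} x (here refl) = walk-keeps is (x [ i ]≔ lookup y i) i (lookup-updated x i _)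
    walk-reaches {i ∷ is} x (there p) = walk-reaches (x [ i ]≔ lookup y i) p

    everywhere : ∀ x → Interior x → defect f x ≡ a → defect f y ≡ a
    everywhere x int e = trans (cong (defect f) (sym (lookup-ext _ _ λ j → walk-reaches x (∈-allFin j))))
      (walk-defect (allFin _) x int e)

Occurs : ∀ {n} → (Point n → Fin 4) → Fin 4 → Set
Occurs f a = ∃ λ x → Interior x × defect f x ≡ a

-- For each nonzero a, the defect is a either everywhere or nowhere on the subgrid of interior
-- points without part a, and it is a at no other point. Knowing which a occur therefore fixes all
-- defects.
determined : ∀ {n} (f g : Point (suc (suc n)) → Fin 4) → Latin f → Latin g → (∀ x → HasZero x → f x ≡ g x) →
  (∀ x → HasZero x → f x ≡ lin f x) → (∀ a → a ≢ 𝟎 → Occurs f a → Occurs g a) → (∀ a → a ≢ 𝟎 → Occurs g a → Occurs f a) →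
  ∀ x → f x ≡ g x
determined {n} f g Lf Lg fg∂ bd fg gf x with any? (λ i → lookup x i ≟ 𝟎)
... | yes z = fg∂ x z
... | no ¬z = ⊕-injectiveˡ _ _ (lin f x) (trans same (cong (g x ⊕_) (sym (lin-cong f g fg∂ x))))
  where
  gf∂ : ∀ x → HasZero x → g x ≡ f x
  gf∂ x z = sym (fg∂ x z)
  bdg : ∀ x → HasZero x → g x ≡ lin g x
  bdg x z = trans (gf∂ x z) (trans (bd x z) (lin-cong f g fg∂ x))
  int : Interior x
  int i p = ¬z (i , p)
  transfer : ∀ (f g : Point (suc (suc n)) → Fin 4) → Latin f → Latin g → (∀ x → HasZero x → f x ≡ g x) →
    (∀ x → HasZero x → f x ≡ lin f x) → (∀ x → HasZero x → g x ≡ lin g x) →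
    (∀ a → a ≢ 𝟎 → Occurs f a → Occurs g a) → defect f x ≢ 𝟎 → defect g x ≡ defect f x
  transfer f g Lf Lg e bf bg o d≢0 with o (defect f x) d≢0 (x , int , refl)
  -- No part of x equals its defect under f, and g has the same parts as f, so the walk for g from y
  -- can end at x.
  ... | y , inty , d = Defect.Walk.everywhere g Lg bg x d≢0 int
    (λ i p → Defect.defect≢part f Lf bf x i (int i) (trans (sym p)
      (sym (cong₂ _⊕_ (e (axis i (lookup x i)) (axis-boundary i (lookup x i))) (e origin (zero , refl)))))) y inty d
  same : defect f x ≡ defect g x
  same with defect f x ≟ 𝟎 | defect g x ≟ 𝟎
  ... | yes p | yes q = trans p (sym q)
  ... | no p | _ = sym (transfer f g Lf Lg fg∂ bd bdg fg p)
  ... | yes _ | no q = transfer g f Lg Lf gf∂ bdg bd gf q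

-- Faces, and agreement and linearity on them

Face : ℕ → Set
Face = Vec Bool

∣_∣ : ∀ {n} → Face n → ℕ
∣ [] ∣ = 0
∣ true ∷ I ∣ = suc ∣ I ∣
∣ false ∷ I ∣ = ∣ I ∣

-- Parametrises the points that vanish outside I.
emb : ∀ {n} (I : Face n) → Point ∣ I ∣ → Point n
emb [] y = []
emb (true ∷ I) (a ∷ y) = a ∷ emb I y
emb (false ∷ I) y = 𝟎 ∷ emb I y

emb-adj : ∀ {n} (I : Face n) {y z} → Adj y z → Adj (emb I y) (emb I z)
emb-adj (true ∷ I) (here p) = here p
emb-adj (true ∷ I) (there p) = there (emb-adj I p)
emb-adj (false ∷ I) p = there (emb-adj I p)

emb-latin : ∀ {n} {f : Point n → Fin 4} (I : Face n) → Latin f → Latin (f ∘ emb I)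
emb-latin I Lf p = Lf (emb-adj I p)

emb-origin : ∀ {n} (I : Face n) → emb I origin ≡ origin
emb-origin [] = refl
emb-origin (true ∷ I) = cong (𝟎 ∷_) (emb-origin I)
emb-origin (false ∷ I) = cong (𝟎 ∷_) (emb-origin I)

emb-norm : ∀ {n} (I : Face n) y → ∥ emb I y ∥ ≡ ∥ y ∥
emb-norm [] [] = refl
emb-norm (true ∷ I) (a ∷ y) = cong (nonzero a +_) (emb-norm I y)
emb-norm (false ∷ I) y = emb-norm I y

-- Coordinates outside I are 𝟎, and there the part vanishes.
parts-emb : ∀ {n} (f : Point n → Fin 4) (I : Face n) y →
  xsum (λ i → part (f ∘ emb I) i (lookup y i)) ≡ xsum (λ i → part f i (lookup (emb I y) i))
parts-emb f [] y = refl
parts-emb f (true ∷ I) (a ∷ y) = cong₂ _⊕_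
  (cong₂ _⊕_ (cong (λ z → f (a ∷ z)) (emb-origin I)) (cong (λ z → f (𝟎 ∷ z)) (emb-origin I)))
  (parts-emb (λ z → f (𝟎 ∷ z)) I y)
parts-emb f (false ∷ I) y = trans (parts-emb (λ z → f (𝟎 ∷ z)) I y)
  (sym (cong (_⊕ xsum (λ i → part f (suc i) (lookup (emb I y) i))) (⊕-self (f origin))))

lin-emb : ∀ {n} (f : Point n → Fin 4) (I : Face n) y → lin (f ∘ emb I) y ≡ lin f (emb I y)
lin-emb f I y = cong₂ _⊕_ (cong f (emb-origin I)) (parts-emb f I y)

supp : ∀ {n} → Point n → Face n
supp [] = []
supp (𝟎 ∷ x) = false ∷ supp x
supp (suc a ∷ x) = true ∷ supp x

core : ∀ {n} (x : Point n) → Point ∣ supp x ∣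
core [] = []
core (𝟎 ∷ x) = core x
core (suc a ∷ x) = suc a ∷ core x

emb-core : ∀ {n} (x : Point n) → emb (supp x) (core x) ≡ x
emb-core [] = refl
emb-core (𝟎 ∷ x) = cong (𝟎 ∷_) (emb-core x)
emb-core (suc a ∷ x) = cong (suc a ∷_) (emb-core x)

size-supp : ∀ {n} (x : Point n) → ∣ supp x ∣ ≡ ∥ x ∥
size-supp [] = refl
size-supp (𝟎 ∷ x) = size-supp x
size-supp (suc a ∷ x) = cong suc (size-supp x)

norm≤ : ∀ {n} (x : Point n) → ∥ x ∥ ≤ n
norm≤ [] = z≤n
norm≤ (𝟎 ∷ x) = m≤n⇒m≤1+n (norm≤ x)
norm≤ (suc a ∷ x) = s≤s (norm≤ x)

norm< : ∀ {n} (x : Point n) → HasZero x → ∥ x ∥ < n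
norm< (a ∷ x) (zero , refl) = s≤s (norm≤ x)
norm< (𝟎 ∷ x) (suc i , p) = m≤n⇒m≤1+n (norm< x (i , p))
norm< (suc a ∷ x) (suc i , p) = s≤s (norm< x (i , p))

infix 4 _⊑_ _⊏_

data _⊑_ : ∀ {n} → Face n → Face n → Set where
  [] : [] ⊑ []
  keep : ∀ {n b} {I J : Face n} → J ⊑ I → (b ∷ J) ⊑ (b ∷ I)
  add : ∀ {n} {I J : Face n} → J ⊑ I → (false ∷ J) ⊑ (true ∷ I)

data _⊏_ : ∀ {n} → Face n → Face n → Set where
  keep : ∀ {n b} {I J : Face n} → J ⊏ I → (b ∷ J) ⊏ (b ∷ I)
  add : ∀ {n} {I J : Face n} → J ⊑ I → (false ∷ J) ⊏ (true ∷ I)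

⊑-emb : ∀ {n} {I J : Face n} → J ⊑ I → ∀ z → ∃ λ y → emb I y ≡ emb J z
⊑-emb [] z = [] , refl
⊑-emb (keep {b = true} p) (a ∷ z) with ⊑-emb p z
... | y , e = a ∷ y , cong (a ∷_) e
⊑-emb (keep {b = false} p) z with ⊑-emb p z
... | y , e = y , cong (𝟎 ∷_) e
⊑-emb (add p) z with ⊑-emb p z
... | y , e = 𝟎 ∷ y , cong (𝟎 ∷_) e

⊏-emb : ∀ {n} {I J : Face n} → J ⊏ I → ∀ z → ∃ λ y → HasZero y × emb I y ≡ emb J z
⊏-emb (keep {b = true} p) (a ∷ z) with ⊏-emb p z
... | y , (i , h) , e = a ∷ y , (suc i , h) , cong (a ∷_) e
⊏-emb (keep {b = false} p) z with ⊏-emb p z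
... | y , h , e = y , h , cong (𝟎 ∷_) e
⊏-emb (add p) z with ⊑-emb p z
... | y , e = 𝟎 ∷ y , (zero , refl) , cong (𝟎 ∷_) e

all-points? : ∀ {n} {P : Point n → Set} → (∀ x → Dec (P x)) → Dec (∀ x → P x)
all-points? {zero} P? = map′ (λ { p [] → p }) (λ p → p []) (P? [])
all-points? {suc n} P? = map′ (λ { p (a ∷ x) → p a x }) (λ p a x → p (a ∷ x)) (all? λ a → all-points? λ x → P? (a ∷ x))

any-point? : ∀ {n} {P : Point n → Set} → (∀ x → Dec (P x)) → Dec (∃ P)
any-point? {zero} P? = map′ ([] ,_) (λ { ([] , p) → p }) (P? [])
any-point? {suc n} P? = map′ (λ { (a , x , p) → a ∷ x , p }) (λ { (a ∷ x , p) → a , x , p }) (any? λ a → any-point? λ x → P? (a ∷ x))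

does-transfer : ∀ {A B : Set} (a? : Dec A) (b? : Dec B) → does a? ≡ does b? → A → B
does-transfer (yes _) (yes b) _ _ = b
does-transfer (no ¬a) _ _ a = ⊥-elim (¬a a)

interior? : ∀ {n} (x : Point n) → Dec (Interior x)
interior? x = all? λ i → ¬? (lookup x i ≟ 𝟎)

module _ {n : ℕ} where

  Agree Agree∂ : (f g : Point n → Fin 4) → Face n → Set
  Agree f g I = ∀ y → f (emb I y) ≡ g (emb I y)
  Agree∂ f g I = ∀ y → HasZero y → f (emb I y) ≡ g (emb I y)

  agree? : ∀ f g I → Dec (Agree f g I)
  agree? f g I = all-points? λ y → f (emb I y) ≟ g (emb I y)

  agree∂? : ∀ f g I → Dec (Agree∂ f g I)
  agree∂? f g I = all-points? λ y → has? 𝟎 y →-dec (f (emb I y) ≟ g (emb I y))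

  Linear Linear∂ : (Point n → Fin 4) → Face n → Set
  Linear f I = ∀ y → f (emb I y) ≡ lin f (emb I y)
  Linear∂ f I = ∀ y → HasZero y → f (emb I y) ≡ lin f (emb I y)

  linear? : ∀ f I → Dec (Linear f I)
  linear? f I = all-points? λ y → f (emb I y) ≟ lin f (emb I y)

  -- A proper subface lies in the boundary; hence the linear faces form a down-set.
  linear-⊏ : ∀ (f : Point n → Fin 4) {I J} → J ⊏ I → Linear∂ f I → Linear f J
  linear-⊏ f p l z with ⊏-emb p z
  ... | y , h , e = subst (λ x → f x ≡ lin f x) e (l y h)

  occurs? : ∀ (f : Point n → Fin 4) (I : Face n) a → Dec (Occurs (f ∘ emb I) a)
  occurs? f I a = any-point? λ x → interior? x ×-dec (defect (f ∘ emb I) x ≟ a)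

  -- Without a triple point the coinciding pair can only be f and g; a triple point makes the
  -- boundary linear.
  third-completion : ∀ {f g h : Point n → Fin 4} {I} → 2 ≤ ∣ I ∣ → Latin f → Latin g → Latin h →
    Agree∂ f g I → Agree∂ g h I → ¬ Agree g h I → ¬ Agree f h I → Agree f g I ⊎ Linear∂ f I
  third-completion {f} {g} {h} {I} 2≤ Lf Lg Lh fg∂ gh∂ ¬gh ¬fh
    with triple-point (f ∘ emb I) (g ∘ emb I) (h ∘ emb I) (emb-latin I Lf) (emb-latin I Lg) (emb-latin I Lh) fg∂ gh∂
  ... | inj₂ (p₁₂ , e) = inj₁ e
  ... | inj₂ (p₂₃ , e) = ⊥-elim (¬gh e)
  ... | inj₂ (p₁₃ , e) = ⊥-elim (¬fh e)
  ... | inj₁ T = inj₂ λ y z → trans (go 2≤ (f ∘ emb I) (g ∘ emb I) (h ∘ emb I) (emb-latin I Lf) (emb-latin I Lg) (emb-latin I Lh) fg∂ gh∂ T y z) (lin-emb f I y)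
    where
    go : ∀ {m} → 2 ≤ m → (f g h : Point m → Fin 4) → Latin f → Latin g → Latin h →
      (∀ x → HasZero x → f x ≡ g x) → (∀ x → HasZero x → g x ≡ h x) → Triple f g h → ∀ x → HasZero x → f x ≡ lin f x
    go (s≤s (s≤s z≤n)) = linear-boundary

  same-defects : ∀ {f g : Point n → Fin 4} {I} → 2 ≤ ∣ I ∣ → Latin f → Latin g → Agree∂ f g I → Linear∂ f I →
    (∀ a → a ≢ 𝟎 → does (occurs? f I a) ≡ does (occurs? g I a)) → Agree f g I
  same-defects {f} {g} {I} 2≤ Lf Lg fg∂ l o = go 2≤ (f ∘ emb I) (g ∘ emb I) (emb-latin I Lf) (emb-latin I Lg) fg∂
    (λ y z → trans (l y z) (sym (lin-emb f I y)))
    (λ a a≢0 → does-transfer (occurs? f I a) (occurs? g I a) (o a a≢0))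
    (λ a a≢0 → does-transfer (occurs? g I a) (occurs? f I a) (sym (o a a≢0)))
    where
    go : ∀ {m} → 2 ≤ m → (f g : Point m → Fin 4) → Latin f → Latin g → (∀ x → HasZero x → f x ≡ g x) →
      (∀ x → HasZero x → f x ≡ lin f x) → (∀ a → a ≢ 𝟎 → Occurs f a → Occurs g a) →
      (∀ a → a ≢ 𝟎 → Occurs g a → Occurs f a) → ∀ x → f x ≡ g x
    go (s≤s (s≤s z≤n)) = determined

  both-linear : ∀ (f g : Point n → Fin 4) {I} → 2 ≤ ∣ I ∣ → Agree∂ f g I → Linear f I → Linear g I → Agree f g I
  both-linear f g {I} 2≤ fg∂ lf lg y = trans (lf y) (trans (sym (lin-emb f I y)) (trans (go 2≤ (f ∘ emb I) (g ∘ emb I) fg∂ y) (trans (lin-emb g I y) (sym (lg y)))))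
    where
    go : ∀ {m} → 2 ≤ m → (f g : Point m → Fin 4) → (∀ x → HasZero x → f x ≡ g x) → ∀ x → lin f x ≡ lin g x
    go (s≤s (s≤s z≤n)) = lin-cong

-- Encoding the members of a list of Latin functions

module Encoding {n : ℕ} (Ls : List (Point n → Fin 4)) (latin : ∀ {f} → f ∈ Ls → Latin f) where

  -- A choice of completion that depends only on the boundary values of f, as `first-cong` shows.
  -- The default f is never reached when f is in the list.
  first : List (Point n → Fin 4) → (Point n → Fin 4) → Face n → (Point n → Fin 4)
  first [] f I = f
  first (g ∷ gs) f I with agree∂? f g I
  ... | yes _ = g
  ... | no _ = first gs f I

  canonical : (Point n → Fin 4) → Face n → (Point n → Fin 4)
  canonical = first Ls

  first-agrees : ∀ gs f I → Agree∂ f (first gs f I) I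
  first-agrees [] f I y z = refl
  first-agrees (g ∷ gs) f I with agree∂? f g I
  ... | yes p = p
  ... | no _ = first-agrees gs f I

  first-∈ : ∀ gs {f} I → f ∈ gs → first gs f I ∈ gs
  first-∈ (g ∷ gs) {f} I p with agree∂? f g I
  first-∈ (g ∷ gs) {f} I p | yes _ = here refl
  first-∈ (g ∷ gs) {f} I (here refl) | no ¬q = ⊥-elim (¬q λ _ _ → refl)
  first-∈ (g ∷ gs) {f} I (there p) | no _ = there (first-∈ gs I p)

  first-cong : ∀ gs {f g} I → f ∈ gs → Agree∂ f g I → first gs f I ≡ first gs g I
  first-cong (h ∷ gs) {f} {g} I p e with agree∂? f h I | agree∂? g h I
  ... | yes _ | yes _ = refl
  ... | yes q | no r = ⊥-elim (r λ y z → trans (sym (e y z)) (q y z))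
  ... | no q | yes r = ⊥-elim (q λ y z → trans (e y z) (r y z))
  first-cong (h ∷ gs) {f} {g} I (here refl) e | no q | no r = ⊥-elim (q λ _ _ → refl)
  first-cong (h ∷ gs) {f} {g} I (there p) e | no q | no r = first-cong gs I p e

  bit : (Point n → Fin 4) → Face n → Bool
  bit f I = does (agree? f (canonical f I) I)

  -- Two of at most two completions are told apart by their bits; a third completion forces linearity.
  bit-step : ∀ {f g I} → f ∈ Ls → g ∈ Ls → 2 ≤ ∣ I ∣ → Agree∂ f g I → bit f I ≡ bit g I → Agree f g I ⊎ Linear∂ f I
  bit-step {f} {g} {I} f∈ g∈ 2≤ fg∂ e with agree? f (canonical f I) I | agree? g (canonical g I) I
  ... | yes p | yes q = inj₁ λ y → trans (p y) (trans (cong (λ h → h (emb I y)) (first-cong Ls I f∈ fg∂)) (sym (q y)))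
  ... | no p | no q = third-completion 2≤ (latin f∈) (latin g∈) (latin (first-∈ Ls I g∈)) fg∂ (first-agrees Ls g I) q
    (λ r → p λ y → trans (r y) (cong (λ h → h (emb I y)) (sym (first-cong Ls I f∈ fg∂))))

  extra : (Point n → Fin 4) → Face n → Vec Bool 4
  extra f I = bit f I ∷ does (occurs? f I 𝟏) ∷ does (occurs? f I 𝟐) ∷ does (occurs? f I 𝟑) ∷ []

  extra-step : ∀ {f g I} → f ∈ Ls → g ∈ Ls → 2 ≤ ∣ I ∣ → Agree∂ f g I → extra f I ≡ extra g I → Agree f g I
  extra-step {f} {g} {I} f∈ g∈ 2≤ fg∂ e with ∷-injective e
  ... | e₀ , e′ with ∷-injective e′
  ... | e₁ , e″ with ∷-injective e″
  ... | e₂ , e‴ with ∷-injective e‴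
  ... | e₃ , _ with bit-step f∈ g∈ 2≤ fg∂ e₀
  ... | inj₁ a = a
  ... | inj₂ l = same-defects 2≤ (latin f∈) (latin g∈) fg∂ l occ
    where
    occ : ∀ a → a ≢ 𝟎 → does (occurs? f I a) ≡ does (occurs? g I a)
    occ 𝟎 p = ⊥-elim (p refl)
    occ 𝟏 _ = e₁
    occ 𝟐 _ = e₂
    occ 𝟑 _ = e₃

  -- One bit per face of the chain: "not yet linear" up to the first non-linear face, "canonical" after it.
  -- The four extra bits describe f on that first non-linear face.
  chain-code : (Point n → Fin 4) → (c : List (Face n)) → Vec Bool (length c + 4)
  chain-code f [] = replicate 4 false
  chain-code f (I ∷ Is) with linear? f I
  ... | yes _ = false ∷ chain-code f Is
  ... | no _ = true ∷ Vec.map (bit f) (fromList Is) Vec.++ extra f I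

  bits-∈ : ∀ {f g I} Is → Vec.map (bit f) (fromList Is) ≡ Vec.map (bit g) (fromList Is) → I ∈ Is → bit f I ≡ bit g I
  bits-∈ (J ∷ Is) e (here refl) = proj₁ (∷-injective e)
  bits-∈ (J ∷ Is) e (there p) = bits-∈ Is (proj₂ (∷-injective e)) p

  chain-step : ∀ {f g I} c → AllPairs _⊏_ c → f ∈ Ls → g ∈ Ls → chain-code f c ≡ chain-code g c → I ∈ c →
    2 ≤ ∣ I ∣ → Agree∂ f g I → Agree f g I
  chain-step {f} {g} (J ∷ Is) (J⊏ ∷ s) f∈ g∈ e I∈ 2≤ fg∂ with linear? f J | linear? g J
  chain-step {f} {g} (J ∷ Is) (J⊏ ∷ s) f∈ g∈ e (here refl) 2≤ fg∂ | yes lf | yes lg = both-linear f g 2≤ fg∂ lf lg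
  chain-step {f} {g} (J ∷ Is) (J⊏ ∷ s) f∈ g∈ e (there I∈) 2≤ fg∂ | yes lf | yes lg =
    chain-step Is s f∈ g∈ (proj₂ (∷-injective e)) I∈ 2≤ fg∂
  chain-step {f} {g} (J ∷ Is) (J⊏ ∷ s) f∈ g∈ e (here refl) 2≤ fg∂ | no ¬lf | no ¬lg =
    extra-step f∈ g∈ 2≤ fg∂ (proj₂ (++-injective _ _ (proj₂ (∷-injective e))))
  chain-step {f} {g} (J ∷ Is) (J⊏ ∷ s) f∈ g∈ e (there I∈) 2≤ fg∂ | no ¬lf | no ¬lg
    with bit-step f∈ g∈ 2≤ fg∂ (bits-∈ Is (proj₁ (++-injective _ _ (proj₂ (∷-injective e)))) I∈)
  ... | inj₁ a = a
  -- J is contained in the boundary of I and is not linear.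
  ... | inj₂ l = ⊥-elim (¬lf (linear-⊏ f (All.lookup J⊏ I∈) l))
  chain-step (J ∷ Is) _ _ _ () _ _ _ | yes _ | no _
  chain-step (J ∷ Is) _ _ _ () _ _ _ | no _ | yes _

code-length : ∀ {n} → List (List (Face n)) → ℕ
code-length [] = 0
code-length (c ∷ cs) = (length c + 4) + code-length cs

record Cover (n : ℕ) : Set where
  field
    chains : List (List (Face n))
    sorted : All (AllPairs _⊏_) chains
    covers : ∀ I → ∃ λ c → c ∈ chains × I ∈ c

module Codes {n : ℕ} (Ls : List (Point (suc n) → Fin 4)) (latin : ∀ {f} → f ∈ Ls → Latin f) (K : Cover (suc n)) where
  open Encoding Ls latin
  open Cover K

  codes : (Point (suc n) → Fin 4) → (cs : List (List (Face (suc n)))) → Vec Bool (code-length cs)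
  codes f [] = []
  codes f (c ∷ cs) = chain-code f c Vec.++ codes f cs

  codes-∈ : ∀ {f g c} cs → codes f cs ≡ codes g cs → c ∈ cs → chain-code f c ≡ chain-code g c
  codes-∈ (c ∷ cs) e (here refl) = proj₁ (++-injective _ _ e)
  codes-∈ (c ∷ cs) e (there p) = codes-∈ cs (proj₂ (++-injective _ _ e)) p

  axes : (Point (suc n) → Fin 4) → Vec (Vec (Fin 4) 4) (suc n)
  axes f = tabulate λ i → tabulate λ t → f (axis i t)

  -- Strong induction on ∥ x ∥: x is interior to the face `supp x`, whose boundary points have
  -- smaller weight. Weight at most 1 is read off the stored axes, since the boundary arguments
  -- start in dimension two.
  codes-injective : ∀ {f g} → f ∈ Ls → g ∈ Ls → codes f chains ≡ codes g chains → axes f ≡ axes g → ∀ x → f x ≡ g x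
  codes-injective {f} {g} f∈ g∈ ec ea x = <-rec P step ∥ x ∥ x refl
    where
    P : ℕ → Set
    P N = ∀ x → ∥ x ∥ ≡ N → f x ≡ g x
    on-axis : ∀ i t → f (axis i t) ≡ g (axis i t)
    on-axis i t = begin
      f (axis i t) ≡⟨ lookup∘tabulate (λ s → f (axis i s)) t ⟨
      lookup (tabulate λ s → f (axis i s)) t ≡⟨ cong (λ v → lookup v t) (lookup∘tabulate (λ j → tabulate λ s → f (axis j s)) i) ⟨
      lookup (lookup (axes f) i) t ≡⟨ cong (λ v → lookup (lookup v i) t) ea ⟩
      lookup (lookup (axes g) i) t ≡⟨ cong (λ v → lookup v t) (lookup∘tabulate (λ j → tabulate λ s → g (axis j s)) i) ⟩
      lookup (tabulate λ s → g (axis i s)) t ≡⟨ lookup∘tabulate (λ s → g (axis i s)) t ⟩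
      g (axis i t) ∎
      where open ≡-Reasoning
    step : ∀ N → (∀ {M} → M < N → P M) → P N
    step N IH x nx with 2 ≤? ∥ x ∥
    ... | no ¬2 with ≤1-axis x ¬2
    ... | i , e = trans (cong f e) (trans (on-axis i _) (cong g (sym e)))
    step N IH x nx | yes 2≤ with covers (supp x)
    ... | c , c∈ , I∈ = trans (cong f (sym (emb-core x))) (trans
      (chain-step c (All.lookup sorted c∈) f∈ g∈ (codes-∈ chains ec c∈) I∈ (≤-trans 2≤ (≤-reflexive (sym (size-supp x)))) below (core x))
      (cong g (emb-core x)))
      where
      below : Agree∂ f g (supp x)
      below y z = IH (≤-trans (≤-reflexive (cong suc (emb-norm (supp x) y)))
        (≤-trans (norm< y z) (≤-reflexive (trans (size-supp x) nx)))) (emb (supp x) y) refl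

-- Covering the faces by chains, block by block

⊑-refl : ∀ {n} (I : Face n) → I ⊑ I
⊑-refl [] = []
⊑-refl (b ∷ I) = keep (⊑-refl I)

⊑-empty : ∀ {n} (I : Face n) → replicate n false ⊑ I
⊑-empty [] = []
⊑-empty (true ∷ I) = add (⊑-empty I)
⊑-empty (false ∷ I) = keep (⊑-empty I)

⊑-++ : ∀ {m n} {I J : Face m} (K : Face n) → J ⊑ I → J Vec.++ K ⊑ I Vec.++ K
⊑-++ K [] = ⊑-refl K
⊑-++ K (keep p) = keep (⊑-++ K p)
⊑-++ K (add p) = add (⊑-++ K p)

⊏-++ : ∀ {m n} {I J : Face m} (K : Face n) → J ⊏ I → J Vec.++ K ⊏ I Vec.++ K
⊏-++ K (keep p) = keep (⊏-++ K p)
⊏-++ K (add p) = add (⊑-++ K p)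

++-⊏ : ∀ {m n} (K : Face m) {I J : Face n} → J ⊏ I → K Vec.++ J ⊏ K Vec.++ I
++-⊏ [] p = p
++-⊏ (b ∷ K) p = keep (++-⊏ K p)

faces : ∀ n → List (Face n)
faces zero = [] ∷ []
faces (suc n) = map (true ∷_) (faces n) ++ map (false ∷_) (faces n)

faces-complete : ∀ {n} (I : Face n) → I ∈ faces n
faces-complete [] = here refl
faces-complete (true ∷ I) = ∈-++⁺ˡ (∈-map⁺ (true ∷_) (faces-complete I))
faces-complete (false ∷ I) = ∈-++⁺ʳ _ (∈-map⁺ (false ∷_) (faces-complete I))

length-faces : ∀ n → length (faces n) ≡ 2 ^ n
length-faces zero = refl
length-faces (suc n) = trans (length-++ (map (true ∷_) (faces n)))
  (cong₂ _+_ (trans (length-map _ (faces n)) (length-faces n))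
    (trans (length-map _ (faces n)) (trans (length-faces n) (sym (+-identityʳ _)))))

-- The maximal chain of initial segments of a block.
prefixes : ∀ L → List (Face L)
prefixes zero = [] ∷ []
prefixes (suc L) = replicate (suc L) false ∷ map (true ∷_) (prefixes L)

prefixes-sorted : ∀ L → AllPairs _⊏_ (prefixes L)
prefixes-sorted zero = [] ∷ []
prefixes-sorted (suc L) = map⁺ (All.universal (λ J → add (⊑-empty J)) (prefixes L)) ∷ AllPairs.map⁺ (AllPairs.map keep (prefixes-sorted L))

length-prefixes : ∀ L → length (prefixes L) ≡ suc L
length-prefixes zero = refl
length-prefixes (suc L) = cong suc (trans (length-map _ (prefixes L)) (length-prefixes L))

nonempty nonprefixes : ∀ L → List (Face L)
nonempty zero = []
nonempty (suc L) = map (true ∷_) (faces L) ++ map (false ∷_) (nonempty L)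
nonprefixes zero = []
nonprefixes (suc L) = map (true ∷_) (nonprefixes L) ++ map (false ∷_) (nonempty L)

nonempty-complete : ∀ {L} (I : Face L) → I ≡ replicate L false ⊎ I ∈ nonempty L
nonempty-complete [] = inj₁ refl
nonempty-complete (true ∷ I) = inj₂ (∈-++⁺ˡ (∈-map⁺ (true ∷_) (faces-complete I)))
nonempty-complete (false ∷ I) = Sum.map (cong (false ∷_)) (∈-++⁺ʳ _ ∘ ∈-map⁺ (false ∷_)) (nonempty-complete I)

nonprefixes-complete : ∀ {L} (I : Face L) → I ∈ prefixes L ⊎ I ∈ nonprefixes L
nonprefixes-complete [] = inj₁ (here refl)
nonprefixes-complete (true ∷ I) = Sum.map (there ∘ ∈-map⁺ (true ∷_)) (∈-++⁺ˡ ∘ ∈-map⁺ (true ∷_)) (nonprefixes-complete I)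
nonprefixes-complete (false ∷ I) = Sum.map (here ∘ cong (false ∷_)) (∈-++⁺ʳ _ ∘ ∈-map⁺ (false ∷_)) (nonempty-complete I)

length-nonempty : ∀ L → suc (length (nonempty L)) ≡ 2 ^ L
length-nonempty zero = refl
length-nonempty (suc L) = begin
  suc (length (map (true ∷_) (faces L) ++ map (false ∷_) (nonempty L))) ≡⟨ cong suc (length-++ (map (true ∷_) (faces L))) ⟩
  suc (length (map (true ∷_) (faces L)) + length (map (false ∷_) (nonempty L)))
    ≡⟨ cong suc (cong₂ _+_ (trans (length-map _ (faces L)) (length-faces L)) (length-map _ (nonempty L))) ⟩
  suc (2 ^ L + length (nonempty L)) ≡⟨ +-suc (2 ^ L) _ ⟨
  2 ^ L + suc (length (nonempty L)) ≡⟨ cong (2 ^ L +_) (trans (length-nonempty L) (sym (+-identityʳ _))) ⟩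
  2 ^ suc L ∎
  where open ≡-Reasoning

length-nonprefixes : ∀ L → suc L + length (nonprefixes L) ≡ 2 ^ L
length-nonprefixes zero = refl
length-nonprefixes (suc L) = begin
  suc (suc L) + length (map (true ∷_) (nonprefixes L) ++ map (false ∷_) (nonempty L))
    ≡⟨ cong (suc (suc L) +_) (trans (length-++ (map (true ∷_) (nonprefixes L)))
         (cong₂ _+_ (length-map _ (nonprefixes L)) (length-map _ (nonempty L)))) ⟩
  suc (suc L) + (length (nonprefixes L) + length (nonempty L))
    ≡⟨ solve 3 (λ l a b → con 2 :+ l :+ (a :+ b) := (con 1 :+ l :+ a) :+ (con 1 :+ b)) refl L (length (nonprefixes L)) (length (nonempty L)) ⟩
  (suc L + length (nonprefixes L)) + suc (length (nonempty L))
    ≡⟨ cong₂ _+_ (length-nonprefixes L) (trans (length-nonempty L) (sym (+-identityʳ _))) ⟩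
  2 ^ suc L ∎
  where
  open ≡-Reasoning
  open +-*-Solver

code-length-++ : ∀ {n} (cs ds : List (List (Face n))) → code-length (cs ++ ds) ≡ code-length cs + code-length ds
code-length-++ [] ds = refl
code-length-++ (c ∷ cs) ds = trans (cong (length c + 4 +_) (code-length-++ cs ds)) (sym (+-assoc (length c + 4) _ _))

code-length-map : ∀ {m n} (h : Face m → Face n) cs → code-length (map (map h) cs) ≡ code-length cs
code-length-map h [] = refl
code-length-map h (c ∷ cs) = cong₂ _+_ (cong (_+ 4) (length-map h c)) (code-length-map h cs)

code-length-uniform : ∀ {A : Set} {n} (F : A → List (Face n)) l → (∀ a → length (F a) ≡ l) → ∀ as → code-length (map F as) ≡ length as * (l + 4)
code-length-uniform F l e [] = refl
code-length-uniform F l e (a ∷ as) = cong₂ _+_ (cong (_+ 4) (e a)) (code-length-uniform F l e as)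

code-length-concatMap : ∀ {A : Set} {n} (F : A → List (List (Face n))) w → (∀ a → code-length (F a) ≡ w) →
  ∀ as → code-length (concatMap F as) ≡ length as * w
code-length-concatMap F w e [] = refl
code-length-concatMap F w e (a ∷ as) = trans (code-length-++ (F a) (concatMap F as)) (cong₂ _+_ (e a) (code-length-concatMap F w e as))

-- The coordinates are cut into B blocks of length L and a rest of length r. A face moves along the
-- prefixes of the first block in which it is a prefix; the faces without such a block stay alone.
module Blocks (L : ℕ) where

  dim : ℕ → ℕ → ℕ
  dim zero r = r
  dim (suc B) r = L + dim B r

  dim≡ : ∀ B r → dim B r ≡ B * L + r
  dim≡ zero r = refl
  dim≡ (suc B) r = trans (cong (L +_) (dim≡ B r)) (sym (+-assoc L _ r))

  through : ∀ {n} → Face n → List (Face (L + n))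
  through I = map (Vec._++ I) (prefixes L)

  chains : ∀ B r → List (List (Face (dim B r)))
  chains zero r = map (_∷ []) (faces r)
  chains (suc B) r = map through (faces (dim B r)) ++ concatMap (λ A → map (map (A Vec.++_)) (chains B r)) (nonprefixes L)

  chains-sorted : ∀ B r → All (AllPairs _⊏_) (chains B r)
  chains-sorted zero r = map⁺ (All.universal (λ I → [] ∷ []) (faces r))
  chains-sorted (suc B) r = ++⁺
    (map⁺ (All.universal (λ I → AllPairs.map⁺ (AllPairs.map (⊏-++ I) (prefixes-sorted L))) (faces (dim B r))))
    (concat⁺ (map⁺ (All.universal (λ A → map⁺ (All.map (λ s → AllPairs.map⁺ (AllPairs.map (++-⊏ A) s)) (chains-sorted B r))) (nonprefixes L))))

  chains-cover : ∀ B r (I : Face (dim B r)) → ∃ λ c → c ∈ chains B r × I ∈ c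
  chains-cover zero r I = I ∷ [] , ∈-map⁺ (_∷ []) (faces-complete I) , here refl
  chains-cover (suc B) r I with splitAt L I
  ... | A , J , refl with nonprefixes-complete A
  ... | inj₁ p = through J , ∈-++⁺ˡ (∈-map⁺ through (faces-complete J)) , ∈-map⁺ (Vec._++ J) p
  ... | inj₂ p with chains-cover B r J
  ... | c , c∈ , J∈ = map (A Vec.++_) c ,
    ∈-++⁺ʳ (map through (faces (dim B r))) (∈-concatMap⁺ (λ A → map (map (A Vec.++_)) (chains B r)) (Any.map (λ { refl → ∈-map⁺ (map (A Vec.++_)) c∈ }) p)) ,
    ∈-map⁺ (A Vec.++_) J∈

  cover : ∀ B r → Cover (dim B r)
  cover B r = record { chains = chains B r ; sorted = chains-sorted B r ; covers = chains-cover B r }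

  p q : ℕ
  p = length (nonprefixes L)
  q = 2 ^ L

  q≡ : suc L + p ≡ q
  q≡ = length-nonprefixes L

  2^dim : ∀ B r → 2 ^ dim B r ≡ q ^ B * 2 ^ r
  2^dim zero r = sym (+-identityʳ _)
  2^dim (suc B) r = trans (^-distribˡ-+-* 2 L (dim B r)) (trans (cong (q *_) (2^dim B r)) (sym (*-assoc q _ _)))

  code-length-zero : ∀ r → code-length (chains 0 r) ≡ 2 ^ r * 5
  code-length-zero r = trans (code-length-uniform (_∷ []) 1 (λ _ → refl) (faces r)) (cong (_* 5) (length-faces r))

  code-length-suc : ∀ B r → code-length (chains (suc B) r) ≡ 2 ^ dim B r * (suc L + 4) + p * code-length (chains B r)
  code-length-suc B r = trans (code-length-++ (map through (faces (dim B r))) _) (cong₂ _+_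
    (trans (code-length-uniform through (suc L) (λ I → trans (length-map _ (prefixes L)) (length-prefixes L)) (faces (dim B r)))
      (cong (_* (suc L + 4)) (length-faces (dim B r))))
    (code-length-concatMap _ (code-length (chains B r)) (λ A → code-length-map (A Vec.++_) (chains B r)) (nonprefixes L)))

  -- Solves the recursion W(B+1) = (L + 5) q^B 2^r + p W(B) with W(0) = 5 * 2^r. The factor L + 1 =
  -- q - p clears the denominator of the geometric sum.
  weighted-length : ∀ B r → suc L * code-length (chains B r) ≡ ((L + 5) * q ^ B + 4 * L * p ^ B) * 2 ^ r
  weighted-length zero r = trans (cong (suc L *_) (code-length-zero r))
    (solve 2 (λ l t → (con 1 :+ l) :* (t :* con 5) := ((l :+ con 5) :* con 1 :+ con 4 :* l :* con 1) :* t) refl L (2 ^ r))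
    where open +-*-Solver
  weighted-length (suc B) r = begin
    suc L * code-length (chains (suc B) r) ≡⟨ cong (suc L *_) (code-length-suc B r) ⟩
    suc L * (2 ^ dim B r * (suc L + 4) + p * W) ≡⟨ cong (λ d → suc L * (d * (suc L + 4) + p * W)) (2^dim B r) ⟩
    suc L * (q ^ B * t * (suc L + 4) + p * W)
      ≡⟨ solve 5 (λ l Q t p w → (con 1 :+ l) :* (Q :* t :* (con 1 :+ l :+ con 4) :+ p :* w)
           := (con 1 :+ l) :* (l :+ con 5) :* Q :* t :+ p :* ((con 1 :+ l) :* w)) refl L (q ^ B) t p W ⟩
    suc L * (L + 5) * q ^ B * t + p * (suc L * W) ≡⟨ cong (λ w → suc L * (L + 5) * q ^ B * t + p * w) (weighted-length B r) ⟩
    suc L * (L + 5) * q ^ B * t + p * (((L + 5) * q ^ B + 4 * L * p ^ B) * t)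
      ≡⟨ solve 5 (λ l Q t p P → (con 1 :+ l) :* (l :+ con 5) :* Q :* t :+ p :* (((l :+ con 5) :* Q :+ con 4 :* l :* P) :* t)
           := ((l :+ con 5) :* ((con 1 :+ l :+ p) :* Q) :+ con 4 :* l :* (p :* P)) :* t) refl L (q ^ B) t p (p ^ B) ⟩
    ((L + 5) * ((suc L + p) * q ^ B) + 4 * L * (p * p ^ B)) * t ≡⟨ cong (λ s → ((L + 5) * (s * q ^ B) + 4 * L * (p * p ^ B)) * t) q≡ ⟩
    ((L + 5) * q ^ suc B + 4 * L * p ^ suc B) * t ∎
    where
    open ≡-Reasoning
    open +-*-Solver
    W = code-length (chains B r)
    t = 2 ^ r

  -- The hypothesis absorbs 4 L p^B into 4 q^B, and 9 = 5 + 4.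
  code-length-bound : ∀ B r → L * p ^ B ≤ q ^ B → suc L * code-length (chains B r) ≤ (L + 9) * 2 ^ dim B r
  code-length-bound B r h = begin
    suc L * code-length (chains B r) ≡⟨ weighted-length B r ⟩
    ((L + 5) * q ^ B + 4 * L * p ^ B) * 2 ^ r ≡⟨ cong (λ s → ((L + 5) * q ^ B + s) * 2 ^ r) (*-assoc 4 L (p ^ B)) ⟩
    ((L + 5) * q ^ B + 4 * (L * p ^ B)) * 2 ^ r ≤⟨ *-monoˡ-≤ (2 ^ r) (+-monoʳ-≤ ((L + 5) * q ^ B) (*-monoʳ-≤ 4 h)) ⟩
    ((L + 5) * q ^ B + 4 * q ^ B) * 2 ^ r ≡⟨ solve 3 (λ l Q t → ((l :+ con 5) :* Q :+ con 4 :* Q) :* t := (l :+ con 9) :* (Q :* t)) refl L (q ^ B) (2 ^ r) ⟩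
    (L + 9) * (q ^ B * 2 ^ r) ≡⟨ cong ((L + 9) *_) (2^dim B r) ⟨
    (L + 9) * 2 ^ dim B r ∎
    where
    open ≤-Reasoning
    open +-*-Solver

-- Choosing the length and the number of the blocks

bernoulli : ∀ p B → (p + B) * p ^ B ≤ p * suc p ^ B
bernoulli p zero = ≤-reflexive (cong (_* 1) (+-identityʳ p))
bernoulli p (suc B) = begin
  (p + suc B) * (p * p ^ B) ≡⟨ solve 3 (λ p b P → (p :+ (con 1 :+ b)) :* (p :* P) := (p :* (p :+ b) :+ p) :* P) refl p B (p ^ B) ⟩
  (p * (p + B) + p) * p ^ B ≤⟨ *-monoˡ-≤ (p ^ B) (+-monoʳ-≤ (p * (p + B)) (m≤m+n p B)) ⟩
  (p * (p + B) + (p + B)) * p ^ B ≡⟨ solve 3 (λ p b P → (p :* (p :+ b) :+ (p :+ b)) :* P := (con 1 :+ p) :* ((p :+ b) :* P)) refl p B (p ^ B) ⟩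
  suc p * ((p + B) * p ^ B) ≤⟨ *-monoʳ-≤ (suc p) (bernoulli p B) ⟩
  suc p * (p * suc p ^ B) ≡⟨ solve 3 (λ s p P → s :* (p :* P) := p :* (s :* P)) refl (suc p) p (suc p ^ B) ⟩
  p * (suc p * suc p ^ B) ∎
  where
  open ≤-Reasoning
  open +-*-Solver

-- For positive p and B = L p, Bernoulli's inequality (1 + 1/p)^B ≥ 1 + B/p gives 1 + L.
power-dominates : ∀ L p → ∃ λ B → L * p ^ B ≤ suc p ^ B
power-dominates L zero = 1 , ≤-trans (≤-reflexive (*-zeroʳ L)) z≤n
power-dominates L p@(suc _) = L * p , *-cancelˡ-≤ p (begin
  p * (L * p ^ (L * p)) ≡⟨ solve 3 (λ p L P → p :* (L :* P) := L :* p :* P) refl p L (p ^ (L * p)) ⟩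
  L * p * p ^ (L * p) ≤⟨ *-monoˡ-≤ (p ^ (L * p)) (m≤n+m (L * p) p) ⟩
  (p + L * p) * p ^ (L * p) ≤⟨ bernoulli p (L * p) ⟩
  p * suc p ^ (L * p) ∎)
  where
  open ≤-Reasoning
  open +-*-Solver

n≤2^n : ∀ n → n ≤ 2 ^ n
n≤2^n zero = z≤n
n≤2^n (suc n) = ≤-trans (+-mono-≤ (m^n>0 2 n) (n≤2^n n)) (≤-reflexive (cong (2 ^ n +_) (sym (+-identityʳ _))))

-- At n = 4c + 1 the two summands of c n = c + (2c)^2 each fit into one half of 2^n; from there on,
-- doubling outgrows the increment.
exponential-dominates : ∀ c → ∃ λ m → ∀ n → n ≥ m → c * n ≤ 2 ^ n
exponential-dominates c = suc (4 * c) , λ n n≥ → subst (λ n → c * n ≤ 2 ^ n) (m+[n∸m]≡n n≥) (grow (n ∸ suc (4 * c)))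
  where
  open ≤-Reasoning
  open +-*-Solver
  2c≤4^c : 2 * c ≤ 4 ^ c
  2c≤4^c = begin
    2 * c ≤⟨ n≤2^n (2 * c) ⟩
    2 ^ (2 * c) ≡⟨ ^-*-assoc 2 2 c ⟨
    4 ^ c ∎
  base : c * suc (4 * c) ≤ 2 ^ suc (4 * c)
  base = begin
    c * suc (4 * c) ≡⟨ solve 1 (λ c → c :* (con 1 :+ con 4 :* c) := c :+ con 2 :* c :* (con 2 :* c)) refl c ⟩
    c + 2 * c * (2 * c) ≤⟨ +-mono-≤ (≤-trans (m≤n*m c 4) (n≤2^n (4 * c))) (*-mono-≤ 2c≤4^c 2c≤4^c) ⟩
    2 ^ (4 * c) + 4 ^ c * 4 ^ c ≡⟨ cong (2 ^ (4 * c) +_) (trans (sym (^-distribˡ-+-* 4 c c)) (trans (^-*-assoc 2 2 (c + c)) (cong (2 ^_) (solve 1 (λ c → con 2 :* (c :+ c) := con 4 :* c) refl c)))) ⟩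
    2 ^ (4 * c) + 2 ^ (4 * c) ≡⟨ cong (2 ^ (4 * c) +_) (+-identityʳ _) ⟨
    2 ^ suc (4 * c) ∎
  grow : ∀ i → c * (suc (4 * c) + i) ≤ 2 ^ (suc (4 * c) + i)
  grow zero = subst (λ n → c * n ≤ 2 ^ n) (sym (+-identityʳ _)) base
  grow (suc i) = subst (λ n → c * n ≤ 2 ^ n) (sym (+-suc _ i)) (begin
    c * suc m ≤⟨ *-monoʳ-≤ c (+-monoˡ-≤ m (s≤s z≤n)) ⟩
    c * (m + m) ≡⟨ *-distribˡ-+ c m m ⟩
    c * m + c * m ≤⟨ +-mono-≤ (grow i) (grow i) ⟩
    2 ^ m + 2 ^ m ≡⟨ cong (2 ^ m +_) (+-identityʳ _) ⟨
    2 ^ suc m ∎)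
    where
    m = suc (4 * c) + i

-- The 8 n bits account for the values on the coordinate axes.
economical-cover : ∀ k → k ≥ 1 → ∃ λ m → ∀ n → n ≥ m → Σ (Cover n) λ K → k * (code-length (Cover.chains K) + 8 * n) ≤ (k + 1) * 2 ^ n
economical-cover k@(suc k′) k≥1 = m₀ , build
  where
  -- L + 1 = 16 k turns (L + 9)/(L + 1) into 1 + 1/(2k); the bits for the axes use the other 1/(2k)
  -- of the allowed excess.
  L : ℕ
  L = 15 + 16 * k′
  open Blocks L
  B : ℕ
  B = proj₁ (power-dominates L p)
  dominated : L * p ^ B ≤ q ^ B
  dominated = ≤-trans (proj₂ (power-dominates L p)) (^-monoˡ-≤ B (≤-trans (s≤s (m≤n+m p L)) (≤-reflexive q≡)))
  m₁ : ℕ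
  m₁ = proj₁ (exponential-dominates (16 * k))
  m₀ : ℕ
  m₀ = B * L + m₁
  bound : ∀ r → dim B r ≥ m₁ → k * (code-length (chains B r) + 8 * dim B r) ≤ (k + 1) * 2 ^ dim B r
  bound r big = *-cancelˡ-≤ 16 (begin
    16 * (k * (W + 8 * n)) ≡⟨ solve 3 (λ k W n → con 16 :* (k :* (W :+ con 8 :* n)) := con 16 :* k :* W :+ con 8 :* (con 16 :* k :* n)) refl k W n ⟩
    16 * k * W + 8 * (16 * k * n) ≤⟨ +-mono-≤ first (*-monoʳ-≤ 8 (proj₂ (exponential-dominates (16 * k)) n big)) ⟩
    (16 * k + 8) * 2 ^ n + 8 * 2 ^ n ≡⟨ solve 2 (λ k T → (con 16 :* k :+ con 8) :* T :+ con 8 :* T := con 16 :* ((k :+ con 1) :* T)) refl k (2 ^ n) ⟩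
    16 * ((k + 1) * 2 ^ n) ∎)
    where
    open ≤-Reasoning
    open +-*-Solver
    n = dim B r
    W = code-length (chains B r)
    first : 16 * k * W ≤ (16 * k + 8) * 2 ^ n
    first = begin
      16 * k * W ≡⟨ cong (_* W) (solve 1 (λ k → con 16 :* (con 1 :+ k) := con 16 :+ con 16 :* k) refl k′) ⟩
      suc L * W ≤⟨ code-length-bound B r dominated ⟩
      (L + 9) * 2 ^ n ≡⟨ cong (_* 2 ^ n) (solve 1 (λ k → con 15 :+ con 16 :* k :+ con 9 := con 16 :* (con 1 :+ k) :+ con 8) refl k′) ⟩
      (16 * k + 8) * 2 ^ n ∎
  build : ∀ n → n ≥ m₀ → Σ (Cover n) λ K → k * (code-length (Cover.chains K) + 8 * n) ≤ (k + 1) * 2 ^ n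
  build n n≥ = subst (λ n → Σ (Cover n) λ K → k * (code-length (Cover.chains K) + 8 * n) ≤ (k + 1) * 2 ^ n) n≡
    (cover B r , bound r (≤-trans (m≤n+m m₁ (B * L)) (≤-trans n≥ (≤-reflexive (sym n≡)))))
    where
    r : ℕ
    r = n ∸ B * L
    n≡ : dim B r ≡ n
    n≡ = trans (dim≡ B r) (m+[n∸m]≡n (≤-trans (m≤m+n (B * L) m₁) n≥))

-- Sums over lists

total : ∀ {A : Set} → (A → ℕ) → List A → ℕ
total f [] = 0
total f (x ∷ xs) = f x + total f xs

total-cong : ∀ {A : Set} {f g : A → ℕ} → (∀ x → f x ≡ g x) → ∀ xs → total f xs ≡ total g xs
total-cong e [] = refl
total-cong e (x ∷ xs) = cong₂ _+_ (e x) (total-cong e xs)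

total-++ : ∀ {A : Set} (f : A → ℕ) xs ys → total f (xs ++ ys) ≡ total f xs + total f ys
total-++ f [] ys = refl
total-++ f (x ∷ xs) ys = trans (cong (f x +_) (total-++ f xs ys)) (sym (+-assoc (f x) _ _))

total-map : ∀ {A B : Set} (f : B → ℕ) (g : A → B) xs → total f (map g xs) ≡ total (f ∘ g) xs
total-map f g [] = refl
total-map f g (x ∷ xs) = cong (f (g x) +_) (total-map f g xs)

total-concatMap : ∀ {A B : Set} (f : B → ℕ) (F : A → List B) xs → total f (concatMap F xs) ≡ total (λ x → total f (F x)) xs
total-concatMap f F [] = refl
total-concatMap f F (x ∷ xs) = trans (total-++ f (F x) (concatMap F xs)) (cong (total f (F x) +_) (total-concatMap f F xs))

total-const : ∀ {A : Set} c (xs : List A) → total (λ _ → c) xs ≡ length xs * c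
total-const c [] = refl
total-const c (x ∷ xs) = cong (c +_) (total-const c xs)

total-+ : ∀ {A : Set} (f g : A → ℕ) xs → total (λ x → f x + g x) xs ≡ total f xs + total g xs
total-+ f g [] = refl
total-+ f g (x ∷ xs) = trans (cong (f x + g x +_) (total-+ f g xs))
  (solve 4 (λ a b c d → a :+ b :+ (c :+ d) := a :+ c :+ (b :+ d)) refl (f x) (g x) (total f xs) (total g xs))
  where open +-*-Solver

total-swap : ∀ {A B : Set} (f : A → B → ℕ) xs ys → total (λ x → total (f x) ys) xs ≡ total (λ y → total (λ x → f x y) xs) ys
total-swap f [] ys = sym (trans (total-const 0 ys) (*-zeroʳ (length ys)))
total-swap f (x ∷ xs) ys = trans (cong (total (f x) ys +_) (total-swap f xs ys)) (sym (total-+ (f x) (λ y → total (λ x → f x y) xs) ys))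

total-≤ : ∀ {A : Set} {f : A → ℕ} {c} → (∀ x → f x ≤ c) → ∀ xs → total f xs ≤ length xs * c
total-≤ h [] = z≤n
total-≤ h (x ∷ xs) = +-mono-≤ (h x) (total-≤ h xs)

-- A sum that reaches the termwise bound leaves no slack. This is how a maximum independent set is
-- seen to meet every fibre in the largest possible size.
total-tight : ∀ {A : Set} {f : A → ℕ} {c} → (∀ x → f x ≤ c) → ∀ xs → total f xs ≡ length xs * c → ∀ {x} → x ∈ xs → f x ≡ c
total-tight {f = f} {c} h (y ∷ xs) e x∈ = at x∈
  where
  rest : total f xs ≤ length xs * c
  rest = total-≤ h xs
  fy : f y ≡ c
  fy = ≤-antisym (h y) (+-cancelʳ-≤ (length xs * c) c (f y) (≤-trans (≤-reflexive (sym e)) (+-monoʳ-≤ (f y) rest)))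
  at : ∀ {x} → x ∈ y ∷ xs → f x ≡ c
  at (here refl) = fy
  at (there p) = total-tight h xs (+-cancelˡ-≡ c _ _ (trans (cong (_+ total f xs) (sym fy)) e)) p

total-cart : ∀ {A B : Set} (f : A × B → ℕ) xs ys → total f (cart xs ys) ≡ total (λ x → total (λ y → f (x , y)) ys) xs
total-cart f xs ys = trans (total-concatMap f (λ x → map (x ,_) ys) xs) (total-cong (λ x → total-map f (x ,_) ys) xs)

total-vecs : ∀ {A : Set} {k} (f : Vec A (suc k) → ℕ) xs → total f (vecs xs (suc k)) ≡ total (λ x → total (λ v → f (x ∷ v)) (vecs xs k)) xs
total-vecs {k = k} f xs = trans (total-concatMap f (λ x → map (x ∷_) (vecs xs k)) xs) (total-cong (λ x → total-map f (x ∷_) (vecs xs k)) xs)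

length-total : ∀ {A : Set} (xs : List A) → length xs ≡ total (λ _ → 1) xs
length-total xs = sym (trans (total-const 1 xs) (*-identityʳ _))

length-cart : ∀ {A B : Set} (xs : List A) (ys : List B) → length (cart xs ys) ≡ length xs * length ys
length-cart xs ys = trans (length-total (cart xs ys)) (trans (total-cart _ xs ys) (trans (total-const _ xs) (cong (length xs *_) (sym (length-total ys)))))

length-vecs : ∀ {A : Set} (xs : List A) k → length (vecs xs k) ≡ length xs ^ k
length-vecs xs zero = refl
length-vecs xs (suc k) = trans (length-total (vecs xs (suc k))) (trans (total-vecs _ xs) (trans (total-const _ xs)
  (cong (length xs *_) (trans (sym (length-total (vecs xs k))) (length-vecs xs k)))))

∈-cart : ∀ {A B : Set} {xs : List A} {ys : List B} {x y} → x ∈ xs → y ∈ ys → (x , y) ∈ cart xs ys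
∈-cart {xs = xs} {ys} {x} p q = ∈-concatMap⁺ (λ x → map (x ,_) ys) (Any.map (λ { refl → ∈-map⁺ (x ,_) q }) p)

∈-vecs : ∀ {A : Set} {xs : List A} → (∀ x → x ∈ xs) → ∀ {k} (v : Vec A k) → v ∈ vecs xs k
∈-vecs p [] = here refl
∈-vecs {xs = xs} p {suc k} (x ∷ v) = ∈-concatMap⁺ (λ x → map (x ∷_) (vecs xs k)) (Any.map (λ { refl → ∈-map⁺ (x ∷_) (∈-vecs p v) }) (p x))

indicator : Bool → ℕ
indicator true = 1
indicator false = 0

length-filterᵇ : ∀ {A : Set} (p : A → Bool) xs → length (filterᵇ p xs) ≡ total (indicator ∘ p) xs
length-filterᵇ p [] = refl
length-filterᵇ p (x ∷ xs) with p x
... | true = cong suc (length-filterᵇ p xs)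
... | false = length-filterᵇ p xs

∈-filterᵇ⁺ : ∀ {A : Set} (p : A → Bool) {xs x} → x ∈ xs → p x ≡ true → x ∈ filterᵇ p xs
∈-filterᵇ⁺ p {y ∷ xs} (here refl) e with p y
... | true = here refl
∈-filterᵇ⁺ p {y ∷ xs} (there q) e with p y
... | true = there (∈-filterᵇ⁺ p q e)
... | false = ∈-filterᵇ⁺ p q e

∈-filterᵇ⁻ : ∀ {A : Set} (p : A → Bool) xs {x} → x ∈ filterᵇ p xs → x ∈ xs × p x ≡ true
∈-filterᵇ⁻ p (y ∷ xs) q with p y in e
∈-filterᵇ⁻ p (y ∷ xs) (here refl) | true = here refl , e
∈-filterᵇ⁻ p (y ∷ xs) (there q) | true with ∈-filterᵇ⁻ p xs q
... | a , b = there a , b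
∈-filterᵇ⁻ p (y ∷ xs) q | false with ∈-filterᵇ⁻ p xs q
... | a , b = there a , b

bool-ext : ∀ {a b} → (a ≡ true → b ≡ true) → (b ≡ true → a ≡ true) → a ≡ b
bool-ext {true} {b} p q = sym (p refl)
bool-ext {false} {true} p q = q refl
bool-ext {false} {false} p q = refl

filterᵇ-injective : ∀ {A : Set} (p q : A → Bool) xs → filterᵇ p xs ≡ filterᵇ q xs → ∀ {x} → x ∈ xs → p x ≡ q x
filterᵇ-injective p q xs e x∈ = bool-ext
  (λ t → proj₂ (∈-filterᵇ⁻ q xs (subst (_ ∈_) e (∈-filterᵇ⁺ p x∈ t))))
  (λ t → proj₂ (∈-filterᵇ⁻ p xs (subst (_ ∈_) (sym e) (∈-filterᵇ⁺ q x∈ t))))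

-- The adjacency tests

∧-true : ∀ {a b} → a ∧ b ≡ true → a ≡ true × b ≡ true
∧-true {true} {true} _ = refl , refl

∨-true : ∀ {a b} → a ∨ b ≡ true → a ≡ true ⊎ b ≡ true
∨-true {true} _ = inj₁ refl
∨-true {false} e = inj₂ e

∨-introˡ : ∀ {a} b → a ≡ true → a ∨ b ≡ true
∨-introˡ b refl = refl

∨-introʳ : ∀ a {b} → b ≡ true → a ∨ b ≡ true
∨-introʳ true refl = refl
∨-introʳ false refl = refl

∧-intro : ∀ {a b} → a ≡ true → b ≡ true → a ∧ b ≡ true
∧-intro refl refl = refl

true≢false : ∀ {a} → a ≡ true → a ≢ false
true≢false refl ()

eqF-sound : ∀ {a b} → eqF a b ≡ true → a ≡ b
eqF-sound {a} {b} e with a ≟ b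
... | yes p = p

eqF-complete : ∀ {a b} → a ≡ b → eqF a b ≡ true
eqF-complete {a} {b} e with a ≟ b
... | yes _ = refl
... | no ¬p = ⊥-elim (¬p e)

adjK-sound : ∀ {a b} → adjK a b ≡ true → a ≢ b
adjK-sound {a} {b} e p with a ≟ b
... | no ¬p = ¬p p

adjK-complete : ∀ {a b} → a ≢ b → adjK a b ≡ true
adjK-complete {a} {b} p with a ≟ b
... | yes q = ⊥-elim (p q)
... | no _ = refl

eqSh-sound : ∀ {u v} → eqSh u v ≡ true → u ≡ v
eqSh-sound e with ∧-true e
... | p , q = cong₂ _,_ (eqF-sound p) (eqF-sound q)

eqSh-refl : ∀ u → eqSh u u ≡ true
eqSh-refl (a , b) = ∧-intro (eqF-complete {a} refl) (eqF-complete {b} refl)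

eqVec-sound : ∀ {A : Set} {e : A → A → Bool} → (∀ {a b} → e a b ≡ true → a ≡ b) → ∀ {k} {x y : Vec A k} → eqVec e x y ≡ true → x ≡ y
eqVec-sound s {x = []} {[]} _ = refl
eqVec-sound {e = e} s {x = a ∷ x} {b ∷ y} p with ∧-true {e a b} p
... | q , r = cong₂ _∷_ (s q) (eqVec-sound s r)

eqVec-refl : ∀ {A : Set} {e : A → A → Bool} → (∀ a → e a a ≡ true) → ∀ {k} (x : Vec A k) → eqVec e x x ≡ true
eqVec-refl r [] = refl
eqVec-refl r (a ∷ x) = ∧-intro (r a) (eqVec-refl r x)

eqK-refl : ∀ {n} (k : Vec (Fin 4) n) → eqVec eqF k k ≡ true
eqK-refl = eqVec-refl (λ _ → eqF-complete refl)

eqS-refl : ∀ {m} (s : Vec ShV m) → eqVec eqSh s s ≡ true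
eqS-refl = eqVec-refl eqSh-refl

adj-new-Sh : ∀ {m n} {s : Vec ShV m} {k : Vec (Fin 4) n} {u v} → adjSh u v ≡ true → adjD (u ∷ s , k) (v ∷ s , k) ≡ true
adj-new-Sh {s = s} {k} p = ∨-introˡ _ (∧-intro (∨-introˡ _ (∧-intro p (eqS-refl s))) (eqK-refl k))

adj-old-Sh : ∀ {m n} (s s′ : Vec ShV m) (k k′ : Vec (Fin 4) n) v → adjD (s , k) (s′ , k′) ≡ true → adjD (v ∷ s , k) (v ∷ s′ , k′) ≡ true
adj-old-Sh s s′ k k′ v e with ∨-true {adjProd eqSh adjSh s s′ ∧ eqVec eqF k k′} e
... | inj₁ p with ∧-true {adjProd eqSh adjSh s s′} p
... | q , r = ∨-introˡ _ (∧-intro (∨-introʳ (adjSh v v ∧ eqVec eqSh s s′) (∧-intro (eqSh-refl v) q)) r)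
adj-old-Sh s s′ k k′ v e | inj₂ p with ∧-true {eqVec eqSh s s′} p
... | q , r = ∨-introʳ (adjProd eqSh adjSh (v ∷ s) (v ∷ s′) ∧ eqVec eqF k k′) (∧-intro (∧-intro (eqSh-refl v) q) r)

adj-cons : ∀ {m n} (s s′ : Vec ShV m) (k k′ : Vec (Fin 4) n) a a′ → adjD (s , a ∷ k) (s′ , a′ ∷ k′) ≡ true →
  (a ≡ a′ × adjD (s , k) (s′ , k′) ≡ true) ⊎ (s ≡ s′ × k ≡ k′ × a ≢ a′)
adj-cons s s′ k k′ a a′ e with ∨-true {adjProd eqSh adjSh s s′ ∧ (eqF a a′ ∧ eqVec eqF k k′)} e
... | inj₁ p with ∧-true {adjProd eqSh adjSh s s′} p
... | q , r with ∧-true {eqF a a′} r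
... | r₁ , r₂ = inj₁ (eqF-sound r₁ , ∨-introˡ _ (∧-intro q r₂))
adj-cons s s′ k k′ a a′ e | inj₂ p with ∧-true {eqVec eqSh s s′} p
... | q , r with ∨-true {adjK a a′ ∧ eqVec eqF k k′} r
... | inj₁ t with ∧-true {adjK a a′} t
... | t₁ , t₂ = inj₂ (eqVec-sound eqSh-sound q , eqVec-sound eqF-sound t₂ , adjK-sound t₁)
adj-cons s s′ k k′ a a′ e | inj₂ p | q , r | inj₂ t with ∧-true {eqF a a′} t
... | t₁ , t₂ = inj₁ (eqF-sound t₁ , ∨-introʳ (adjProd eqSh adjSh s s′ ∧ eqVec eqF k k′) (∧-intro q t₂))

adj-cons₂ : ∀ {m n} (s s′ : Vec ShV m) (k k′ : Vec (Fin 4) n) a a′ b b′ → adjD (s , a ∷ b ∷ k) (s′ , a′ ∷ b′ ∷ k′) ≡ true →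
  (a ≡ a′ × b ≡ b′ × adjD (s , k) (s′ , k′) ≡ true) ⊎ (s ≡ s′ × k ≡ k′ × (a ≡ a′ × b ≢ b′ ⊎ a ≢ a′ × b ≡ b′))
adj-cons₂ s s′ k k′ a a′ b b′ e with adj-cons s s′ (b ∷ k) (b′ ∷ k′) a a′ e
... | inj₂ (p , refl , q) = inj₂ (p , refl , inj₂ (q , refl))
... | inj₁ (p , q) with adj-cons s s′ k k′ b b′ q
... | inj₁ (r , t) = inj₁ (p , r , t)
... | inj₂ (r , t , u) = inj₂ (r , t , inj₁ (p , u))

adj-new-K : ∀ {n} {k : Vec (Fin 4) n} {a b} → a ≢ b → adjD {0} ([] , a ∷ k) ([] , b ∷ k) ≡ true
adj-new-K {k = k} p = ∨-introˡ _ (∧-intro (adjK-complete p) (eqK-refl k))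

adj-old-K : ∀ {n} {k k′ : Vec (Fin 4) n} a → Adj k k′ → adjD {0} ([] , a ∷ k) ([] , a ∷ k′) ≡ true
adj-old-K {k = k} {k′} a p = ∨-introʳ (adjK a a ∧ eqVec eqF k k′) (∧-intro (eqF-complete refl) (prod p))
  where
  prod : ∀ {n} {k k′ : Vec (Fin 4) n} → Adj k k′ → adjProd eqF adjK k k′ ≡ true
  prod (here {x = k} p) = ∨-introˡ _ (∧-intro (adjK-complete p) (eqK-refl k))
  prod (there {a = a} {x = k} {k′} p) = ∨-introʳ (adjK a a ∧ eqVec eqF k k′) (∧-intro (eqF-complete refl) (prod p))

-- Independent sets of the Shrikhande graph

shs : List ShV
shs = cart (allFin 4) (allFin 4)

∈-shs : ∀ v → v ∈ shs
∈-shs (a , b) = ∈-cart (∈-allFin a) (∈-allFin b)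

-- Dependent sets are pruned as they arise, so that `classification` runs over the independent sets
-- only.
enum : List ShV → List (List ShV)
enum [] = [] ∷ []
enum (x ∷ xs) = map (x ∷_) (filterᵇ (allᵇ (λ y → not (adjSh x y))) (enum xs)) ++ enum xs

allᵇ-intro : ∀ {A : Set} (p : A → Bool) xs → (∀ {x} → x ∈ xs → p x ≡ true) → allᵇ p xs ≡ true
allᵇ-intro p [] h = refl
allᵇ-intro p (x ∷ xs) h = ∧-intro (h (here refl)) (allᵇ-intro p xs (h ∘ there))

allᵇ-elim : ∀ {A : Set} (p : A → Bool) xs → allᵇ p xs ≡ true → ∀ {x} → x ∈ xs → p x ≡ true
allᵇ-elim p (x ∷ xs) e (here refl) = proj₁ (∧-true e)
allᵇ-elim p (x ∷ xs) e (there q) = allᵇ-elim p xs (proj₂ (∧-true {p x} e)) q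

enum-complete : ∀ p → (∀ {u v} → p u ≡ true → p v ≡ true → adjSh u v ≡ false) → ∀ xs → filterᵇ p xs ∈ enum xs
enum-complete p h [] = here refl
enum-complete p h (x ∷ xs) with p x in e
... | false = ∈-++⁺ʳ (map (x ∷_) (filterᵇ (allᵇ (λ y → not (adjSh x y))) (enum xs))) (enum-complete p h xs)
... | true = ∈-++⁺ˡ (∈-map⁺ (x ∷_) (∈-filterᵇ⁺ _ (enum-complete p h xs)
  (allᵇ-intro _ (filterᵇ p xs) λ q → cong not (h e (proj₂ (∈-filterᵇ⁻ p xs q))))))

_≟ˢ_ : (u v : ShV) → Dec (u ≡ v)
_≟ˢ_ = Product.≡-dec _≟_ _≟_

_≟ᴸ_ : (A B : List ShV) → Dec (A ≡ B)
_≟ᴸ_ = ≡-dec _≟ˢ_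

open DecMembership _≟ˢ_ using () renaming (_∈?_ to _∈ˢ?_)

-- The sixteen independent 4-sets of Sh next to sixteen permutations of {0,1,2,3}, seen as maximum
-- independent sets of K₄ × K₄; disjoint sets are next to disjoint permutations.
table : List (List ShV × (Fin 4 → Fin 4))
table =
  ((𝟎 , 𝟎) ∷ (𝟎 , 𝟐) ∷ (𝟐 , 𝟎) ∷ (𝟐 , 𝟐) ∷ [] , four 𝟎 𝟏 𝟐 𝟑) ∷
  ((𝟎 , 𝟎) ∷ (𝟎 , 𝟐) ∷ (𝟐 , 𝟏) ∷ (𝟐 , 𝟑) ∷ [] , four 𝟎 𝟏 𝟑 𝟐) ∷
  ((𝟎 , 𝟎) ∷ (𝟏 , 𝟐) ∷ (𝟐 , 𝟎) ∷ (𝟑 , 𝟐) ∷ [] , four 𝟎 𝟑 𝟐 𝟏) ∷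
  ((𝟎 , 𝟎) ∷ (𝟏 , 𝟑) ∷ (𝟐 , 𝟐) ∷ (𝟑 , 𝟏) ∷ [] , four 𝟎 𝟐 𝟏 𝟑) ∷
  ((𝟎 , 𝟏) ∷ (𝟎 , 𝟑) ∷ (𝟐 , 𝟎) ∷ (𝟐 , 𝟐) ∷ [] , four 𝟏 𝟎 𝟐 𝟑) ∷
  ((𝟎 , 𝟏) ∷ (𝟎 , 𝟑) ∷ (𝟐 , 𝟏) ∷ (𝟐 , 𝟑) ∷ [] , four 𝟏 𝟎 𝟑 𝟐) ∷
  ((𝟎 , 𝟏) ∷ (𝟏 , 𝟎) ∷ (𝟐 , 𝟑) ∷ (𝟑 , 𝟐) ∷ [] , four 𝟏 𝟑 𝟎 𝟐) ∷
  ((𝟎 , 𝟏) ∷ (𝟏 , 𝟑) ∷ (𝟐 , 𝟏) ∷ (𝟑 , 𝟑) ∷ [] , four 𝟏 𝟐 𝟑 𝟎) ∷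
  ((𝟎 , 𝟐) ∷ (𝟏 , 𝟎) ∷ (𝟐 , 𝟐) ∷ (𝟑 , 𝟎) ∷ [] , four 𝟐 𝟏 𝟎 𝟑) ∷
  ((𝟎 , 𝟐) ∷ (𝟏 , 𝟏) ∷ (𝟐 , 𝟎) ∷ (𝟑 , 𝟑) ∷ [] , four 𝟑 𝟏 𝟐 𝟎) ∷
  ((𝟎 , 𝟑) ∷ (𝟏 , 𝟏) ∷ (𝟐 , 𝟑) ∷ (𝟑 , 𝟏) ∷ [] , four 𝟑 𝟎 𝟏 𝟐) ∷
  ((𝟎 , 𝟑) ∷ (𝟏 , 𝟐) ∷ (𝟐 , 𝟏) ∷ (𝟑 , 𝟎) ∷ [] , four 𝟐 𝟎 𝟑 𝟏) ∷
  ((𝟏 , 𝟎) ∷ (𝟏 , 𝟐) ∷ (𝟑 , 𝟎) ∷ (𝟑 , 𝟐) ∷ [] , four 𝟐 𝟑 𝟎 𝟏) ∷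
  ((𝟏 , 𝟎) ∷ (𝟏 , 𝟐) ∷ (𝟑 , 𝟏) ∷ (𝟑 , 𝟑) ∷ [] , four 𝟐 𝟑 𝟏 𝟎) ∷
  ((𝟏 , 𝟏) ∷ (𝟏 , 𝟑) ∷ (𝟑 , 𝟎) ∷ (𝟑 , 𝟐) ∷ [] , four 𝟑 𝟐 𝟎 𝟏) ∷
  ((𝟏 , 𝟏) ∷ (𝟏 , 𝟑) ∷ (𝟑 , 𝟏) ∷ (𝟑 , 𝟑) ∷ [] , four 𝟑 𝟐 𝟏 𝟎) ∷
  []

sixteen : List (List ShV)
sixteen = map proj₁ table

_∈ᴸ?_ : (A : List ShV) (As : List (List ShV)) → Dec (A ∈ As)
_∈ᴸ?_ = DecMembership._∈?_ _≟ᴸ_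

classified : List ShV → Bool
classified A = (length A ≤ᵇ 3) ∨ ⌊ A ∈ᴸ? sixteen ⌋

abstract
  classification : allᵇ classified (enum shs) ≡ true
  classification = refl

  table-size : All (λ e → length (proj₁ e) ≡ 4) table
  table-size = from-yes (All.all? (λ e → length (proj₁ e) ℕ.≟ 4) table)

  table-injective : All (λ e → ∀ a b → proj₂ e a ≡ proj₂ e b → a ≡ b) table
  table-injective = from-yes (All.all? (λ e → all? λ a → all? λ b → (proj₂ e a ≟ proj₂ e b) →-dec (a ≟ b)) table)

  table-disjoint : All (λ e → All (λ e′ → All (_∉ proj₁ e′) (proj₁ e) → ∀ a → proj₂ e a ≢ proj₂ e′ a) table) table
  table-disjoint = from-yes (All.all? (λ e → All.all? (λ e′ →
    All.all? (λ v → ¬? (v ∈ˢ? proj₁ e′)) (proj₁ e) →-dec all? λ a → ¬? (proj₂ e a ≟ proj₂ e′ a)) table) table)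

  table-faithful : All (λ e → All (λ e′ → (∀ a → proj₂ e a ≡ proj₂ e′ a) → proj₁ e ≡ proj₁ e′) table) table
  table-faithful = from-yes (All.all? (λ e → All.all? (λ e′ →
    (all? λ a → proj₂ e a ≟ proj₂ e′ a) →-dec (proj₁ e ≟ᴸ proj₁ e′)) table) table)

classify : ∀ {A} → A ∈ enum shs → length A ≤ 3 ⊎ ∃ λ π → (A , π) ∈ table
classify {A} p with ∨-true {length A ≤ᵇ 3} (allᵇ-elim classified (enum shs) classification p)
... | inj₁ q = inj₁ (≤ᵇ⇒≤ _ 3 (Equivalence.from T-≡ q))
... | inj₂ q with A ∈ᴸ? sixteen
... | yes r with ∈-map⁻ proj₁ r
... | (_ , π) , e∈ , refl = inj₂ (π , e∈)

find : List (List ShV × (Fin 4 → Fin 4)) → List ShV → Fin 4 → Fin 4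
find [] A = λ a → a
find ((B , π) ∷ t) A = if ⌊ A ≟ᴸ B ⌋ then π else find t A

perm : List ShV → Fin 4 → Fin 4
perm = find table

find-∈ : ∀ t {A π} → (A , π) ∈ t → (A , find t A) ∈ t
find-∈ ((B , ρ) ∷ t) {A} p with A ≟ᴸ B
find-∈ ((B , ρ) ∷ t) {A} p | yes refl = here refl
find-∈ ((B , ρ) ∷ t) {A} (here refl) | no ¬q = ⊥-elim (¬q refl)
find-∈ ((B , ρ) ∷ t) {A} (there p) | no _ = there (find-∈ t p)

-- MDS codes as Boolean functions on the vertices

Independent : ∀ {m n} → (Vert m n → Bool) → Set
Independent χ = ∀ u v → χ u ≡ true → χ v ≡ true → adjD u v ≡ false

size : ∀ {m n} → (Vert m n → Bool) → ℕ
size {m} {n} χ = total (indicator ∘ χ) (verts m n)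

MDS : ∀ {m n} → ℕ → (Vert m n → Bool) → Set
MDS e χ = Independent χ × size χ ≡ 4 ^ e

∈-verts : ∀ {m n} (v : Vert m n) → v ∈ verts m n
∈-verts (s , k) = ∈-cart (∈-vecs ∈-shs s) (∈-vecs ∈-allFin k)

length-verts : ∀ m n → length (verts m n) ≡ 4 ^ (2 * m + n)
length-verts m n = begin
  length (verts m n) ≡⟨ length-cart (vecs shs m) (vecs (allFin 4) n) ⟩
  length (vecs shs m) * length (vecs (allFin 4) n) ≡⟨ cong₂ _*_ (length-vecs shs m) (length-vecs (allFin 4) n) ⟩
  16 ^ m * 4 ^ n ≡⟨ cong (_* 4 ^ n) (^-*-assoc 4 2 m) ⟩
  4 ^ (2 * m) * 4 ^ n ≡⟨ ^-distribˡ-+-* 4 (2 * m) n ⟨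
  4 ^ (2 * m + n) ∎
  where open ≡-Reasoning

total-first : ∀ {A B : Set} {m} (xs : List A) (ys : List B) (X : Vec A (suc m) × B → ℕ) →
  total X (cart (vecs xs (suc m)) ys) ≡ total (λ w → total (λ v → X (v ∷ proj₁ w , proj₂ w)) xs) (cart (vecs xs m) ys)
total-first {m = m} xs ys X = begin
  total X (cart (vecs xs (suc m)) ys) ≡⟨ total-cart X (vecs xs (suc m)) ys ⟩
  total (λ s → total (λ k → X (s , k)) ys) (vecs xs (suc m)) ≡⟨ total-vecs (λ s → total (λ k → X (s , k)) ys) xs ⟩
  total (λ v → total (λ s → total (λ k → X (v ∷ s , k)) ys) ss) xs ≡⟨ total-swap (λ v s → total (λ k → X (v ∷ s , k)) ys) xs ss ⟩
  total (λ s → total (λ v → total (λ k → X (v ∷ s , k)) ys) xs) ss ≡⟨ total-cong (λ s → total-swap (λ v k → X (v ∷ s , k)) xs ys) ss ⟩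
  total (λ s → total (λ k → total (λ v → X (v ∷ s , k)) xs) ys) ss ≡⟨ total-cart (λ w → total (λ v → X (v ∷ proj₁ w , proj₂ w)) xs) ss ys ⟨
  total (λ w → total (λ v → X (v ∷ proj₁ w , proj₂ w)) xs) (cart ss ys) ∎
  where
  open ≡-Reasoning
  ss = vecs xs m

total-second : ∀ {A B : Set} {n} (ss : List A) (xs : List B) (X : A × Vec B (suc n) → ℕ) →
  total X (cart ss (vecs xs (suc n))) ≡ total (λ w → total (λ a → X (proj₁ w , a ∷ proj₂ w)) xs) (cart ss (vecs xs n))
total-second {n = n} ss xs X = begin
  total X (cart ss (vecs xs (suc n))) ≡⟨ total-cart X ss (vecs xs (suc n)) ⟩
  total (λ s → total (λ k → X (s , k)) (vecs xs (suc n))) ss ≡⟨ total-cong (λ s → total-vecs (λ k → X (s , k)) xs) ss ⟩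
  total (λ s → total (λ a → total (λ k → X (s , a ∷ k)) (vecs xs n)) xs) ss ≡⟨ total-cong (λ s → total-swap (λ a k → X (s , a ∷ k)) xs (vecs xs n)) ss ⟩
  total (λ s → total (λ k → total (λ a → X (s , a ∷ k)) xs) (vecs xs n)) ss ≡⟨ total-cart (λ w → total (λ a → X (proj₁ w , a ∷ proj₂ w)) xs) ss (vecs xs n) ⟨
  total (λ w → total (λ a → X (proj₁ w , a ∷ proj₂ w)) xs) (cart ss (vecs xs n)) ∎
  where open ≡-Reasoning

-- Replacing a Shrikhande factor by two complete factors

fibre : ∀ {m n} → (Vert (suc m) n → Bool) → Vert m n → List ShV
fibre χ (s , k) = filterᵇ (λ v → χ (v ∷ s , k)) shs

size-fibres : ∀ {m n} (χ : Vert (suc m) n → Bool) → size χ ≡ total (λ w → length (fibre χ w)) (verts m n)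
size-fibres {m} {n} χ = trans (total-first shs (vecs (allFin 4) n) (indicator ∘ χ))
  (total-cong (λ w → sym (length-filterᵇ (λ v → χ (v ∷ proj₁ w , proj₂ w)) shs)) (verts m n))

not-true : ∀ {a} → (a ≡ true → ⊥) → a ≡ false
not-true {true} p = ⊥-elim (p refl)
not-true {false} p = refl

fibre-enum : ∀ {m n} (χ : Vert (suc m) n → Bool) → Independent χ → ∀ w → fibre χ w ∈ enum shs
fibre-enum χ I (s , k) = enum-complete (λ v → χ (v ∷ s , k))
  (λ {u} {v} p q → not-true λ a → true≢false (adj-new-Sh {s = s} {k} {u} {v} a) (I (u ∷ s , k) (v ∷ s , k) p q)) shs

-- The 4^(e-1) fibres have at most 4 points each and 4^e points together, so each has exactly 4 and
-- is one of the sixteen sets.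
fibre-entry : ∀ {m n e} (χ : Vert (suc m) n → Bool) → MDS e χ → 2 * suc m + n ≡ suc e → ∀ w → (fibre χ w , perm (fibre χ w)) ∈ table
fibre-entry {m} {n} {e} χ (I , sz) eq w with classify (fibre-enum χ I w)
... | inj₂ (π , p) = find-∈ table p
... | inj₁ l≤3 = ⊥-elim (1+n≰n (≤-trans (≤-reflexive (sym full)) l≤3))
  where
  at-most : ∀ w → length (fibre χ w) ≤ 4
  at-most w with classify (fibre-enum χ I w)
  ... | inj₁ p = ≤-trans p (n≤1+n 3)
  ... | inj₂ (π , p) = ≤-reflexive (All.lookup table-size p)
  exponent : suc (2 * m + n) ≡ e
  exponent = suc-injective (trans (solve 2 (λ m n → con 2 :+ (con 2 :* m :+ n) := con 2 :* (con 1 :+ m) :+ n) refl m n) eq)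
    where open +-*-Solver
  full : length (fibre χ w) ≡ 4
  full = total-tight at-most (verts m n) (trans (sym (size-fibres χ)) (trans sz (trans (cong (4 ^_) (sym exponent))
    (trans (*-comm 4 (4 ^ (2 * m + n))) (cong (_* 4) (sym (length-verts m n))))))) (∈-verts w)

replace : ∀ {m n} → (Vert (suc m) n → Bool) → Vert m (suc (suc n)) → Bool
replace χ (s , a ∷ b ∷ k) = eqF (perm (fibre χ (s , k)) a) b

one-column : ∀ c → total (λ b → indicator (eqF c b)) (allFin 4) ≡ 1
one-column 𝟎 = refl
one-column 𝟏 = refl
one-column 𝟐 = refl
one-column 𝟑 = refl

size-replace : ∀ {m n e} (χ : Vert (suc m) n → Bool) → MDS e χ → 2 * suc m + n ≡ suc e → size (replace χ) ≡ size χ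
size-replace {m} {n} χ M eq = begin
  total X (verts m (suc (suc n))) ≡⟨ total-second ss F X ⟩
  total (λ w → total (λ a → X (proj₁ w , a ∷ proj₂ w)) F) (verts m (suc n)) ≡⟨ total-second ss F (λ w → total (λ a → X (proj₁ w , a ∷ proj₂ w)) F) ⟩
  total (λ w → total (λ b → total (λ a → Y w a b) F) F) (verts m n) ≡⟨ total-cong (λ w → cell w) (verts m n) ⟩
  total (λ w → length (fibre χ w)) (verts m n) ≡⟨ size-fibres χ ⟨
  size χ ∎
  where
  open ≡-Reasoning
  X = indicator ∘ replace χ
  F = allFin 4
  ss = vecs shs m
  Y : Vert m n → Fin 4 → Fin 4 → ℕ
  Y w a b = indicator (eqF (perm (fibre χ w) a) b)
  cell : ∀ w → total (λ b → total (λ a → Y w a b) F) F ≡ length (fibre χ w)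
  cell w = begin
    total (λ b → total (λ a → Y w a b) F) F ≡⟨ total-swap (Y w) F F ⟨
    total (λ a → total (Y w a) F) F ≡⟨ total-cong (λ a → one-column (perm (fibre χ w) a)) F ⟩
    4 ≡⟨ All.lookup table-size (fibre-entry χ M eq w) ⟨
    length (fibre χ w) ∎

-- For an edge of the base, the fibres over its ends are disjoint, hence so are their permutations.
-- For an edge inside a copy of K₄ × K₄, the permutation being a function, or being injective, is
-- enough.
replace-MDS : ∀ {m n e} (χ : Vert (suc m) n → Bool) → 2 * suc m + n ≡ suc e → MDS e χ → MDS e (replace χ)
replace-MDS {m} {n} {e} χ eq M@(I , sz) = indep , trans (size-replace χ M eq) sz
  where
  entry : ∀ w → (fibre χ w , perm (fibre χ w)) ∈ table
  entry = fibre-entry χ M eq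
  indep : Independent (replace χ)
  indep (s , a ∷ b ∷ k) (s′ , a′ ∷ b′ ∷ k′) p q = not-true λ adj → impossible (adj-cons₂ s s′ k k′ a a′ b b′ adj)
    where
    disjoint : adjD (s , k) (s′ , k′) ≡ true → All (_∉ fibre χ (s′ , k′)) (fibre χ (s , k))
    disjoint adj = All.tabulate λ {v} v∈ v∈′ → true≢false (adj-old-Sh s s′ k k′ v adj)
      (I (v ∷ s , k) (v ∷ s′ , k′) (proj₂ (∈-filterᵇ⁻ (λ v → χ (v ∷ s , k)) shs v∈)) (proj₂ (∈-filterᵇ⁻ (λ v → χ (v ∷ s′ , k′)) shs v∈′)))
    impossible : (a ≡ a′ × b ≡ b′ × adjD (s , k) (s′ , k′) ≡ true) ⊎ (s ≡ s′ × k ≡ k′ × (a ≡ a′ × b ≢ b′ ⊎ a ≢ a′ × b ≡ b′)) → ⊥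
    impossible (inj₁ (refl , refl , adj)) =
      All.lookup (All.lookup table-disjoint (entry (s , k))) (entry (s′ , k′)) (disjoint adj) a
        (trans (eqF-sound p) (sym (eqF-sound q)))
    impossible (inj₂ (refl , refl , inj₁ (refl , b≢b′))) = b≢b′ (trans (sym (eqF-sound p)) (eqF-sound q))
    impossible (inj₂ (refl , refl , inj₂ (a≢a′ , refl))) =
      a≢a′ (All.lookup table-injective (entry (s , k)) a a′ (trans (eqF-sound p) (sym (eqF-sound q))))

replace-injective : ∀ {m n e} (χ ψ : Vert (suc m) n → Bool) → 2 * suc m + n ≡ suc e → MDS e χ → MDS e ψ →
  (∀ w → replace χ w ≡ replace ψ w) → ∀ w → χ w ≡ ψ w
replace-injective χ ψ eq M M′ e (v ∷ s , k) = filterᵇ-injective (λ v → χ (v ∷ s , k)) (λ v → ψ (v ∷ s , k)) shs same (∈-shs v)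
  where
  same : fibre χ (s , k) ≡ fibre ψ (s , k)
  same = All.lookup (All.lookup table-faithful (fibre-entry χ M eq (s , k))) (fibre-entry ψ M′ eq (s , k))
    λ a → sym (eqF-sound (trans (sym (e (s , a ∷ perm (fibre χ (s , k)) a ∷ k))) (eqF-complete refl)))

-- Maximum independent sets of H(e+1,4) are graphs of Latin functions

module Graph {e} (χ : Vert 0 (suc e) → Bool) where

  row : Point e → Fin 4 → Bool
  row k a = χ ([] , a ∷ k)

  chosen? : ∀ k → Dec (∃ λ a → row k a ≡ true)
  chosen? k = any? λ a → row k a ≟ᵇ true

  colour : Point e → Fin 4
  colour k with chosen? k
  ... | yes (a , _) = a
  -- Default for an empty row; `row-colour` shows that a maximum independent set has none.
  ... | no _ = 𝟎

  module _ (M : MDS e χ) where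

    private
      I : Independent χ
      I = proj₁ M

    unique : ∀ k {a b} → row k a ≡ true → row k b ≡ true → a ≡ b
    unique k {a} {b} p q with a ≟ b
    ... | yes r = r
    ... | no r = ⊥-elim (true≢false (adj-new-K {k = k} r) (I ([] , a ∷ k) ([] , b ∷ k) p q))

    size-rows : size χ ≡ total (λ w → total (indicator ∘ row (proj₂ w)) (allFin 4)) (verts 0 e)
    size-rows = trans (total-second ([] ∷ []) (allFin 4) (indicator ∘ χ))
      (total-cong (λ { ([] , k) → refl }) (verts 0 e))

    at-most-one : ∀ (p : Fin 4 → Bool) → (∀ {a b} → p a ≡ true → p b ≡ true → a ≡ b) → total (indicator ∘ p) (allFin 4) ≤ 1
    at-most-one p u with p 𝟎 in e₀ | p 𝟏 in e₁ | p 𝟐 in e₂ | p 𝟑 in e₃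
    ... | false | false | false | false = z≤n
    ... | true | false | false | false = ≤-refl
    ... | false | true | false | false = ≤-refl
    ... | false | false | true | false = ≤-refl
    ... | false | false | false | true = ≤-refl
    ... | true | true | _ | _ with () ← u e₀ e₁
    ... | true | _ | true | _ with () ← u e₀ e₂
    ... | true | _ | _ | true with () ← u e₀ e₃
    ... | _ | true | true | _ with () ← u e₁ e₂
    ... | _ | true | _ | true with () ← u e₁ e₃
    ... | _ | _ | true | true with () ← u e₂ e₃

    none : ∀ (p : Fin 4 → Bool) → ¬ (∃ λ a → p a ≡ true) → total (indicator ∘ p) (allFin 4) ≡ 0
    none p ¬p = trans (total-cong {g = λ _ → 0} (λ a → cong indicator (not-true λ t → ¬p (a , t))) (allFin 4)) refl

    -- There are 4^e rows, each with at most one vertex, and 4^e vertices in all.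
    row-colour : ∀ k → row k (colour k) ≡ true
    row-colour k with chosen? k
    ... | yes (_ , p) = p
    ... | no ¬p with () ← trans (sym (none (row k) ¬p)) (total-tight (λ w → at-most-one (row (proj₂ w)) (unique (proj₂ w))) (verts 0 e)
        (trans (sym size-rows) (trans (proj₂ M) (sym (trans (*-identityʳ _) (length-verts 0 e))))) (∈-verts ([] , k)))

    colour-latin : Latin colour
    colour-latin {k} {k′} adj p = true≢false (adj-old-K (colour k) adj)
      (I ([] , colour k ∷ k) ([] , colour k ∷ k′) (row-colour k) (subst (λ a → row k′ a ≡ true) (sym p) (row-colour k′)))

    row≡ : ∀ k a → row k a ≡ eqF (colour k) a
    row≡ k a = bool-ext (λ p → eqF-complete (unique k (row-colour k) p))
      (λ p → subst (λ a → row k a ≡ true) (eqF-sound p) (row-colour k))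

latin-of : ∀ m {n e} → 2 * m + n ≡ suc e → (Vert m n → Bool) → Point e → Fin 4
shift-dim : ∀ {m n e} → 2 * suc m + n ≡ suc e → 2 * m + suc (suc n) ≡ suc e
shift-dim {m} {n} eq = trans (solve 2 (λ m n → con 2 :* m :+ (con 2 :+ n) := con 2 :* (con 1 :+ m) :+ n) refl m n) eq
  where open +-*-Solver
latin-of zero refl χ = Graph.colour χ
latin-of (suc m) eq χ = latin-of m (shift-dim {m} eq) (replace χ)

latin-of-latin : ∀ m {n e} (eq : 2 * m + n ≡ suc e) (χ : Vert m n → Bool) → MDS e χ → Latin (latin-of m eq χ)
latin-of-latin zero refl χ M = Graph.colour-latin χ M
latin-of-latin (suc m) eq χ M = latin-of-latin m (shift-dim {m} eq) (replace χ) (replace-MDS χ eq M)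

latin-of-injective : ∀ m {n e} (eq : 2 * m + n ≡ suc e) (χ ψ : Vert m n → Bool) → MDS e χ → MDS e ψ →
  (∀ x → latin-of m eq χ x ≡ latin-of m eq ψ x) → ∀ w → χ w ≡ ψ w
latin-of-injective zero refl χ ψ M M′ e ([] , a ∷ k) =
  trans (Graph.row≡ χ M k a) (trans (cong (λ c → eqF c a) (e k)) (sym (Graph.row≡ ψ M′ k a)))
latin-of-injective (suc m) eq χ ψ M M′ e = replace-injective χ ψ eq M M′
  (latin-of-injective m (shift-dim {m} eq) (replace χ) (replace ψ) (replace-MDS χ eq M) (replace-MDS ψ eq M′) e)

-- Sublists, characteristic functions, and counting by injections

concatMap-product : ∀ {A B C : Set} (f : A → B → C) xs ys → concatMap (λ x → map (f x) ys) xs ≡ cartesianProductWith f xs ys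
concatMap-product f [] ys = refl
concatMap-product f (x ∷ xs) ys = cong (map (f x) ys ++_) (concatMap-product f xs ys)

cart-unique : ∀ {A B : Set} {xs : List A} {ys : List B} → Unique xs → Unique ys → Unique (cart xs ys)
cart-unique {xs = xs} {ys} U V = subst Unique (sym (concatMap-product _,_ xs ys)) (Unique.cartesianProductWith⁺ _,_ (λ { refl → refl , refl }) U V)

vecs-unique : ∀ {A : Set} {xs : List A} → Unique xs → ∀ k → Unique (vecs xs k)
vecs-unique U zero = [] ∷ []
vecs-unique {xs = xs} U (suc k) = subst Unique (sym (concatMap-product _∷_ xs (vecs xs k)))
  (Unique.cartesianProductWith⁺ _∷_ (λ { refl → refl , refl }) U (vecs-unique U k))

verts-unique : ∀ m n → Unique (verts m n)
verts-unique m n = cart-unique (vecs-unique (cart-unique (Unique.allFin⁺ 4) (Unique.allFin⁺ 4)) m) (vecs-unique (Unique.allFin⁺ 4) n)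

sublists-⊆ : ∀ {A : Set} (xs : List A) {S} → S ∈ sublists xs → ∀ {x} → x ∈ S → x ∈ xs
sublists-⊆ [] (here refl) ()
sublists-⊆ (y ∷ xs) p q with ∈-++⁻ (map (y ∷_) (sublists xs)) p
... | inj₂ r = there (sublists-⊆ xs r q)
... | inj₁ r with ∈-map⁻ (y ∷_) r
sublists-⊆ (y ∷ xs) p (here refl) | inj₁ r | S , S∈ , refl = here refl
sublists-⊆ (y ∷ xs) p (there q) | inj₁ r | S , S∈ , refl = there (sublists-⊆ xs S∈ q)

sublists-unique : ∀ {A : Set} {xs : List A} → Unique xs → Unique (sublists xs)
sublists-unique [] = [] ∷ []
sublists-unique {xs = x ∷ xs} (x≢ ∷ U) = Unique.++⁺ (Unique.map⁺ (λ { refl → refl }) (sublists-unique U)) (sublists-unique U) disjoint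
  where
  disjoint : ∀ {S} → ¬ (S ∈ map (x ∷_) (sublists xs) × S ∈ sublists xs)
  disjoint (p , q) with ∈-map⁻ (x ∷_) p
  ... | S , _ , refl = All.lookup x≢ (sublists-⊆ xs q (here refl)) refl

filterᵇ-cong : ∀ {A : Set} {p q : A → Bool} xs → (∀ {x} → x ∈ xs → p x ≡ q x) → filterᵇ p xs ≡ filterᵇ q xs
filterᵇ-cong [] e = refl
filterᵇ-cong {p = p} {q} (x ∷ xs) e with p x | q x | e (here refl)
... | true | true | refl = cong (x ∷_) (filterᵇ-cong xs (e ∘ there))
... | false | false | refl = filterᵇ-cong xs (e ∘ there)

module Characteristic {A : Set} (_≟ᴬ_ : (a b : A) → Dec (a ≡ b)) where

  open DecMembership _≟ᴬ_ using (_∈?_)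

  χ : List A → A → Bool
  χ S a = ⌊ a ∈? S ⌋

  χ-∈ : ∀ {S a} → χ S a ≡ true → a ∈ S
  χ-∈ {S} {a} e with a ∈? S
  ... | yes p = p

  ∈-χ : ∀ {S a} → a ∈ S → χ S a ≡ true
  ∈-χ {S} {a} p with a ∈? S
  ... | yes _ = refl
  ... | no ¬p = ⊥-elim (¬p p)

  -- A sublist keeps the order of the duplicate-free list, so membership determines it.
  χ-filter : ∀ {xs S} → Unique xs → S ∈ sublists xs → filterᵇ (χ S) xs ≡ S
  χ-filter {[]} U (here refl) = refl
  χ-filter {x ∷ xs} {S} (x≢ ∷ U) p with ∈-++⁻ (map (x ∷_) (sublists xs)) p
  ... | inj₂ q with χ S x in e
  ... | true = ⊥-elim (All.lookup x≢ (sublists-⊆ xs q (χ-∈ e)) refl)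
  ... | false = χ-filter U q
  χ-filter {x ∷ xs} {S} (x≢ ∷ U) p | inj₁ q with ∈-map⁻ (x ∷_) q
  ... | S′ , S′∈ , refl with χ (x ∷ S′) x in e
  ... | false = ⊥-elim (true≢false (∈-χ {x ∷ S′} (here refl)) e)
  ... | true = cong (x ∷_) (trans (filterᵇ-cong xs same) (χ-filter U S′∈))
    where
    same : ∀ {y} → y ∈ xs → χ (x ∷ S′) y ≡ χ S′ y
    same {y} y∈ = bool-ext down (λ t → ∈-χ (there (χ-∈ t)))
      where
      down : χ (x ∷ S′) y ≡ true → χ S′ y ≡ true
      down t with χ-∈ {x ∷ S′} t
      ... | here refl = ⊥-elim (All.lookup x≢ y∈ refl)
      ... | there r = ∈-χ r

lookup-unique : ∀ {A : Set} {xs : List A} → Unique xs → ∀ {i j} → List.lookup xs i ≡ List.lookup xs j → i ≡ j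
lookup-unique {xs = x ∷ xs} (x≢ ∷ U) {zero} {zero} e = refl
lookup-unique {xs = x ∷ xs} (x≢ ∷ U) {zero} {suc j} e = ⊥-elim (All.lookup x≢ (∈-lookup j) e)
lookup-unique {xs = x ∷ xs} (x≢ ∷ U) {suc i} {zero} e = ⊥-elim (All.lookup x≢ (∈-lookup i) (sym e))
lookup-unique {xs = x ∷ xs} (x≢ ∷ U) {suc i} {suc j} e = cong suc (lookup-unique U e)

injection-bound : ∀ {A : Set} {xs : List A} {M} → Unique xs → (c : A → Fin M) →
  (∀ {a b} → a ∈ xs → b ∈ xs → c a ≡ c b → a ≡ b) → length xs ≤ M
injection-bound {xs = xs} U c inj = injective⇒≤ {f = c ∘ List.lookup xs} λ {i} {j} e →
  lookup-unique U (inj (∈-lookup i) (∈-lookup j) e)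

number : ∀ {k n} → Vec (Fin k) n → Fin (k ^ n)
number [] = zero
number (a ∷ v) = combine a (number v)

number-injective : ∀ {k n} (v w : Vec (Fin k) n) → number v ≡ number w → v ≡ w
number-injective [] [] e = refl
number-injective (a ∷ v) (b ∷ w) e with combine-injective a (number v) b (number w) e
... | p , q = cong₂ _∷_ p (number-injective v w q)

fromBool : Bool → Fin 2
fromBool false = zero
fromBool true = suc zero

fromBool-injective : ∀ {a b} → fromBool a ≡ fromBool b → a ≡ b
fromBool-injective {false} {false} _ = refl
fromBool-injective {true} {true} _ = refl

map-injective : ∀ {A B : Set} {f : A → B} → (∀ {a b} → f a ≡ f b → a ≡ b) → ∀ {n} (v w : Vec A n) → Vec.map f v ≡ Vec.map f w → v ≡ w
map-injective i [] [] e = refl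
map-injective i (a ∷ v) (b ∷ w) e = cong₂ _∷_ (i (proj₁ (∷-injective e))) (map-injective i v w (proj₂ (∷-injective e)))

_≟ⱽ_ : ∀ {m n} (u v : Vert m n) → Dec (u ≡ v)
_≟ⱽ_ = Product.≡-dec (Vec.≡-dec _≟ˢ_) (Vec.≡-dec _≟_)

module Count (m n e : ℕ) (eq : 2 * m + n ≡ suc (suc e)) (K : Cover (suc e)) where

  open Characteristic (_≟ⱽ_ {m} {n})

  codesets : List (List (Vert m n))
  codesets = filterᵇ (isMDS m n) (sublists (verts m n))

  codesets-unique : Unique codesets
  codesets-unique = Unique.filter⁺ (T? ∘ isMDS m n) (sublists-unique (verts-unique m n))

  filtered : ∀ {S} → S ∈ codesets → filterᵇ (χ S) (verts m n) ≡ S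
  filtered S∈ = χ-filter (verts-unique m n) (proj₁ (∈-filterᵇ⁻ (isMDS m n) (sublists (verts m n)) S∈))

  χ-MDS : ∀ {S} → S ∈ codesets → MDS (suc e) (χ S)
  χ-MDS {S} S∈ with ∧-true {independent S} (proj₂ (∈-filterᵇ⁻ (isMDS m n) (sublists (verts m n)) S∈))
  ... | ind , len = indep , (begin
    size (χ S) ≡⟨ length-filterᵇ (χ S) (verts m n) ⟨
    length (filterᵇ (χ S) (verts m n)) ≡⟨ cong length (filtered S∈) ⟩
    length S ≡⟨ ≡ᵇ⇒≡ _ _ (Equivalence.from T-≡ len) ⟩
    4 ^ (2 * m + n ∸ 1) ≡⟨ cong (λ d → 4 ^ (d ∸ 1)) eq ⟩
    4 ^ suc e ∎)
    where
    open ≡-Reasoning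
    indep : Independent (χ S)
    indep u v p q with adjD u v | allᵇ-elim (λ v → not (adjD u v)) S (allᵇ-elim (λ u → allᵇ (λ v → not (adjD u v)) S) S ind (χ-∈ p)) (χ-∈ q)
    ... | false | _ = refl

  latinᵒ : List (Vert m n) → Point (suc e) → Fin 4
  latinᵒ S = latin-of m eq (χ S)

  latins : List (Point (suc e) → Fin 4)
  latins = map latinᵒ codesets

  latins-latin : ∀ {f} → f ∈ latins → Latin f
  latins-latin f∈ with ∈-map⁻ latinᵒ f∈
  ... | S , S∈ , refl = latin-of-latin m eq (χ S) (χ-MDS S∈)

  open Codes latins latins-latin K
  open Cover K

  -- There are 256 = 4^4 = 2^8 possible colour vectors on one axis.
  code : List (Vert m n) → Fin (2 ^ code-length chains * 256 ^ suc e)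
  code S = combine (number (Vec.map fromBool (codes (latinᵒ S) chains))) (number (Vec.map number (axes (latinᵒ S))))

  code-injective : ∀ {S T} → S ∈ codesets → T ∈ codesets → code S ≡ code T → S ≡ T
  code-injective {S} {T} S∈ T∈ c≡ with combine-injective _ _ _ _ c≡
  ... | p , q = trans (sym (filtered S∈)) (trans (filterᵇ-cong (verts m n) λ {v} _ →
      latin-of-injective m eq (χ S) (χ T) (χ-MDS S∈) (χ-MDS T∈) same v) (filtered T∈))
    where
    same : ∀ x → latinᵒ S x ≡ latinᵒ T x
    same = codes-injective (∈-map⁺ latinᵒ S∈) (∈-map⁺ latinᵒ T∈)
      (map-injective fromBool-injective _ _ (number-injective _ _ p))
      (map-injective (number-injective _ _) _ _ (number-injective _ _ q))

  N-bound : N m n ≤ 2 ^ (code-length chains + 8 * suc e)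
  N-bound = ≤-trans (injection-bound codesets-unique code code-injective)
    (≤-reflexive (trans (cong (2 ^ code-length chains *_) (^-*-assoc 2 8 (suc e))) (sym (^-distribˡ-+-* 2 (code-length chains) (8 * suc e)))))

-- The lower bound: free choices of sides in bipartite products

high odd : Fin 4 → Bool
high 𝟎 = false
high 𝟏 = false
high 𝟐 = true
high 𝟑 = true
odd 𝟎 = false
odd 𝟏 = true
odd 𝟐 = false
odd 𝟑 = true

digits : Bool → Bool → Fin 4
digits false false = 𝟎
digits false true = 𝟏
digits true false = 𝟐
digits true true = 𝟑

high-digits : ∀ h o → high (digits h o) ≡ h
high-digits false false = refl
high-digits false true = refl
high-digits true false = refl
high-digits true true = refl

odd-digits : ∀ h o → odd (digits h o) ≡ o
odd-digits false false = refl
odd-digits false true = refl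
odd-digits true false = refl
odd-digits true true = refl

-- The vertices with the same label form a product of 4-cycles (rows of Sh) and edges; the side of a vertex
-- is its class in the bipartition of that product, and an edge between two products changes the parity.
parity side : ∀ {m n} → Vec ShV m → Vec (Fin 4) n → Bool
parity [] [] = false
parity [] (a ∷ k) = high a xor parity [] k
parity ((x , y) ∷ s) k = odd y xor parity s k
side [] [] = false
side [] (a ∷ k) = odd a xor side [] k
side ((x , y) ∷ s) k = odd x xor side s k

label : ∀ {m n} → Vec ShV m → Vec (Fin 4) n → Vec Bool (m * 2 + n)
label [] k = Vec.map high k
label ((x , y) ∷ s) k = odd y ∷ high y ∷ label s k

xor-cancelˡ : ∀ c {a b} → c xor a ≡ c xor b → a ≡ b
xor-cancelˡ false e = e
xor-cancelˡ true {false} {false} e = refl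
xor-cancelˡ true {true} {true} e = refl

xor-cancelʳ : ∀ c {a b} → a xor c ≡ b xor c → a ≡ b
xor-cancelʳ c {false} {false} e = refl
xor-cancelʳ c {true} {true} e = refl
xor-cancelʳ false {false} {true} ()
xor-cancelʳ true {false} {true} ()
xor-cancelʳ false {true} {false} ()
xor-cancelʳ true {true} {false} ()

xor-self : ∀ a → a xor a ≡ false
xor-self false = refl
xor-self true = refl

not-xor : ∀ a → not a xor a ≡ true
not-xor false = refl
not-xor true = refl

adj-cons-Sh : ∀ {m n} (s s′ : Vec ShV m) (k k′ : Vec (Fin 4) n) u u′ → adjD (u ∷ s , k) (u′ ∷ s′ , k′) ≡ true →
  (u ≡ u′ × adjD (s , k) (s′ , k′) ≡ true) ⊎ (s ≡ s′ × k ≡ k′ × adjSh u u′ ≡ true)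
adj-cons-Sh s s′ k k′ u u′ e with ∨-true {adjProd eqSh adjSh (u ∷ s) (u′ ∷ s′) ∧ eqVec eqF k k′} e
... | inj₁ p with ∧-true {adjProd eqSh adjSh (u ∷ s) (u′ ∷ s′)} p
... | q , r with ∨-true {adjSh u u′ ∧ eqVec eqSh s s′} q
... | inj₁ t with ∧-true {adjSh u u′} t
... | t₁ , t₂ = inj₂ (eqVec-sound eqSh-sound t₂ , eqVec-sound eqF-sound r , t₁)
adj-cons-Sh s s′ k k′ u u′ e | inj₁ p | q , r | inj₂ t with ∧-true {eqSh u u′} t
... | t₁ , t₂ = inj₁ (eqSh-sound t₁ , ∨-introˡ _ (∧-intro t₂ r))
adj-cons-Sh s s′ k k′ u u′ e | inj₂ p with ∧-true {eqSh u u′ ∧ eqVec eqSh s s′} p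
... | q , r with ∧-true {eqSh u u′} q
... | q₁ , q₂ = inj₁ (eqSh-sound q₁ , ∨-introʳ (adjProd eqSh adjSh s s′ ∧ eqVec eqF k k′) (∧-intro q₂ r))

abstract
  -- Only the differences ±(1,0) keep the parity of y; they stay in the row and flip the parity of
  -- x.
  edge-Sh : ∀ x y x′ y′ → adjSh (x , y) (x′ , y′) ≡ true → odd y ≢ odd y′ ⊎ (y ≡ y′ × odd x ≢ odd x′)
  edge-Sh = from-yes (all? λ x → all? λ y → all? λ x′ → all? λ y′ → (adjSh (x , y) (x′ , y′) ≟ᵇ true) →-dec
    (¬? (odd y ≟ᵇ odd y′) ⊎-dec ((y ≟ y′) ×-dec ¬? (odd x ≟ᵇ odd x′))))

  edge-K : ∀ a a′ → a ≢ a′ → high a ≢ high a′ ⊎ (high a ≡ high a′ × odd a ≢ odd a′)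
  edge-K = from-yes (all? λ a → all? λ a′ → ¬? (a ≟ a′) →-dec (¬? (high a ≟ᵇ high a′) ⊎-dec ((high a ≟ᵇ high a′) ×-dec ¬? (odd a ≟ᵇ odd a′))))

-- An edge moves one coordinate: either it flips the parity, or it stays in the product and flips
-- the side.
edge : ∀ {m n} (s s′ : Vec ShV m) (k k′ : Vec (Fin 4) n) → adjD (s , k) (s′ , k′) ≡ true → parity s k ≡ parity s′ k′ →
  label s k ≡ label s′ k′ × side s k ≢ side s′ k′
edge [] [] [] [] () _
edge [] [] (a ∷ k) (a′ ∷ k′) e p with adj-cons [] [] k k′ a a′ e
... | inj₁ (refl , e′) with edge [] [] k k′ e′ (xor-cancelˡ (high a) p)
... | q , r = cong (high a ∷_) q , r ∘ xor-cancelˡ (odd a)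
edge [] [] (a ∷ k) (a′ ∷ k′) e p | inj₂ (_ , refl , a≢a′) with edge-K a a′ a≢a′
... | inj₁ q = ⊥-elim (q (xor-cancelʳ (parity [] k) p))
... | inj₂ (q , r) = cong (_∷ _) q , r ∘ xor-cancelʳ (side [] k)
edge ((x , y) ∷ s) ((x′ , y′) ∷ s′) k k′ e p with adj-cons-Sh s s′ k k′ (x , y) (x′ , y′) e
... | inj₁ (refl , e′) with edge s s′ k k′ e′ (xor-cancelˡ (odd y) p)
... | q , r = cong (λ l → odd y ∷ high y ∷ l) q , r ∘ xor-cancelˡ (odd x)
edge ((x , y) ∷ s) ((x′ , y′) ∷ s′) k k′ e p | inj₂ (refl , refl , e′) with edge-Sh x y x′ y′ e′
... | inj₁ q = ⊥-elim (q (xor-cancelʳ (parity s k) p))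
... | inj₂ (refl , r) = refl , r ∘ xor-cancelʳ (side s k)

unlabel : ∀ m {n} → Vec Bool (m * 2 + n) → Vert m n
unlabel zero t = [] , Vec.map (λ h → digits h false) t
unlabel (suc m) (o ∷ h ∷ t) with unlabel m t
... | s , k = (𝟎 , digits h o) ∷ s , k

label-unlabel : ∀ m {n} (t : Vec Bool (m * 2 + n)) → label (proj₁ (unlabel m t)) (proj₂ (unlabel m t)) ≡ t
label-unlabel zero [] = refl
label-unlabel zero (h ∷ t) = cong₂ _∷_ (high-digits h false) (label-unlabel zero t)
label-unlabel (suc m) (o ∷ h ∷ t) = cong₂ _∷_ (odd-digits h o) (cong₂ _∷_ (high-digits h o) (label-unlabel m t))

filterᵇ-sublist : ∀ {A : Set} (p : A → Bool) xs → filterᵇ p xs ∈ sublists xs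
filterᵇ-sublist p [] = here refl
filterᵇ-sublist p (x ∷ xs) with p x
... | true = ∈-++⁺ˡ (∈-map⁺ (x ∷_) (filterᵇ-sublist p xs))
... | false = ∈-++⁺ʳ (map (x ∷_) (sublists xs)) (filterᵇ-sublist p xs)

number-surjective : ∀ {k n} (c : Fin (k ^ n)) → ∃ λ (v : Vec (Fin k) n) → number v ≡ c
number-surjective {n = zero} zero = [] , refl
number-surjective {k} {suc n} c with number-surjective {k} {n} (proj₂ (remQuot {k} (k ^ n) c))
... | v , e = proj₁ (remQuot {k} (k ^ n) c) ∷ v , trans (cong (combine (proj₁ (remQuot {k} (k ^ n) c))) e) (combine-remQuot {k} (k ^ n) c)

toBool : Fin 2 → Bool
toBool zero = false
toBool (suc _) = true

toBool-injective : ∀ {a b} → toBool a ≡ toBool b → a ≡ b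
toBool-injective {zero} {zero} _ = refl
toBool-injective {suc zero} {suc zero} _ = refl

fromBool-toBool : ∀ {n} (v : Vec (Fin 2) n) → Vec.map fromBool (Vec.map toBool v) ≡ v
fromBool-toBool [] = refl
fromBool-toBool (zero ∷ v) = cong (zero ∷_) (fromBool-toBool v)
fromBool-toBool (suc zero ∷ v) = cong (suc zero ∷_) (fromBool-toBool v)

same : Bool → Bool → Bool
same a b = not (a xor b)

same-sound : ∀ {a b} → same a b ≡ true → a ≡ b
same-sound {false} {false} _ = refl
same-sound {true} {true} _ = refl

selects : ∀ {m n e} → (Vert m n → Vec Bool e) → (Vec Bool e → Bool) → Vert m n → Bool
selects ρ β (s , k) = not (parity s k) ∧ same (side s k) (β (ρ (s , k)))

-- In both uses ρ is the label without its first bit. Even parity restores that bit, so the 2^e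
-- values of ρ index the even products. The bit comes from a K₄ factor if m is 0 and from a
-- Shrikhande factor otherwise, which is why ρ is a parameter.
module Lower {m n e : ℕ} (ρ : Vert m n → Vec Bool e)
  (ρ-edge : ∀ u v → label (proj₁ u) (proj₂ u) ≡ label (proj₁ v) (proj₂ v) → ρ u ≡ ρ v)
  (balanced : ∀ β → total (indicator ∘ selects ρ β) (verts m n) ≡ 4 ^ (2 * m + n ∸ 1))
  (reached : ∀ t → ∃ λ v → parity (proj₁ v) (proj₂ v) ≡ false × ρ v ≡ t × side (proj₁ v) (proj₂ v) ≡ true) where

  codeset : (Vec Bool e → Bool) → List (Vert m n)
  codeset β = filterᵇ (selects ρ β) (verts m n)

  selects-independent : ∀ β u v → selects ρ β u ≡ true → selects ρ β v ≡ true → adjD u v ≡ false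
  selects-independent β (s , k) (s′ , k′) p q = not-true λ a → contradiction a (∧-true {not (parity s k)} p) (∧-true {not (parity s′ k′)} q)
    where
    contradiction : adjD (s , k) (s′ , k′) ≡ true → _ → _ → ⊥
    contradiction a (p₁ , p₂) (q₁ , q₂) with edge s s′ k k′ a (trans (sym (not-involutive _)) (trans (cong not (trans p₁ (sym q₁))) (not-involutive _)))
    ... | l , d = d (trans (same-sound p₂) (trans (cong β (ρ-edge (s , k) (s′ , k′) l)) (sym (same-sound q₂))))

  codeset-∈ : ∀ β → codeset β ∈ filterᵇ (isMDS m n) (sublists (verts m n))
  codeset-∈ β = ∈-filterᵇ⁺ (isMDS m n) (filterᵇ-sublist (selects ρ β) (verts m n)) (∧-intro
    (allᵇ-intro _ (codeset β) λ {u} u∈ → allᵇ-intro _ (codeset β) λ {v} v∈ → cong not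
      (selects-independent β u v (proj₂ (∈-filterᵇ⁻ (selects ρ β) (verts m n) u∈)) (proj₂ (∈-filterᵇ⁻ (selects ρ β) (verts m n) v∈))))
    (Equivalence.to T-≡ (≡⇒≡ᵇ _ _ (trans (length-filterᵇ (selects ρ β) (verts m n)) (balanced β)))))

  -- At an even vertex on the side `true`, membership in the code is the value of the choice
  -- function; `reached` gives such a vertex for every index.
  codeset-injective : ∀ β γ → codeset β ≡ codeset γ → ∀ t → β t ≡ γ t
  codeset-injective β γ e t with reached t
  ... | (s , k) , p , refl , q = trans (value β) (trans (filterᵇ-injective (selects ρ β) (selects ρ γ) (verts m n) e (∈-verts (s , k))) (sym (value γ)))
    where
    value : ∀ β → β (ρ (s , k)) ≡ selects ρ β (s , k)
    value β rewrite p | q = sym (not-involutive _)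

  table-of : Vec (Fin 2) (2 ^ e) → Vec Bool e → Bool
  table-of v t = toBool (lookup v (number (Vec.map fromBool t)))

  table-of-injective : ∀ v w → (∀ t → table-of v t ≡ table-of w t) → v ≡ w
  table-of-injective v w h = lookup-ext v w λ i → entry i (number-surjective i)
    where
    entry : ∀ i → (∃ λ (u : Vec (Fin 2) e) → number u ≡ i) → lookup v i ≡ lookup w i
    entry i (u , refl) = subst (λ u → lookup v (number u) ≡ lookup w (number u)) (fromBool-toBool u) (toBool-injective (h (Vec.map toBool u)))

  many : 2 ^ (2 ^ e) ≤ N m n
  many = injective⇒≤ {f = λ i → index (codeset-∈ (β i))} λ {i} {j} p →
    trans (sym (proj₂ (vector i))) (trans (cong number (table-of-injective (proj₁ (vector i)) (proj₁ (vector j)) (codeset-injective (β i) (β j)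
      (trans (lookup-index (codeset-∈ (β i))) (trans (cong (List.lookup (filterᵇ (isMDS m n) (sublists (verts m n)))) p) (sym (lookup-index (codeset-∈ (β j))))))))) (proj₂ (vector j)))
    where
    vector : ∀ i → ∃ λ (v : Vec (Fin 2) (2 ^ e)) → number v ≡ i
    vector i = number-surjective i
    β : Fin (2 ^ (2 ^ e)) → Vec Bool e → Bool
    β i = table-of (proj₁ (vector i))

-- Parity fixes the high bit of the first digit and the chosen side its low bit.
one-digit : ∀ c d b → total (λ a → indicator (not (high a xor c) ∧ same (odd a xor d) b)) (allFin 4) ≡ 1
one-digit false false false = refl
one-digit false false true = refl
one-digit false true false = refl
one-digit false true true = refl
one-digit true false false = refl
one-digit true false true = refl
one-digit true true false = refl
one-digit true true true = refl

choose : Bool → Bool → Bool → Bool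
choose b₀ b₁ false = b₀
choose b₀ b₁ true = b₁

choose-η : ∀ (β : Bool → Bool) h → β h ≡ choose (β false) (β true) h
choose-η β false = refl
choose-η β true = refl

-- Parity fixes the low bit of y. For both remaining values of y the chosen side fixes the low bit
-- of x, which leaves 2 * 2 vertices.
four-vertices : ∀ c d (β : Bool → Bool) →
  total (λ v → indicator (not (odd (proj₂ v) xor c) ∧ same (odd (proj₁ v) xor d) (β (high (proj₂ v))))) shs ≡ 4
four-vertices c d β = trans (total-cong (λ v → cong (λ b → indicator (not (odd (proj₂ v) xor c) ∧ same (odd (proj₁ v) xor d) b)) (choose-η β (high (proj₂ v)))) shs)
  (cases c d (β false) (β true))
  where
  cases : ∀ c d b₀ b₁ → total (λ v → indicator (not (odd (proj₂ v) xor c) ∧ same (odd (proj₁ v) xor d) (choose b₀ b₁ (high (proj₂ v))))) shs ≡ 4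
  cases false false false false = refl
  cases false false false true = refl
  cases false false true false = refl
  cases false false true true = refl
  cases false true false false = refl
  cases false true false true = refl
  cases false true true false = refl
  cases false true true true = refl
  cases true false false false = refl
  cases true false false true = refl
  cases true false true false = refl
  cases true false true true = refl
  cases true true false false = refl
  cases true true false true = refl
  cases true true true false = refl
  cases true true true true = refl

lower-Hamming : ∀ e → 2 ^ (2 ^ e) ≤ N 0 (suc e)
lower-Hamming e = Lower.many ρ (λ { ([] , _ ∷ _) ([] , _ ∷ _) → cong tail }) balanced reached
  where
  ρ : Vert 0 (suc e) → Vec Bool e
  ρ (s , k) = tail (label s k)
  balanced : ∀ β → total (indicator ∘ selects ρ β) (verts 0 (suc e)) ≡ 4 ^ e
  balanced β = trans (total-second ([] ∷ []) (allFin 4) (indicator ∘ selects ρ β))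
    (trans (total-cong (λ { ([] , k) → one-digit (parity [] k) (side [] k) (β (Vec.map high k)) }) (verts 0 e))
      (trans (total-const 1 (verts 0 e)) (trans (*-identityʳ _) (length-verts 0 e))))
  reached : ∀ t → ∃ λ v → parity (proj₁ v) (proj₂ v) ≡ false × ρ v ≡ t × side (proj₁ v) (proj₂ v) ≡ true
  reached t = ([] , digits (parity [] k) (not (side [] k)) ∷ k) ,
    trans (cong (_xor parity [] k) (high-digits (parity [] k) (not (side [] k)))) (xor-self (parity [] k)) ,
    label-unlabel 0 t ,
    trans (cong (_xor side [] k) (odd-digits (parity [] k) (not (side [] k)))) (not-xor (side [] k))
    where
    k : Vec (Fin 4) e
    k = proj₂ (unlabel 0 t)

lower-Doob : ∀ m n → 2 ^ (2 ^ suc (m * 2 + n)) ≤ N (suc m) n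
lower-Doob m n = Lower.many ρ (λ { (_ ∷ _ , _) (_ ∷ _ , _) → cong tail }) balanced reached
  where
  ρ : Vert (suc m) n → Vec Bool (suc (m * 2 + n))
  ρ (s , k) = tail (label s k)
  balanced : ∀ β → total (indicator ∘ selects ρ β) (verts (suc m) n) ≡ 4 ^ (2 * suc m + n ∸ 1)
  balanced β = trans (total-first shs (vecs (allFin 4) n) (indicator ∘ selects ρ β))
    (trans (total-cong (λ { (s , k) → four-vertices (parity s k) (side s k) (λ h → β (h ∷ label s k)) }) (verts m n))
      (trans (total-const 4 (verts m n)) (trans (cong (_* 4) (length-verts m n)) (trans (*-comm (4 ^ (2 * m + n)) 4)
        (cong (4 ^_) (cong (_∸ 1) (solve 2 (λ m n → con 2 :+ (con 2 :* m :+ n) := con 2 :* (con 1 :+ m) :+ n) refl m n)))))))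
    where open +-*-Solver
  reached : ∀ t → ∃ λ v → parity (proj₁ v) (proj₂ v) ≡ false × ρ v ≡ t × side (proj₁ v) (proj₂ v) ≡ true
  reached (h ∷ t) with unlabel m t | label-unlabel m t
  ... | s , k | q = ((digits false (not (side s k)) , digits h (parity s k)) ∷ s , k) ,
    trans (cong (_xor parity s k) (odd-digits h (parity s k))) (xor-self (parity s k)) ,
    cong₂ _∷_ (high-digits h (parity s k)) q ,
    trans (cong (_xor side s k) (odd-digits false (not (side s k)))) (not-xor (side s k))

lower-bound : ∀ m n → 2 * m + n ≥ 1 → 2 ^ (2 ^ (2 * m + n ∸ 1)) ≤ N m n
lower-bound zero (suc n) _ = lower-Hamming n
lower-bound (suc m) n _ = subst (λ d → 2 ^ (2 ^ d) ≤ N (suc m) n)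
  (cong (_∸ 1) (solve 2 (λ m n → con 2 :+ (m :* con 2 :+ n) := con 2 :* (con 1 :+ m) :+ n) refl m n)) (lower-Doob m n)
  where open +-*-Solver

-- Here 1/k plays the part of the error bound: log₂ N lies between 1 - 1/k and 1 + 1/k times
-- 2^(2m+n-1), and the k-th power clears the fractions.
theorem1 : (k : ℕ) → k ≥ 1 →
    Σ ℕ (λ d₀ → (m n : ℕ) → 2 * m + n ≥ d₀ →
    (2 ^ ((k ∸ 1) * 2 ^ (2 * m + n ∸ 1)) ≤ N m n ^ k)
    × (N m n ^ k ≤ 2 ^ ((k + 1) * 2 ^ (2 * m + n ∸ 1))))
theorem1 k k≥1 with economical-cover k k≥1
-- The Latin functions have 2m + n - 1 = suc (d + r) coordinates, which is positive and at least d,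
-- as `Count` and `covers` require.
... | d , covers = 2 + d , λ m n d≤ → lower m n (≤-trans (s≤s z≤n) d≤) , upper m n _ (sym (m+[n∸m]≡n d≤))
  where
  open ≤-Reasoning
  lower : ∀ m n → 2 * m + n ≥ 1 → 2 ^ ((k ∸ 1) * 2 ^ (2 * m + n ∸ 1)) ≤ N m n ^ k
  lower m n d≥1 = begin
    -- The lower bound has no error term of its own; passing from k to k ∸ 1 only weakens it.
    2 ^ ((k ∸ 1) * D) ≤⟨ ^-monoʳ-≤ 2 (*-monoˡ-≤ D (m∸n≤m k 1)) ⟩
    2 ^ (k * D) ≡⟨ cong (2 ^_) (*-comm k D) ⟩
    2 ^ (D * k) ≡⟨ ^-*-assoc 2 D k ⟨
    (2 ^ D) ^ k ≤⟨ ^-monoˡ-≤ k (lower-bound m n d≥1) ⟩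
    N m n ^ k ∎
    where
    D = 2 ^ (2 * m + n ∸ 1)
  upper : ∀ m n r → 2 * m + n ≡ 2 + d + r → N m n ^ k ≤ 2 ^ ((k + 1) * 2 ^ (2 * m + n ∸ 1))
  upper m n r eq with covers (suc (d + r)) (≤-trans (m≤m+n d r) (n≤1+n _))
  ... | K , bound = begin
    N m n ^ k ≤⟨ ^-monoˡ-≤ k (Count.N-bound m n (d + r) eq K) ⟩
    (2 ^ W) ^ k ≡⟨ ^-*-assoc 2 W k ⟩
    2 ^ (W * k) ≡⟨ cong (2 ^_) (*-comm W k) ⟩
    2 ^ (k * W) ≤⟨ ^-monoʳ-≤ 2 bound ⟩
    2 ^ ((k + 1) * 2 ^ suc (d + r)) ≡⟨ cong (λ s → 2 ^ ((k + 1) * 2 ^ (s ∸ 1))) eq ⟨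
    2 ^ ((k + 1) * 2 ^ (2 * m + n ∸ 1)) ∎
    where
    W = code-length (Cover.chains K) + 8 * suc (d + r)
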